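{- There exists an $(\mathbb{F}_{17}\times\mathbb{F}_q,\mathbb{F}_{17}\times\{0\},17,1)$-DF for every prime $q\equiv 1 \pmod{16}$ such that either $q>Q(4,13)$ (numerically $Q(4,13)\approx 3.44807\times 10^{17}$), or $q\in S_{17}$, or $6673\leq q\leq 9857$, where $S_{17}=\{17, 881, 1297, 1601, 1873, 2017, 2129, 2657, 2753, 2801, 2897, 3089, 3121, 3217, 3313, 3361, 3617, 3697, 3761, 3793, 3889, 4001, 4049, 4129, 4241, 4273, 4289, 4481, 4561, 4657, 4721, 4801, 4817, 4993, 5009, 5233, 5281, 5297, 5393, 5441, 5521, 5569, 5857, 5953, 6113, 6257, 6337, 6449, 6529\}$.
   Context: For an additive group $G$ with a subgroup $N$, a $(G,N,k,\lambda)$ relative difference family (DF) is a multiset $[B_1,\dots,B_r]$ of $k$-subsets of $G$ such that the multiset $\bigcup_{i}[x-y: x,y\in B_i, x\neq y]$ contains every element of $G\setminus N$ exactly $\lambda$ times and no element of $N$. For positive integers $d,m$, $Q(d,m)=\frac{1}{4}\left(U+\sqrt{U^2+4d^{m-1}m}\right)^2$ where $U=\sum_{h=1}^m \binom{m}{h}(d-1)^h(h-1)$. -}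

module Defs where

open import Data.Nat using (ℕ; zero; suc; _+_; _*_; _∸_; _^_; _<_; _≤_)
open import Data.Nat.DivMod using (_mod_)
open import Data.Nat.Combinatorics using (_C_)
open import Data.Fin using (Fin; toℕ)
open import Data.Fin.Properties using () renaming (_≟_ to _≟F_)
open import Data.Product using (_×_; _,_; proj₁; proj₂)
open import Data.Product.Properties using (≡-dec)
open import Data.List using (List; []; _∷_; map; allFin; upTo)
open import Data.Nat.ListAction using (sum)
open import Data.List.Relation.Unary.All using (All)
open import Data.Bool using (if_then_else_)
open import Relation.Nullary using (¬_)
open import Relation.Nullary.Decidable using (⌊_⌋)
open import Relation.Binary.PropositionalEquality using (_≡_)
open import Function.Definitions using (Injective)

-- The cyclic group Z/n (additive group of F_n for n prime), as Fin n.

subMod : ∀ {n} → Fin n → Fin n → Fin n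
subMod {suc k} a b = (toℕ a + (suc k ∸ toℕ b)) mod (suc k)

Grp : ℕ → ℕ → Set
Grp p q = Fin p × Fin q

_-G_ : ∀ {p q} → Grp p q → Grp p q → Grp p q
(a , b) -G (c , d) = subMod a c , subMod b d

_≟G_ : ∀ {p q} (x y : Grp p q) → _
_≟G_ = ≡-dec _≟F_ _≟F_

InN : ∀ {p q} → Grp p q → Set
InN (a , b) = toℕ b ≡ 0

-- A k-subset of G, given as an injective enumeration Fin k → G.
Block : ℕ → ℕ → ℕ → Set
Block p q k = Fin k → Grp p q

IsKSubset : ∀ {p q k} → Block p q k → Set
IsKSubset B = Injective _≡_ _≡_ B

diffCountBlock : ∀ {p q k} → Block p q k → Grp p q → ℕ
diffCountBlock {k = k} B g =
  sum (map (λ i → sum (map (λ j →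
      if ⌊ i ≟F j ⌋ then 0 else (if ⌊ (B i -G B j) ≟G g ⌋ then 1 else 0))
    (allFin k))) (allFin k))

diffCount : ∀ {p q k} → List (Block p q k) → Grp p q → ℕ
diffCount F g = sum (map (λ B → diffCountBlock B g) F)

IsRelDF : (p q k lam : ℕ) → List (Block p q k) → Set
IsRelDF p q k lam F =
  All IsKSubset F ×
  (∀ (g : Grp p q) → (InN g → diffCount F g ≡ 0) × (¬ InN g → diffCount F g ≡ lam))

-- Q(d,m) = (1/4)(U + sqrt(U^2 + 4 d^(m-1) m))^2,
-- U = Σ_{h=1}^m C(m,h) (d-1)^h (h-1)   (all terms are natural numbers).

U : ℕ → ℕ → ℕ
U d m = sum (map (λ h → (m C h) * ((d ∸ 1) ^ h) * (h ∸ 1)) (map suc (upTo m)))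

-- "q > Q(d,m)" for a natural number q, expressed without reals.
-- With c = d^(m-1) m ≥ 0 and U ≥ 0:
--   q > Q  ⇔  2√q > U + √(U²+4c)  ⇔  q - c > U √q  ⇔  c < q ∧ U² q < (q - c)².
GtQ : ℕ → ℕ → ℕ → Set
GtQ d m q = (c < q) × (U d m * U d m * q < (q ∸ c) * (q ∸ c))
  where c = d ^ (m ∸ 1) * m

{-# OPTIONS --safe #-}
-- Let ι² = -1 in F_q and let χ be the quartic character, with values in the fourth roots of unity of F_q. For nonzero
-- b₁, b₂, b₄, b₈ put B = {(0,0)} ∪ {(s, ± b_s), (-s, ± ι b_s) : s = 1, 2, 4, 8}. For each h in F_17 the second
-- coordinates of the differences (h, *) of B are the products of the powers of ι with four forms in the b_s. If χ
-- separates the four forms for every h, then the blocks (1, s) B, with s running over the fourth powers modulo the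
-- powers of ι, form a difference family: q ≡ 1 (mod 16) makes the powers of ι fourth powers. For small q suitable b_s
-- are tabulated. For large q they are chosen one after the other, the last subject to conditions on χ at 13 linear
-- polynomials which cut out a coset of index 2^21. The number of solutions is a combination of 2^21 character sums,
-- and Stepanov's method bounds the nontrivial ones: a polynomial of small degree vanishing to high order wherever the
-- character takes a given value exists by counting coefficients, and its degree limits how often that value occurs.
-- This is weaker than Weil's bound by a constant factor which the size of q absorbs.
module Submission where

open import Defs
open import Data.Nat as ℕ using (ℕ; zero; suc; _≤_; _<_; z≤n; s≤s; NonZero; _%_; _/_; _∸_)
import Data.Nat.Properties as ℕ
open import Data.Nat.Combinatorics using (_C_; nCk+nC[k+1]≡[n+1]C[k+1]; nC1≡n; nCn≡1)
open import Data.Nat.Divisibility using (_∣_; divides; _∣?_; m%n≡0⇒n∣m; n∣m⇒m%n≡0; ∣⇒≤; ∣-refl)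
open import Data.Nat.DivMod using (_mod_; %-distribˡ-+; %-distribˡ-*; m%n%n≡m%n; n%n≡0; m%n<n; m<n⇒m%n≡m; m≡m%n+[m/n]*n; [m+kn]%n≡m%n; m<n*o⇒m/o<n)
open import Data.Nat.ListAction using () renaming (sum to sumℕ)
open import Data.Nat.Primality using (Prime; euclidsLemma; prime⇒nonZero; prime⇒nonTrivial; prime⇒irreducible)
open import Data.Nat.Solver using (module +-*-Solver)
open import Data.Fin as Fin using (Fin; toℕ; fromℕ<; zero; suc; combine; remQuot; finToFun; funToFin; #_)
open import Data.Fin.Patterns
import Data.Fin.Properties as Fin
open import Data.Bool as Bool using (if_then_else_; true; false)
open import Data.Empty using (⊥; ⊥-elim)
open import Data.Unit using (⊤; tt)
open import Data.Maybe as Maybe using (Maybe; just; nothing)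
import Data.Maybe.Properties as Maybe
open import Data.Product using (_×_; _,_; proj₁; proj₂; ∃; uncurry)
import Data.Product.Properties as Product
open import Data.Sum using (_⊎_; inj₁; inj₂; [_,_]′)
open import Data.List as List using (List; []; _∷_; length; map; filter; allFin)
import Data.List.Properties as List
open import Data.List.Membership.Propositional using (_∈_; find; lose)
open import Data.List.Membership.Propositional.Properties using (∈-filter⁻; ∈-filter⁺; ∈-map⁻; ∈-allFin)
open import Data.List.Relation.Unary.All as All using (All; []; _∷_; all?)
import Data.List.Relation.Unary.All.Properties as All
open import Data.List.Relation.Unary.AllPairs as AllPairs using (AllPairs; []; _∷_)
open import Data.List.Relation.Unary.Any as Any using (Any; any?; here; there)
open import Data.List.Relation.Unary.Unique.Propositional using (Unique)
import Data.List.Relation.Unary.Unique.Propositional.Properties as Unique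
open import Data.Vec as Vec using (Vec; []; _∷_; lookup; _[_]≔_)
import Data.Vec.Properties as Vec
open import Algebra.Bundles using (CommutativeRing; CommutativeSemiring)
open import Algebra.Structures using (IsCommutativeRing)
import Algebra.Structures.Biased as Biased
import Algebra.Properties.CommutativeMonoid.Sum as MonoidSum
import Algebra.Properties.CommutativeSemiring.Binomial as Binomial
import Algebra.Properties.CommutativeSemiring.Exp as CExp
import Algebra.Properties.Ring as RingProperties
import Algebra.Properties.Semiring.Exp as Exp
import Algebra.Properties.Semiring.Mult as Mult
import Algebra.Properties.Semiring.Sum as Sum
import Algebra.Solver.Ring.NaturalCoefficients.Default as Solver
open import Function using (_∘_; id)
open import Level using (0ℓ)
open import Relation.Binary using (IsEquivalence; tri<; tri≈; tri>)
open import Relation.Binary.PropositionalEquality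
import Relation.Binary.Reasoning.Setoid as SetoidReasoning
open import Relation.Nullary using (¬_; Dec; yes; no; does)
open import Relation.Nullary.Decidable using (¬?; _×-dec_; _⊎-dec_; _→-dec_; ⌊_⌋; from-yes)
open import Relation.Unary using (Decidable)

-- Prime fields

-- The block is invariant under (x, y) ↦ (-x, ι y). With negation added, its differences fall into
-- orbits, each of which gives one form times all powers of ι at both h and -h; this is why four
-- forms for each h suffice.
--
-- In the rows h = 1, 2, 4, 8 one form is a single b_s and another is a multiple of 1 + ι. The class
-- of 1 + ι is given with q, so in these rows every class is fixed in advance and depends on it. The
-- rows 3, 5, 6, 7 contain only sums of two different parameters. There the forms are merely asked
-- to split into two opposite pairs, one with values ±1 and one with values ±ι.
--
-- This economy is forced. Prescribing all 13 classes for the last parameter would mean 4^13 = 2^26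
-- character sums, too many for the error term of Stepanov's bound at the threshold; the weaker
-- demands reduce the index to 4^9 · 2^3 = 2^21. Weil's bound would then need √q to be roughly 12 ·
-- 2^21, about 2.5 · 10^7, whereas the hypothesis gives √q above 5.8 · 10^8.

absorption : ∀ n k → suc k ℕ.* (suc n C suc k) ≡ suc n ℕ.* (n C k)
absorption zero    zero    = refl
absorption zero    (suc k) = ℕ.*-zeroʳ (suc (suc k))
absorption (suc n) zero    = begin
  1 ℕ.* (suc (suc n) C 1)  ≡⟨ ℕ.*-identityˡ _ ⟩
  suc (suc n) C 1          ≡⟨ nC1≡n (suc (suc n)) ⟩
  suc (suc n)              ≡⟨ ℕ.*-identityʳ _ ⟨
  suc (suc n) ℕ.* 1        ∎
  where open ≡-Reasoning
absorption (suc n) (suc k) = begin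
  K ℕ.* (suc (suc n) C K)                            ≡⟨ cong (K ℕ.*_) (nCk+nC[k+1]≡[n+1]C[k+1] (suc n) (suc k)) ⟨
  K ℕ.* (x ℕ.+ y)                                    ≡⟨ ℕ.*-distribˡ-+ K x y ⟩
  K ℕ.* x ℕ.+ K ℕ.* y                                ≡⟨ cong₂ (λ u v → x ℕ.+ u ℕ.+ v) (absorption n k) (absorption n (suc k)) ⟩
  x ℕ.+ suc n ℕ.* (n C k) ℕ.+ suc n ℕ.* (n C suc k)  ≡⟨ ℕ.+-assoc x _ _ ⟩
  x ℕ.+ (suc n ℕ.* (n C k) ℕ.+ suc n ℕ.* (n C suc k)) ≡⟨ cong (x ℕ.+_) (ℕ.*-distribˡ-+ (suc n) (n C k) _) ⟨
  x ℕ.+ suc n ℕ.* ((n C k) ℕ.+ (n C suc k))          ≡⟨ cong (λ u → x ℕ.+ suc n ℕ.* u) (nCk+nC[k+1]≡[n+1]C[k+1] n k) ⟩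
  suc (suc n) ℕ.* x                                  ∎
  where
  open ≡-Reasoning
  K = suc (suc k)
  x = suc n C suc k
  y = suc n C K

-- By `absorption` the prime divides the product of `suc k` with the coefficient, and `suc k` is too
-- small to be divisible by it.
prime∣C : ∀ {n} → Prime (suc n) → ∀ {k} → k < n → suc n ∣ (suc n C suc k)
prime∣C {n} pr {k} k<n with euclidsLemma (suc k) (suc n C suc k) pr
    (divides (n C k) (trans (absorption n k) (ℕ.*-comm (suc n) (n C k))))
... | inj₁ d = ⊥-elim (ℕ.<⇒≱ (s≤s k<n) (∣⇒≤ d))
... | inj₂ d = d

-- Arguments about the field rest on these laws alone and never unfold remainders. The way back to
-- the statement of the theorem and to numerical computation leads through `subMod≡`, `toℕ-0#` and
-- `toℕ-·1`.
record PrimeField (p : ℕ) : Set where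
  infixl 6 _+_
  infixl 7 _*_
  infix  8 -_
  field
    _+_ _*_           : Fin p → Fin p → Fin p
    -_                : Fin p → Fin p
    0# 1#             : Fin p
    isCommutativeRing : IsCommutativeRing _≡_ _+_ _*_ -_ 0# 1#
  commutativeRing : CommutativeRing 0ℓ 0ℓ
  commutativeRing = record { isCommutativeRing = isCommutativeRing }
  field
    isPrime     : Prime p
    integral    : ∀ {x y} → x * y ≡ 0# → x ≡ 0# ⊎ y ≡ 0#
    frobenius   : ∀ x → Exp._^_ (CommutativeRing.semiring commutativeRing) x p ≡ x
    subMod≡     : ∀ x y → subMod x y ≡ x + - y
    toℕ-0#      : toℕ 0# ≡ 0
    toℕ-·1      : ∀ n .{{_ : NonZero p}} →
                  toℕ (Mult._×_ (CommutativeRing.semiring commutativeRing) n 1#) ≡ n % p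

module Construct (n : ℕ) (pr : Prime (suc n)) where
  p = suc n
  F = Fin p

  φ : ℕ → F
  φ m = m mod p

  toℕ-φ : ∀ m → toℕ (φ m) ≡ m % p
  toℕ-φ m = Fin.toℕ-fromℕ< (m%n<n m p)

  φ-toℕ : ∀ x → φ (toℕ x) ≡ x
  φ-toℕ x = Fin.toℕ-injective (trans (toℕ-φ (toℕ x)) (m<n⇒m%n≡m (Fin.toℕ<n x)))

  φ-cong : ∀ a b → a % p ≡ b % p → φ a ≡ φ b
  φ-cong a b e = Fin.toℕ-injective (trans (toℕ-φ a) (trans e (sym (toℕ-φ b))))

  infixl 6 _⊕_
  infixl 7 _⊗_
  _⊕_ _⊗_ : F → F → F
  x ⊕ y = φ (toℕ x ℕ.+ toℕ y)
  x ⊗ y = φ (toℕ x ℕ.* toℕ y)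

  ⊖_ : F → F
  ⊖ x = φ (p ∸ toℕ x)

  φ-+ : ∀ a b → φ a ⊕ φ b ≡ φ (a ℕ.+ b)
  φ-+ a b = φ-cong (toℕ (φ a) ℕ.+ toℕ (φ b)) (a ℕ.+ b) (trans (cong₂ (λ u v → (u ℕ.+ v) % p) (toℕ-φ a) (toℕ-φ b)) (sym (%-distribˡ-+ a b p)))

  φ-* : ∀ a b → φ a ⊗ φ b ≡ φ (a ℕ.* b)
  φ-* a b = φ-cong (toℕ (φ a) ℕ.* toℕ (φ b)) (a ℕ.* b) (trans (cong₂ (λ u v → (u ℕ.* v) % p) (toℕ-φ a) (toℕ-φ b)) (sym (%-distribˡ-* a b p)))

  φ-p : φ p ≡ φ 0
  φ-p = φ-cong p 0 (n%n≡0 p)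

  -- Matching on a `View` replaces an element by the residue of a natural number, after which `φ-+`
  -- and `φ-*` reduce the ring laws to those of ℕ.
  data View : F → Set where
    view-φ : ∀ a → View (φ a)

  view : ∀ x → View x
  view x = subst View (φ-toℕ x) (view-φ (toℕ x))

  ⊕-assoc : ∀ x y z → (x ⊕ y) ⊕ z ≡ x ⊕ (y ⊕ z)
  ⊕-assoc x y z with view x | view y | view z
  ... | view-φ a | view-φ b | view-φ c = begin
    (φ a ⊕ φ b) ⊕ φ c   ≡⟨ cong (_⊕ φ c) (φ-+ a b) ⟩
    φ (a ℕ.+ b) ⊕ φ c   ≡⟨ φ-+ (a ℕ.+ b) c ⟩
    φ (a ℕ.+ b ℕ.+ c)   ≡⟨ cong φ (ℕ.+-assoc a b c) ⟩
    φ (a ℕ.+ (b ℕ.+ c)) ≡⟨ φ-+ a (b ℕ.+ c) ⟨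
    φ a ⊕ φ (b ℕ.+ c)   ≡⟨ cong (φ a ⊕_) (φ-+ b c) ⟨
    φ a ⊕ (φ b ⊕ φ c)   ∎
    where open ≡-Reasoning

  ⊗-assoc : ∀ x y z → (x ⊗ y) ⊗ z ≡ x ⊗ (y ⊗ z)
  ⊗-assoc x y z with view x | view y | view z
  ... | view-φ a | view-φ b | view-φ c = begin
    (φ a ⊗ φ b) ⊗ φ c   ≡⟨ cong (_⊗ φ c) (φ-* a b) ⟩
    φ (a ℕ.* b) ⊗ φ c   ≡⟨ φ-* (a ℕ.* b) c ⟩
    φ (a ℕ.* b ℕ.* c)   ≡⟨ cong φ (ℕ.*-assoc a b c) ⟩
    φ (a ℕ.* (b ℕ.* c)) ≡⟨ φ-* a (b ℕ.* c) ⟨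
    φ a ⊗ φ (b ℕ.* c)   ≡⟨ cong (φ a ⊗_) (φ-* b c) ⟨
    φ a ⊗ (φ b ⊗ φ c)   ∎
    where open ≡-Reasoning

  ⊗-distribˡ : ∀ x y z → x ⊗ (y ⊕ z) ≡ x ⊗ y ⊕ x ⊗ z
  ⊗-distribˡ x y z with view x | view y | view z
  ... | view-φ a | view-φ b | view-φ c = begin
    φ a ⊗ (φ b ⊕ φ c)           ≡⟨ cong (φ a ⊗_) (φ-+ b c) ⟩
    φ a ⊗ φ (b ℕ.+ c)           ≡⟨ φ-* a (b ℕ.+ c) ⟩
    φ (a ℕ.* (b ℕ.+ c))         ≡⟨ cong φ (ℕ.*-distribˡ-+ a b c) ⟩
    φ (a ℕ.* b ℕ.+ a ℕ.* c)     ≡⟨ φ-+ (a ℕ.* b) (a ℕ.* c) ⟨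
    φ (a ℕ.* b) ⊕ φ (a ℕ.* c)   ≡⟨ cong₂ _⊕_ (φ-* a b) (φ-* a c) ⟨
    φ a ⊗ φ b ⊕ φ a ⊗ φ c       ∎
    where open ≡-Reasoning

  ⊕-comm : ∀ x y → x ⊕ y ≡ y ⊕ x
  ⊕-comm x y = cong φ (ℕ.+-comm (toℕ x) (toℕ y))

  ⊗-comm : ∀ x y → x ⊗ y ≡ y ⊗ x
  ⊗-comm x y = cong φ (ℕ.*-comm (toℕ x) (toℕ y))

  ⊕-identityˡ : ∀ x → φ 0 ⊕ x ≡ x
  ⊕-identityˡ x = φ-toℕ x

  ⊗-identityˡ : ∀ x → φ 1 ⊗ x ≡ x
  ⊗-identityˡ x with view x
  ... | view-φ a = trans (φ-* 1 a) (cong φ (ℕ.*-identityˡ a))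

  ⊕-inverseʳ : ∀ x → x ⊕ ⊖ x ≡ φ 0
  ⊕-inverseʳ x = begin
    x ⊕ φ (p ∸ toℕ x)               ≡⟨ cong (_⊕ ⊖ x) (φ-toℕ x) ⟨
    φ (toℕ x) ⊕ φ (p ∸ toℕ x)       ≡⟨ φ-+ (toℕ x) (p ∸ toℕ x) ⟩
    φ (toℕ x ℕ.+ (p ∸ toℕ x))       ≡⟨ cong φ (ℕ.m+[n∸m]≡n (ℕ.<⇒≤ (Fin.toℕ<n x))) ⟩
    φ p                             ≡⟨ φ-p ⟩
    φ 0                             ∎
    where open ≡-Reasoning

  isCR : IsCommutativeRing _≡_ _⊕_ _⊗_ ⊖_ (φ 0) (φ 1)
  isCR = record
    { isRing = record
      { +-isAbelianGroup = record
        { isGroup = record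
          { isMonoid = record
            { isSemigroup = record
              { isMagma = record { isEquivalence = isEquivalence ; ∙-cong = cong₂ _⊕_ }
              ; assoc = ⊕-assoc }
            ; identity = ⊕-identityˡ , λ x → trans (⊕-comm x (φ 0)) (⊕-identityˡ x) }
          ; inverse = (λ x → trans (⊕-comm (⊖ x) x) (⊕-inverseʳ x)) , ⊕-inverseʳ
          ; ⁻¹-cong = cong ⊖_ }
        ; comm = ⊕-comm }
      ; *-cong = cong₂ _⊗_
      ; *-assoc = ⊗-assoc
      ; *-identity = ⊗-identityˡ , λ x → trans (⊗-comm x (φ 1)) (⊗-identityˡ x)
      ; distrib = ⊗-distribˡ , λ x y z → trans (⊗-comm (y ⊕ z) x)
                    (trans (⊗-distribˡ x y z) (cong₂ _⊕_ (⊗-comm x y) (⊗-comm x z))) }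
    ; *-comm = ⊗-comm }

  R : CommutativeRing 0ℓ 0ℓ
  R = record { isCommutativeRing = isCR }

  open CommutativeRing R using (semiring; commutativeSemiring; +-identityʳ; *-identityʳ; zeroˡ)
  open Exp semiring using (_^_)
  open Mult semiring using () renaming (_×_ to _·_; ×1-homo-* to ·1-homo-*; ×-assoc-* to ·-assoc-*)
  open MonoidSum (CommutativeRing.+-commutativeMonoid R) using (sum; sum-init-last; sum-cong-≗; sum-replicate-zero)
  module B = Binomial commutativeSemiring

  ·1≡φ : ∀ m → m · φ 1 ≡ φ m
  ·1≡φ zero    = refl
  ·1≡φ (suc m) = trans (cong (φ 1 ⊕_) (·1≡φ m)) (φ-+ 1 m)

  φ≡0⇒∣ : ∀ {m} → φ m ≡ φ 0 → p ∣ m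
  φ≡0⇒∣ {m} e = m%n≡0⇒n∣m m p (trans (sym (toℕ-φ m)) (trans (cong toℕ e) (toℕ-φ 0)))

  ∣⇒φ≡0 : ∀ {m} → p ∣ m → φ m ≡ φ 0
  ∣⇒φ≡0 {m} d = φ-cong m 0 (n∣m⇒m%n≡0 m p d)

  ⊗-integral : ∀ {x y} → x ⊗ y ≡ φ 0 → x ≡ φ 0 ⊎ y ≡ φ 0
  ⊗-integral {x} {y} e with euclidsLemma (toℕ x) (toℕ y) pr (φ≡0⇒∣ e)
  ... | inj₁ d = inj₁ (trans (sym (φ-toℕ x)) (∣⇒φ≡0 d))
  ... | inj₂ d = inj₂ (trans (sym (φ-toℕ y)) (∣⇒φ≡0 d))

  p∣⇒·≡0 : ∀ {m} x → p ∣ m → m · x ≡ φ 0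
  p∣⇒·≡0 {m} x d = begin
    m · x              ≡⟨ cong (m ·_) (⊗-identityˡ x) ⟨
    m · (φ 1 ⊗ x)      ≡⟨ ·-assoc-* m (φ 1) x ⟨
    (m · φ 1) ⊗ x      ≡⟨ cong (_⊗ x) (trans (·1≡φ m) (∣⇒φ≡0 d)) ⟩
    φ 0 ⊗ x            ≡⟨ zeroˡ x ⟩
    φ 0                ∎
    where open ≡-Reasoning

  1^ : ∀ m → φ 1 ^ m ≡ φ 1
  1^ zero    = refl
  1^ (suc m) = trans (⊗-identityˡ _) (1^ m)

  -- Only the two outer terms of the binomial expansion survive modulo p.
  freshman : ∀ x → (x ⊕ φ 1) ^ p ≡ x ^ p ⊕ φ 1
  freshman x = begin
    (x ⊕ φ 1) ^ p                    ≡⟨ B.theorem p x (φ 1) ⟩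
    t zero ⊕ sum (λ i → t (suc i))   ≡⟨ cong₂ _⊕_ first rest ⟩
    φ 1 ⊕ x ^ p                      ≡⟨ ⊕-comm (φ 1) (x ^ p) ⟩
    x ^ p ⊕ φ 1                      ∎
    where
    open ≡-Reasoning
    t = B.binomialTerm x (φ 1) p
    first : t zero ≡ φ 1
    first = trans (+-identityʳ _) (trans (⊗-identityˡ _) (1^ p))
    inner : ∀ (i : Fin n) → t (suc (Fin.inject₁ i)) ≡ φ 0
    inner i = p∣⇒·≡0 _ (prime∣C pr (subst (_< n) (sym (Fin.toℕ-inject₁ i)) (Fin.toℕ<n i)))
    outer : t (suc (Fin.fromℕ n)) ≡ x ^ p
    outer rewrite Fin.toℕ-fromℕ n | nCn≡1 p | ℕ.n∸n≡0 n = trans (+-identityʳ _) (*-identityʳ _)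
    rest : sum (λ i → t (suc i)) ≡ x ^ p
    rest = begin
      sum (λ i → t (suc i))                              ≡⟨ sum-init-last (λ i → t (suc i)) ⟩
      sum (λ i → t (suc (Fin.inject₁ i))) ⊕ t (suc (Fin.fromℕ n))
        ≡⟨ cong₂ _⊕_ (trans (sum-cong-≗ inner) (sum-replicate-zero n)) outer ⟩
      φ 0 ⊕ x ^ p                                        ≡⟨ ⊕-identityˡ _ ⟩
      x ^ p                                              ∎

  fermat : ∀ x → x ^ p ≡ x
  fermat x with view x
  ... | view-φ a = go a
    where
    go : ∀ a → φ a ^ p ≡ φ a
    go zero    = zeroˡ (φ 0 ^ n)
    go (suc a) = begin
      φ (suc a) ^ p         ≡⟨ cong (_^ p) φ-suc ⟨
      (φ a ⊕ φ 1) ^ p       ≡⟨ freshman (φ a) ⟩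
      φ a ^ p ⊕ φ 1         ≡⟨ cong (_⊕ φ 1) (go a) ⟩
      φ a ⊕ φ 1             ≡⟨ φ-suc ⟩
      φ (suc a)             ∎
      where
      open ≡-Reasoning
      φ-suc : φ a ⊕ φ 1 ≡ φ (suc a)
      φ-suc = trans (φ-+ a 1) (cong φ (ℕ.+-comm a 1))

  field-p : PrimeField p
  field-p = record
    { isCommutativeRing = isCR
    ; isPrime = pr
    ; integral = ⊗-integral
    ; frobenius = fermat
    ; subMod≡ = λ x y → trans (sym (φ-+ (toℕ x) (p ∸ toℕ y))) (cong (_⊕ ⊖ y) (φ-toℕ x))
    ; toℕ-0# = refl
    ; toℕ-·1 = λ m → trans (cong toℕ (·1≡φ m)) (toℕ-φ m)
    }

primeField : ∀ {p} → Prime p → PrimeField p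
primeField {zero}  pr = ⊥-elim (ℕ.≢-nonZero⁻¹ 0 {{prime⇒nonZero pr}} refl)
primeField {suc n} pr = Construct.field-p n pr

module FieldFacts {p : ℕ} (K : PrimeField p) where
  open PrimeField K public
  open CommutativeRing commutativeRing public
    using (+-assoc; +-comm; +-identityˡ; +-identityʳ; -‿inverseˡ; -‿inverseʳ; *-assoc; *-comm;
           *-identityˡ; *-identityʳ; distribˡ; distribʳ; zeroˡ; zeroʳ; ring; semiring;
           commutativeSemiring; +-commutativeMonoid)
  open Exp semiring public using (_^_; ^-homo-*; ^-assocʳ)
  open CExp commutativeSemiring public using (^-distrib-*)
  open Mult semiring public using () renaming (_×_ to _·_; ×-homo-+ to ·-homo-+; ×1-homo-* to ·1-homo-*; ×-assoc-* to ·-assoc-*)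
  open RingProperties ring public using (-‿distribˡ-*; -‿distribʳ-*; -‿involutive; -0#≈0#; +-cancelˡ; +-cancelʳ)
  module S = Solver commutativeSemiring

  F : Set
  F = Fin p

  instance
    p≢0 : NonZero p
    p≢0 = prime⇒nonZero isPrime

  1<p : 1 < p
  1<p = ℕ.nonTrivial⇒n>1 p {{prime⇒nonTrivial isPrime}}

  toℕ≡0 : ∀ {x} → toℕ x ≡ 0 → x ≡ 0#
  toℕ≡0 e = Fin.toℕ-injective (trans e (sym toℕ-0#))

  ·1≡0⇒∣ : ∀ n → n · 1# ≡ 0# → p ∣ n
  ·1≡0⇒∣ n e = m%n≡0⇒n∣m n p (trans (sym (toℕ-·1 n)) (trans (cong toℕ e) toℕ-0#))

  p·1≡0 : p · 1# ≡ 0#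
  p·1≡0 = toℕ≡0 (trans (toℕ-·1 p) (n∣m⇒m%n≡0 p p (∣-refl)))

  ·≡·1* : ∀ n x → n · x ≡ (n · 1#) * x
  ·≡·1* n x = trans (cong (n ·_) (sym (*-identityˡ x))) (sym (·-assoc-* n 1# x))

  char : ∀ {n} → 0 < n → n < p → n · 1# ≢ 0#
  char {suc n} _ n<p e = ℕ.<⇒≱ n<p (∣⇒≤ (·1≡0⇒∣ (suc n) e))

  1≢0 : 1# ≢ 0#
  1≢0 e = char {1} (s≤s z≤n) 1<p (trans (+-identityʳ 1#) e)

  *≢0 : ∀ {x y} → x ≢ 0# → y ≢ 0# → x * y ≢ 0#
  *≢0 x≢0 y≢0 e with integral e
  ... | inj₁ x≡0 = x≢0 x≡0
  ... | inj₂ y≡0 = y≢0 y≡0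

  ^≢0 : ∀ {x} n → x ≢ 0# → x ^ n ≢ 0#
  ^≢0 zero    x≢0 = 1≢0
  ^≢0 (suc n) x≢0 = *≢0 x≢0 (^≢0 n x≢0)

  +-inverse-unique : ∀ {x y} → x + - y ≡ 0# → x ≡ y
  +-inverse-unique {x} {y} e = begin
    x               ≡⟨ +-identityʳ x ⟨
    x + 0#          ≡⟨ cong (x +_) (-‿inverseˡ y) ⟨
    x + (- y + y)   ≡⟨ +-assoc x (- y) y ⟨
    x + - y + y     ≡⟨ cong (_+ y) e ⟩
    0# + y          ≡⟨ +-identityˡ y ⟩
    y               ∎
    where open ≡-Reasoning

  *-cancelˡ : ∀ {x y z} → x ≢ 0# → x * y ≡ x * z → y ≡ z
  *-cancelˡ {x} {y} {z} x≢0 e with integral {x} {y + - z} (begin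
    x * (y + - z)       ≡⟨ distribˡ x y (- z) ⟩
    x * y + x * - z     ≡⟨ cong₂ _+_ e (sym (-‿distribʳ-* x z)) ⟩
    x * z + - (x * z)   ≡⟨ -‿inverseʳ _ ⟩
    0#                  ∎)
    where open ≡-Reasoning
  ... | inj₁ x≡0 = ⊥-elim (x≢0 x≡0)
  ... | inj₂ y-z = +-inverse-unique y-z

  1^ : ∀ n → 1# ^ n ≡ 1#
  1^ zero    = refl
  1^ (suc n) = trans (*-identityˡ _) (1^ n)

  fermat : ∀ {n x} → p ≡ suc n → x ≢ 0# → x ^ n ≡ 1#
  fermat {n} {x} p≡ x≢0 = *-cancelˡ x≢0
    (trans (cong (x ^_) (sym p≡)) (trans (frobenius x) (sym (*-identityʳ x))))

  inverse : ∀ {x} → x ≢ 0# → ∃ λ y → y ≢ 0# × x * y ≡ 1#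
  inverse {x} x≢0 = go p refl 1<p
    where
    go : ∀ q → p ≡ q → 1 < q → ∃ λ y → y ≢ 0# × x * y ≡ 1#
    go (suc zero)    _  (s≤s ())
    go (suc (suc n)) e _ = x ^ n , ^≢0 n x≢0 , fermat e x≢0

-- Polynomials

module Polynomial {p : ℕ} (K : PrimeField p) where
  open FieldFacts K

  infixl 6 _⊞_
  infixl 7 _⊠_ _•_
  infix  4 _≈_

  Poly : Set
  Poly = List F

  coef : Poly → ℕ → F
  coef []       n       = 0#
  coef (a ∷ as) zero    = a
  coef (a ∷ as) (suc n) = coef as n

  -- Lists may end in zeros, so polynomials are compared coefficient by coefficient, and degrees are
  -- only ever bounded above, by lengths.
  record _≈_ (as bs : Poly) : Set where
    constructor mk
    field at : ∀ n → coef as n ≡ coef bs n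
  open _≈_ public

  ≈-refl : ∀ {as} → as ≈ as
  ≈-refl = mk λ n → refl

  ≈-sym : ∀ {as bs} → as ≈ bs → bs ≈ as
  ≈-sym e = mk λ n → sym (at e n)

  ≈-trans : ∀ {as bs cs} → as ≈ bs → bs ≈ cs → as ≈ cs
  ≈-trans e f = mk λ n → trans (at e n) (at f n)

  _⊞_ : Poly → Poly → Poly
  []       ⊞ bs       = bs
  (a ∷ as) ⊞ []       = a ∷ as
  (a ∷ as) ⊞ (b ∷ bs) = a + b ∷ as ⊞ bs

  _•_ : F → Poly → Poly
  c • as = map (c *_) as

  _⊠_ : Poly → Poly → Poly
  []       ⊠ bs = []
  (a ∷ as) ⊠ bs = a • bs ⊞ (0# ∷ as ⊠ bs)

  -- The formal derivative, from the product rule for a + X f.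
  D : Poly → Poly
  D []       = []
  D (a ∷ as) = as ⊞ (0# ∷ D as)

  eval : Poly → F → F
  eval []       x = 0#
  eval (a ∷ as) x = a + x * eval as x

  coef-⊞ : ∀ as bs n → coef (as ⊞ bs) n ≡ coef as n + coef bs n
  coef-⊞ []       bs       n       = sym (+-identityˡ _)
  coef-⊞ (a ∷ as) []       n       = sym (+-identityʳ _)
  coef-⊞ (a ∷ as) (b ∷ bs) zero    = refl
  coef-⊞ (a ∷ as) (b ∷ bs) (suc n) = coef-⊞ as bs n

  coef-• : ∀ c as n → coef (c • as) n ≡ c * coef as n
  coef-• c []       n       = sym (zeroʳ c)
  coef-• c (a ∷ as) zero    = refl
  coef-• c (a ∷ as) (suc n) = coef-• c as n

  coef-D : ∀ as n → coef (D as) n ≡ suc n · coef as (suc n)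
  coef-D []       n       = sym (trans (·≡·1* (suc n) 0#) (zeroʳ _))
  coef-D (a ∷ as) zero    = coef-⊞ as (0# ∷ D as) 0
  coef-D (a ∷ as) (suc n) = trans (coef-⊞ as (0# ∷ D as) (suc n)) (cong (coef as (suc n) +_) (coef-D as n))

  D-cong : ∀ {as bs} → as ≈ bs → D as ≈ D bs
  D-cong {as} {bs} e = mk λ n → trans (coef-D as n) (trans (cong (suc n ·_) (at e (suc n))) (sym (coef-D bs n)))

  ⊞-cong : ∀ {as as′ bs bs′} → as ≈ as′ → bs ≈ bs′ → as ⊞ bs ≈ as′ ⊞ bs′
  ⊞-cong {as} {as′} {bs} {bs′} e f = mk λ n →
    trans (coef-⊞ as bs n) (trans (cong₂ _+_ (at e n) (at f n)) (sym (coef-⊞ as′ bs′ n)))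

  •-cong : ∀ c {as bs} → as ≈ bs → c • as ≈ c • bs
  •-cong c {as} {bs} e = mk λ n → trans (coef-• c as n) (trans (cong (c *_) (at e n)) (sym (coef-• c bs n)))

  ∷-cong : ∀ {a b as bs} → a ≡ b → as ≈ bs → a ∷ as ≈ b ∷ bs
  ∷-cong e f = mk λ { zero → e ; (suc n) → at f n }

  0∷[]≈[] : 0# ∷ [] ≈ []
  0∷[]≈[] = mk λ { zero → refl ; (suc n) → refl }

  ⊞-comm : ∀ as bs → as ⊞ bs ≈ bs ⊞ as
  ⊞-comm as bs = mk λ n → trans (coef-⊞ as bs n) (trans (+-comm _ _) (sym (coef-⊞ bs as n)))

  ⊞-assoc : ∀ as bs cs → (as ⊞ bs) ⊞ cs ≈ as ⊞ (bs ⊞ cs)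
  ⊞-assoc as bs cs = mk λ n → begin
    coef ((as ⊞ bs) ⊞ cs) n               ≡⟨ trans (coef-⊞ (as ⊞ bs) cs n) (cong (_+ coef cs n) (coef-⊞ as bs n)) ⟩
    coef as n + coef bs n + coef cs n     ≡⟨ +-assoc _ _ _ ⟩
    coef as n + (coef bs n + coef cs n)   ≡⟨ trans (coef-⊞ as (bs ⊞ cs) n) (cong (coef as n +_) (coef-⊞ bs cs n)) ⟨
    coef (as ⊞ (bs ⊞ cs)) n               ∎
    where open ≡-Reasoning

  ⊞-identityʳ : ∀ as → as ⊞ [] ≈ as
  ⊞-identityʳ as = mk λ n → trans (coef-⊞ as [] n) (+-identityʳ _)

  ⊠-congʳ : ∀ as {bs cs} → bs ≈ cs → as ⊠ bs ≈ as ⊠ cs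
  ⊠-congʳ []       e = ≈-refl
  ⊠-congʳ (a ∷ as) e = ⊞-cong (•-cong a e) (∷-cong refl (⊠-congʳ as e))

  0•≈[] : ∀ as → 0# • as ≈ []
  0•≈[] as = mk λ n → trans (coef-• 0# as n) (zeroˡ _)

  ⊠-zeroʳ : ∀ as → as ⊠ [] ≈ []
  ⊠-zeroʳ []       = ≈-refl
  ⊠-zeroʳ (a ∷ as) = ≈-trans (∷-cong refl (⊠-zeroʳ as)) 0∷[]≈[]

  -- The recursion of the product in its second argument, which makes the induction for
  -- commutativity possible.
  ⊠-∷ : ∀ as b bs → as ⊠ (b ∷ bs) ≈ b • as ⊞ (0# ∷ as ⊠ bs)
  ⊠-∷ []       b bs = ≈-sym 0∷[]≈[]
  ⊠-∷ (a ∷ as) b bs = ∷-cong (cong (_+ 0#) (*-comm a b)) (mk λ n → begin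
    coef (a • bs ⊞ as ⊠ (b ∷ bs)) n
      ≡⟨ trans (coef-⊞ (a • bs) _ n) (cong (coef (a • bs) n +_) (trans (at (⊠-∷ as b bs) n) (coef-⊞ (b • as) _ n))) ⟩
    coef (a • bs) n + (coef (b • as) n + coef (0# ∷ as ⊠ bs) n)
      ≡⟨ S.solve 3 (λ u v w → u S.:+ (v S.:+ w) S.:= v S.:+ (u S.:+ w)) refl _ _ _ ⟩
    coef (b • as) n + (coef (a • bs) n + coef (0# ∷ as ⊠ bs) n)
      ≡⟨ trans (coef-⊞ (b • as) _ n) (cong (coef (b • as) n +_) (coef-⊞ (a • bs) _ n)) ⟨
    coef (b • as ⊞ (a • bs ⊞ (0# ∷ as ⊠ bs))) n ∎)
    where open ≡-Reasoning

  ⊠-comm : ∀ as bs → as ⊠ bs ≈ bs ⊠ as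
  ⊠-comm []       bs = ≈-sym (⊠-zeroʳ bs)
  ⊠-comm (a ∷ as) bs = ≈-trans (⊞-cong ≈-refl (∷-cong refl (⊠-comm as bs))) (≈-sym (⊠-∷ bs a as))

  ⊠-cong : ∀ {as as′ bs bs′} → as ≈ as′ → bs ≈ bs′ → as ⊠ bs ≈ as′ ⊠ bs′
  ⊠-cong {as} {as′} {bs} {bs′} e f = ≈-trans (⊠-congʳ as f)
    (≈-trans (⊠-comm as bs′) (≈-trans (⊠-congʳ bs′ e) (⊠-comm bs′ as′)))

  ⊠-distribˡ : ∀ as bs cs → as ⊠ (bs ⊞ cs) ≈ as ⊠ bs ⊞ as ⊠ cs
  ⊠-distribˡ []       bs cs = ≈-refl
  ⊠-distribˡ (a ∷ as) bs cs = mk λ n → begin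
    coef (a • (bs ⊞ cs) ⊞ (0# ∷ as ⊠ (bs ⊞ cs))) n
      ≡⟨ coef-⊞ (a • (bs ⊞ cs)) _ n ⟩
    coef (a • (bs ⊞ cs)) n + coef (0# ∷ as ⊠ (bs ⊞ cs)) n
      ≡⟨ cong₂ _+_ (trans (coef-• a (bs ⊞ cs) n) (cong (a *_) (coef-⊞ bs cs n))) (tl n) ⟩
    a * (coef bs n + coef cs n) + (coef (0# ∷ as ⊠ bs) n + coef (0# ∷ as ⊠ cs) n)
      ≡⟨ S.solve 5 (λ a u v w z → a S.:* (u S.:+ v) S.:+ (w S.:+ z) S.:= (a S.:* u S.:+ w) S.:+ (a S.:* v S.:+ z)) refl a _ _ _ _ ⟩
    (a * coef bs n + coef (0# ∷ as ⊠ bs) n) + (a * coef cs n + coef (0# ∷ as ⊠ cs) n)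
      ≡⟨ cong₂ (λ u v → (u + _) + (v + _)) (coef-• a bs n) (coef-• a cs n) ⟨
    (coef (a • bs) n + coef (0# ∷ as ⊠ bs) n) + (coef (a • cs) n + coef (0# ∷ as ⊠ cs) n)
      ≡⟨ trans (coef-⊞ ((a ∷ as) ⊠ bs) _ n) (cong₂ _+_ (coef-⊞ (a • bs) _ n) (coef-⊞ (a • cs) _ n)) ⟨
    coef ((a ∷ as) ⊠ bs ⊞ (a ∷ as) ⊠ cs) n ∎
    where
    open ≡-Reasoning
    tl : ∀ n → coef (0# ∷ as ⊠ (bs ⊞ cs)) n ≡ coef (0# ∷ as ⊠ bs) n + coef (0# ∷ as ⊠ cs) n
    tl zero    = sym (+-identityˡ 0#)
    tl (suc n) = trans (at (⊠-distribˡ as bs cs) n) (coef-⊞ (as ⊠ bs) _ n)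

  ⊠-distribʳ : ∀ as bs cs → (bs ⊞ cs) ⊠ as ≈ bs ⊠ as ⊞ cs ⊠ as
  ⊠-distribʳ as bs cs = ≈-trans (⊠-comm (bs ⊞ cs) as)
    (≈-trans (⊠-distribˡ as bs cs) (⊞-cong (⊠-comm as bs) (⊠-comm as cs)))

  ⊞-∷ : ∀ as bs → 0# ∷ (as ⊞ bs) ≈ (0# ∷ as) ⊞ (0# ∷ bs)
  ⊞-∷ as bs = ∷-cong (sym (+-identityˡ 0#)) ≈-refl

  •-⊞ : ∀ c as bs → c • (as ⊞ bs) ≈ c • as ⊞ c • bs
  •-⊞ c as bs = mk λ n → trans (coef-• c (as ⊞ bs) n) (trans (cong (c *_) (coef-⊞ as bs n))
    (trans (distribˡ c _ _) (sym (trans (coef-⊞ (c • as) _ n) (cong₂ _+_ (coef-• c as n) (coef-• c bs n))))))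

  •-• : ∀ c d as → c • (d • as) ≈ (c * d) • as
  •-• c d as = mk λ n → trans (coef-• c (d • as) n) (trans (cong (c *_) (coef-• d as n))
    (trans (sym (*-assoc c d _)) (sym (coef-• (c * d) as n))))

  •-⊠ : ∀ c as bs → (c • as) ⊠ bs ≈ c • (as ⊠ bs)
  •-⊠ c []       bs = ≈-refl
  •-⊠ c (a ∷ as) bs = ≈-sym (≈-trans (•-⊞ c (a • bs) _)
    (⊞-cong (•-• c a bs) (∷-cong (zeroʳ c) (≈-sym (•-⊠ c as bs)))))

  0∷-⊠ : ∀ as bs → (0# ∷ as) ⊠ bs ≈ 0# ∷ as ⊠ bs
  0∷-⊠ as bs = ⊞-cong (0•≈[] bs) ≈-refl

  ⊠-assoc : ∀ as bs cs → (as ⊠ bs) ⊠ cs ≈ as ⊠ (bs ⊠ cs)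
  ⊠-assoc []       bs cs = ≈-refl
  ⊠-assoc (a ∷ as) bs cs = ≈-trans (⊠-distribʳ cs (a • bs) _)
    (⊞-cong (•-⊠ a bs cs) (≈-trans (0∷-⊠ (as ⊠ bs) cs) (∷-cong refl (⊠-assoc as bs cs))))

  1ₚ : Poly
  1ₚ = 1# ∷ []

  ⊠-identityˡ : ∀ as → 1ₚ ⊠ as ≈ as
  ⊠-identityˡ as = ≈-trans (⊞-cong (mk λ n → trans (coef-• 1# as n) (*-identityˡ _)) 0∷[]≈[]) (⊞-identityʳ as)

  ≈-isEquivalence : IsEquivalence _≈_
  ≈-isEquivalence = record { refl = ≈-refl ; sym = ≈-sym ; trans = ≈-trans }

  polyRing : CommutativeSemiring 0ℓ 0ℓ
  polyRing = record
    { _≈_ = _≈_ ; _+_ = _⊞_ ; _*_ = _⊠_ ; 0# = [] ; 1# = 1ₚ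
    ; isCommutativeSemiring = Biased.isCommutativeSemiringˡ record
      { +-isCommutativeMonoid = Biased.isCommutativeMonoidˡ record
        { isSemigroup = record
          { isMagma = record { isEquivalence = ≈-isEquivalence ; ∙-cong = ⊞-cong } ; assoc = ⊞-assoc }
        ; identityˡ = λ as → ≈-refl ; comm = ⊞-comm }
      ; *-isCommutativeMonoid = Biased.isCommutativeMonoidˡ record
        { isSemigroup = record
          { isMagma = record { isEquivalence = ≈-isEquivalence ; ∙-cong = ⊠-cong } ; assoc = ⊠-assoc }
        ; identityˡ = ⊠-identityˡ ; comm = ⊠-comm }
      ; distribʳ = ⊠-distribʳ ; zeroˡ = λ as → ≈-refl } }

  module P = CommutativeSemiring polyRing
  module PS = Solver polyRing
  open Exp P.semiring public using () renaming (_^_ to _^ₚ_)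

  D-⊞ : ∀ as bs → D (as ⊞ bs) ≈ D as ⊞ D bs
  D-⊞ as bs = mk λ n → trans (coef-D (as ⊞ bs) n)
    (trans (trans (·≡·1* (suc n) _) (trans (cong (suc n · 1# *_) (coef-⊞ as bs (suc n))) (distribˡ _ _ _)))
    (sym (trans (coef-⊞ (D as) _ n) (cong₂ _+_ (trans (coef-D as n) (·≡·1* (suc n) _)) (trans (coef-D bs n) (·≡·1* (suc n) _))))))

  D-• : ∀ c as → D (c • as) ≈ c • D as
  D-• c as = mk λ n → trans (coef-D (c • as) n) (trans (·≡·1* (suc n) _)
    (trans (cong (suc n · 1# *_) (coef-• c as (suc n)))
    (trans (S.solve 3 (λ u v w → u S.:* (v S.:* w) S.:= v S.:* (u S.:* w)) refl (suc n · 1#) c (coef as (suc n)))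
    (sym (trans (coef-• c (D as) n) (cong (c *_) (trans (coef-D as n) (·≡·1* (suc n) _))))))))

  D-⊠ : ∀ as bs → D (as ⊠ bs) ≈ D as ⊠ bs ⊞ as ⊠ D bs
  D-⊠ []       bs = ≈-refl
  D-⊠ (a ∷ as) bs = begin
    D (a • bs ⊞ (0# ∷ as ⊠ bs))
      ≈⟨ D-⊞ (a • bs) _ ⟩
    D (a • bs) ⊞ (as ⊠ bs ⊞ (0# ∷ D (as ⊠ bs)))
      ≈⟨ ⊞-cong (D-• a bs) (⊞-cong (≈-refl {as ⊠ bs}) (≈-trans (∷-cong refl (D-⊠ as bs)) (⊞-∷ (D as ⊠ bs) _))) ⟩
    a • D bs ⊞ (as ⊠ bs ⊞ ((0# ∷ D as ⊠ bs) ⊞ (0# ∷ as ⊠ D bs)))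
      ≈⟨ PS.solve 4 (λ u v w z → u PS.:+ (v PS.:+ (w PS.:+ z)) PS.:= (v PS.:+ w) PS.:+ (u PS.:+ z)) ≈-refl (a • D bs) (as ⊠ bs) (0# ∷ D as ⊠ bs) (0# ∷ as ⊠ D bs) ⟩
    (as ⊠ bs ⊞ (0# ∷ D as ⊠ bs)) ⊞ (a ∷ as) ⊠ D bs
      ≈⟨ ⊞-cong (⊞-cong (≈-refl {as ⊠ bs}) (≈-sym (0∷-⊠ (D as) bs))) (≈-refl {(a ∷ as) ⊠ D bs}) ⟩
    (as ⊠ bs ⊞ (0# ∷ D as) ⊠ bs) ⊞ (a ∷ as) ⊠ D bs
      ≈⟨ ⊞-cong (⊠-distribʳ bs as (0# ∷ D as)) (≈-refl {(a ∷ as) ⊠ D bs}) ⟨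
    D (a ∷ as) ⊠ bs ⊞ (a ∷ as) ⊠ D bs ∎
    where open SetoidReasoning P.setoid

  eval-⊞ : ∀ as bs x → eval (as ⊞ bs) x ≡ eval as x + eval bs x
  eval-⊞ []       bs       x = sym (+-identityˡ _)
  eval-⊞ (a ∷ as) []       x = sym (+-identityʳ _)
  eval-⊞ (a ∷ as) (b ∷ bs) x = trans (cong (λ u → a + b + x * u) (eval-⊞ as bs x))
    (S.solve 5 (λ a b x u v → a S.:+ b S.:+ x S.:* (u S.:+ v) S.:= (a S.:+ x S.:* u) S.:+ (b S.:+ x S.:* v)) refl a b x _ _)

  eval-• : ∀ c as x → eval (c • as) x ≡ c * eval as x
  eval-• c []       x = sym (zeroʳ c)
  eval-• c (a ∷ as) x = trans (cong (λ u → c * a + x * u) (eval-• c as x))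
    (S.solve 4 (λ c a x u → c S.:* a S.:+ x S.:* (c S.:* u) S.:= c S.:* (a S.:+ x S.:* u)) refl c a x _)

  eval-⊠ : ∀ as bs x → eval (as ⊠ bs) x ≡ eval as x * eval bs x
  eval-⊠ []       bs x = sym (zeroˡ _)
  eval-⊠ (a ∷ as) bs x = begin
    eval (a • bs ⊞ (0# ∷ as ⊠ bs)) x                   ≡⟨ eval-⊞ (a • bs) _ x ⟩
    eval (a • bs) x + (0# + x * eval (as ⊠ bs) x)      ≡⟨ cong₂ (λ u v → u + (0# + x * v)) (eval-• a bs x) (eval-⊠ as bs x) ⟩
    a * eval bs x + (0# + x * (eval as x * eval bs x)) ≡⟨ cong (a * eval bs x +_) (+-identityˡ _) ⟩
    a * eval bs x + x * (eval as x * eval bs x)        ≡⟨ S.solve 4 (λ a b x u → a S.:* b S.:+ x S.:* (u S.:* b) S.:= (a S.:+ x S.:* u) S.:* b) refl a _ x _ ⟩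
    (a + x * eval as x) * eval bs x                    ∎
    where open ≡-Reasoning

  eval-zero : ∀ as x → as ≈ [] → eval as x ≡ 0#
  eval-zero []       x e = refl
  eval-zero (a ∷ as) x e = trans (cong₂ (λ u v → u + x * v) (at e 0) (eval-zero as x (mk λ n → at e (suc n))))
    (trans (+-identityˡ _) (zeroʳ x))

  eval-cong : ∀ {as bs} x → as ≈ bs → eval as x ≡ eval bs x
  eval-cong {[]}     {bs}     x e = sym (eval-zero bs x (≈-sym e))
  eval-cong {a ∷ as} {[]}     x e = eval-zero (a ∷ as) x e
  eval-cong {a ∷ as} {b ∷ bs} x e = cong₂ (λ u v → u + x * v) (at e 0) (eval-cong {as} {bs} x (mk λ n → at e (suc n)))

  eval-^ : ∀ as n x → eval (as ^ₚ n) x ≡ eval as x ^ n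
  eval-^ as zero    x = trans (cong (1# +_) (zeroʳ x)) (+-identityʳ 1#)
  eval-^ as (suc n) x = trans (eval-⊠ as _ x) (cong (eval as x *_) (eval-^ as n x))

-- Stepanov's method

module RootBound {p : ℕ} (K : PrimeField p) where
  open FieldFacts K
  open Polynomial K
  open Sum semiring public using (sum; sum-cong-≗; ∑-distrib-+; *-distribˡ-sum; sum-replicate-zero)

  Dⁿ : ℕ → Poly → Poly
  Dⁿ zero    f = f
  Dⁿ (suc l) f = D (Dⁿ l f)

  Dⁿ-cong : ∀ l {f g} → f ≈ g → Dⁿ l f ≈ Dⁿ l g
  Dⁿ-cong zero    e = e
  Dⁿ-cong (suc l) e = D-cong (Dⁿ-cong l e)

  lin : F → Poly
  lin c = c ∷ 1# ∷ []

  D-lin : ∀ c → D (lin c) ≈ 1ₚ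
  D-lin c = ∷-cong (+-identityʳ 1#) 0∷[]≈[]

  eval-lin : ∀ c x → eval (lin c) x ≡ x + c
  eval-lin c x = begin
    c + x * (1# + x * 0#)  ≡⟨ cong (λ u → c + x * (1# + u)) (zeroʳ x) ⟩
    c + x * (1# + 0#)      ≡⟨ cong (λ u → c + x * u) (+-identityʳ 1#) ⟩
    c + x * 1#             ≡⟨ cong (c +_) (*-identityʳ x) ⟩
    c + x                  ≡⟨ +-comm c x ⟩
    x + c                  ∎
    where open ≡-Reasoning

  lin-⊠ : ∀ c f → lin c ⊠ f ≈ c • f ⊞ (0# ∷ f)
  lin-⊠ c f = ⊞-cong ≈-refl (∷-cong refl (⊠-identityˡ f))

  D-lin-⊠ : ∀ c f → D (lin c ⊠ f) ≈ f ⊞ lin c ⊠ D f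
  D-lin-⊠ c f = ≈-trans (D-⊠ (lin c) f)
    (⊞-cong (≈-trans (⊠-cong (D-lin c) ≈-refl) (⊠-identityˡ f)) ≈-refl)

  suc-• : ∀ n f → f ⊞ (n · 1#) • f ≈ (suc n · 1#) • f
  suc-• n f = mk λ i → begin
    coef (f ⊞ (n · 1#) • f) i               ≡⟨ trans (coef-⊞ f _ i) (cong (coef f i +_) (coef-• (n · 1#) f i)) ⟩
    coef f i + n · 1# * coef f i            ≡⟨ cong (_+ n · 1# * coef f i) (*-identityˡ (coef f i)) ⟨
    1# * coef f i + n · 1# * coef f i       ≡⟨ distribʳ (coef f i) 1# (n · 1#) ⟨
    (1# + n · 1#) * coef f i                ≡⟨ coef-• (suc n · 1#) f i ⟨
    coef ((suc n · 1#) • f) i               ∎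
    where open ≡-Reasoning

  -- Leibniz's rule stops after two terms because the second derivative of X + c vanishes.
  Dⁿ-lin-⊠ : ∀ c f l → Dⁿ (suc l) (lin c ⊠ f) ≈ (suc l · 1#) • Dⁿ l f ⊞ lin c ⊠ Dⁿ (suc l) f
  Dⁿ-lin-⊠ c f zero = ≈-trans (D-lin-⊠ c f)
    (⊞-cong {f} {(1 · 1#) • f} (mk λ n → sym (trans (coef-• (1 · 1#) f n) (trans (cong (_* coef f n) (+-identityʳ 1#)) (*-identityˡ _)))) (≈-refl {lin c ⊠ D f}))
  Dⁿ-lin-⊠ c f (suc l) = begin
    D (Dⁿ (suc l) (lin c ⊠ f))
      ≈⟨ D-cong (Dⁿ-lin-⊠ c f l) ⟩
    D ((suc l · 1#) • Dⁿ l f ⊞ lin c ⊠ g)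
      ≈⟨ D-⊞ ((suc l · 1#) • Dⁿ l f) _ ⟩
    D ((suc l · 1#) • Dⁿ l f) ⊞ D (lin c ⊠ g)
      ≈⟨ ⊞-cong (D-• (suc l · 1#) (Dⁿ l f)) (D-lin-⊠ c g) ⟩
    (suc l · 1#) • g ⊞ (g ⊞ lin c ⊠ D g)
      ≈⟨ PS.solve 3 (λ u v w → u PS.:+ (v PS.:+ w) PS.:= (v PS.:+ u) PS.:+ w) ≈-refl ((suc l · 1#) • g) g (lin c ⊠ D g) ⟩
    (g ⊞ (suc l · 1#) • g) ⊞ lin c ⊠ D g
      ≈⟨ ⊞-cong (suc-• (suc l) g) (≈-refl {lin c ⊠ D g}) ⟩
    (suc (suc l) · 1#) • g ⊞ lin c ⊠ D g ∎
    where
    open SetoidReasoning P.setoid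
    g = Dⁿ (suc l) f

  -- Synthetic division by X - x: the coefficients of the quotient are the intermediate values of
  -- Horner's scheme.
  quot : F → Poly → Poly
  quot x []           = []
  quot x (a ∷ [])     = []
  quot x (a ∷ b ∷ as) = eval (b ∷ as) x ∷ quot x (b ∷ as)

  length-quot : ∀ x a as → length (quot x (a ∷ as)) ≡ length as
  length-quot x a []       = refl
  length-quot x a (b ∷ as) = cong suc (length-quot x b as)

  division : ∀ x f → f ≈ lin (- x) ⊠ quot x f ⊞ (eval f x ∷ [])
  division x []           = ≈-sym (≈-trans (⊞-cong (⊠-zeroʳ (lin (- x))) ≈-refl) 0∷[]≈[])
  division x (a ∷ [])     = ≈-sym (≈-trans (⊞-cong (⊠-zeroʳ (lin (- x))) ≈-refl)
                              (∷-cong (trans (cong (a +_) (zeroʳ x)) (+-identityʳ a)) ≈-refl))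
  division x (a ∷ b ∷ as) = ≈-sym (begin
    lin c ⊠ (e ∷ Q) ⊞ (a + x * e ∷ [])             ≈⟨ ⊞-cong (lin-⊠ c (e ∷ Q)) (≈-refl {a + x * e ∷ []}) ⟩
    c * e + 0# + (a + x * e) ∷ (c • Q ⊞ (e ∷ Q)) ⊞ []  ≈⟨ ∷-cong head-eq (≈-trans (⊞-identityʳ _) (tail-eq (division x (b ∷ as)))) ⟩
    a ∷ b ∷ as                                     ∎)
    where
    open SetoidReasoning P.setoid
    c = - x
    e = eval (b ∷ as) x
    Q = quot x (b ∷ as)
    head-eq : c * e + 0# + (a + x * e) ≡ a
    head-eq = trans (S.solve 3 (λ u v a → u S.:+ S.con 0 S.:+ (a S.:+ v) S.:= a S.:+ (u S.:+ v)) refl (c * e) (x * e) a)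
      (trans (cong (a +_) (trans (sym (distribʳ e c x)) (trans (cong (_* e) (-‿inverseˡ x)) (zeroˡ e)))) (+-identityʳ a))
    tail-eq : b ∷ as ≈ lin c ⊠ Q ⊞ (e ∷ []) → c • Q ⊞ (e ∷ Q) ≈ b ∷ as
    tail-eq ih = begin
      c • Q ⊞ (e ∷ Q)                 ≈⟨ ⊞-cong (≈-refl {c • Q}) (∷-cong (sym (+-identityˡ e)) (≈-sym (⊞-identityʳ Q))) ⟩
      c • Q ⊞ ((0# ∷ Q) ⊞ (e ∷ []))   ≈⟨ ⊞-assoc (c • Q) (0# ∷ Q) (e ∷ []) ⟨
      (c • Q ⊞ (0# ∷ Q)) ⊞ (e ∷ [])   ≈⟨ ⊞-cong (lin-⊠ c Q) (≈-refl {e ∷ []}) ⟨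
      lin c ⊠ Q ⊞ (e ∷ [])            ≈⟨ ih ⟨
      b ∷ as                          ∎

  -- Ordinary derivatives detect multiplicity as long as M ≤ p, since then the factorials that occur
  -- are invertible.
  Vanish : ℕ → Poly → F → Set
  Vanish M f x = ∀ l → l < M → eval (Dⁿ l f) x ≡ 0#

  private
    eval-Dⁿ-lin-⊠ : ∀ {f} c g l x → f ≈ lin c ⊠ g →
      eval (Dⁿ (suc l) f) x ≡ suc l · 1# * eval (Dⁿ l g) x + (x + c) * eval (Dⁿ (suc l) g) x
    eval-Dⁿ-lin-⊠ c g l x e = trans (eval-cong x (≈-trans (Dⁿ-cong (suc l) e) (Dⁿ-lin-⊠ c g l)))
      (trans (eval-⊞ ((suc l · 1#) • Dⁿ l g) _ x)
        (cong₂ _+_ (eval-• (suc l · 1#) (Dⁿ l g) x)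
          (trans (eval-⊠ (lin c) (Dⁿ (suc l) g) x) (cong (_* eval (Dⁿ (suc l) g) x) (eval-lin c x)))))

  -- At x the second term of `Dⁿ-lin-⊠` drops out. The derivative of f of order l + 1 is thus l + 1
  -- times that of g of order l, and l + 1 < p can be cancelled.
  vanish-quot : ∀ {f g x m} → f ≈ lin (- x) ⊠ g → m < p → Vanish (suc m) f x → Vanish m g x
  vanish-quot {f} {g} {x} e m<p V l l<m =
    [ (λ l≡0 → ⊥-elim (char (s≤s z≤n) (ℕ.≤-<-trans l<m m<p) l≡0)) , id ]′ (integral (begin
      suc l · 1# * u                    ≡⟨ +-identityʳ _ ⟨
      suc l · 1# * u + 0#               ≡⟨ cong (suc l · 1# * u +_) (trans (cong (_* w) (-‿inverseʳ x)) (zeroˡ w)) ⟨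
      suc l · 1# * u + (x + - x) * w    ≡⟨ eval-Dⁿ-lin-⊠ (- x) g l x e ⟨
      eval (Dⁿ (suc l) f) x             ≡⟨ V (suc l) (s≤s l<m) ⟩
      0#                                ∎))
    where
    open ≡-Reasoning
    u = eval (Dⁿ l g) x
    w = eval (Dⁿ (suc l) g) x

  -- Here y - x is invertible. Once the derivative of g of order l is known to vanish at y, the two
  -- terms of `Dⁿ-lin-⊠` leave only the one of order l + 1.
  vanish-quot-other : ∀ {f g x y M} → x ≢ y → f ≈ lin (- x) ⊠ g → Vanish M f y → Vanish M g y
  vanish-quot-other {f} {g} {x} {y} {M} x≢y e V = go
    where
    y-x≢0 : y + - x ≢ 0#
    y-x≢0 z = x≢y (sym (+-inverse-unique z))
    cancel : ∀ {u} → (y + - x) * u ≡ 0# → u ≡ 0#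
    cancel {u} z = *-cancelˡ y-x≢0 (trans z (sym (zeroʳ _)))
    go : Vanish M g y
    go zero    l<M = cancel (trans (sym (trans (eval-⊠ (lin (- x)) g y) (cong (_* eval g y) (eval-lin (- x) y))))
                       (trans (eval-cong y (≈-sym e)) (V 0 l<M)))
    go (suc l) l<M = cancel (trans (sym (trans (cong (λ u → suc l · 1# * u + (y + - x) * eval (Dⁿ (suc l) g) y) (go l (ℕ.<-trans (ℕ.n<1+n l) l<M)))
                       (trans (cong (_+ (y + - x) * eval (Dⁿ (suc l) g) y) (zeroʳ _)) (+-identityˡ _))))
                       (trans (sym (eval-Dⁿ-lin-⊠ (- x) g l y e)) (V (suc l) l<M)))

  private
    strip : ∀ x M Z → (∀ {y} → y ∈ Z → x ≢ y) → ∀ m f → m ≤ p → Vanish m f x → (∀ {y} → y ∈ Z → Vanish M f y) →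
            ¬ f ≈ [] → ∃ λ g → m ℕ.+ length g ≡ length f × (∀ {y} → y ∈ Z → Vanish M g y) × ¬ g ≈ []
    strip x M Z x∉ zero    f        _   _ W f≉ = f , refl , W , f≉
    strip x M Z x∉ (suc m) []       _   _ W f≉ = ⊥-elim (f≉ ≈-refl)
    strip x M Z x∉ (suc m) f@(a ∷ as) m<p V W f≉ = g , cong suc (trans g-len (length-quot x a as)) , Wg , g≉
      where
      factor : f ≈ lin (- x) ⊠ quot x f
      factor = ≈-trans (division x f) (≈-trans (⊞-cong (≈-refl {lin (- x) ⊠ quot x f})
                 (≈-trans (∷-cong (V 0 (s≤s z≤n)) ≈-refl) 0∷[]≈[])) (⊞-identityʳ _))
      rec = strip x M Z x∉ m (quot x f) (ℕ.<⇒≤ m<p) (vanish-quot factor m<p V)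
              (λ y∈ → vanish-quot-other (x∉ y∈) factor (W y∈))
              (λ q≈ → f≉ (≈-trans factor (≈-trans (⊠-congʳ (lin (- x)) q≈) (⊠-zeroʳ (lin (- x))))))
      g = proj₁ rec
      g-len = proj₁ (proj₂ rec)
      Wg = proj₁ (proj₂ (proj₂ rec))
      g≉ = proj₂ (proj₂ (proj₂ rec))

  -- Every point of `Z` lets M linear factors be divided out, each at the cost of one coefficient,
  -- without disturbing the orders at the remaining points.
  rootBound : ∀ M Z f → Unique Z → M ≤ p → (∀ {x} → x ∈ Z → Vanish M f x) → ¬ f ≈ [] → length Z ℕ.* M ≤ length f
  rootBound M []      f _        _   _ _  = z≤n
  rootBound M (x ∷ Z) f (x∉ ∷ u) M≤p V f≉ with strip x M Z (λ y∈ → All.lookup x∉ y∈) M f M≤p (V (here refl)) (V ∘ there) f≉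
  ... | g , len , W , g≉ = subst (M ℕ.+ length Z ℕ.* M ≤_) len (ℕ.+-monoʳ-≤ M (rootBound M Z g u M≤p W g≉))

  lincomb : ∀ {N} → (Fin N → F) → (Fin N → Poly) → Poly
  lincomb {zero}  c b = []
  lincomb {suc N} c b = c zero • b zero ⊞ lincomb (c ∘ suc) (b ∘ suc)

  coef-lincomb : ∀ {N} (c : Fin N → F) b n → coef (lincomb c b) n ≡ sum (λ s → c s * coef (b s) n)
  coef-lincomb {zero}  c b n = refl
  coef-lincomb {suc N} c b n = trans (coef-⊞ (c zero • b zero) _ n)
    (cong₂ _+_ (coef-• (c zero) (b zero) n) (coef-lincomb (c ∘ suc) (b ∘ suc) n))

  eval-lincomb : ∀ {N} (c : Fin N → F) b x → eval (lincomb c b) x ≡ sum (λ s → c s * eval (b s) x)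
  eval-lincomb {zero}  c b x = refl
  eval-lincomb {suc N} c b x = trans (eval-⊞ (c zero • b zero) _ x)
    (cong₂ _+_ (eval-• (c zero) (b zero) x) (eval-lincomb (c ∘ suc) (b ∘ suc) x))

  D-lincomb : ∀ {N} (c : Fin N → F) b → D (lincomb c b) ≈ lincomb c (D ∘ b)
  D-lincomb {zero}  c b = ≈-refl
  D-lincomb {suc N} c b = ≈-trans (D-⊞ (c zero • b zero) _)
    (⊞-cong (D-• (c zero) (b zero)) (D-lincomb (c ∘ suc) (b ∘ suc)))

  Dⁿ-lincomb : ∀ {N} (c : Fin N → F) b l → Dⁿ l (lincomb c b) ≈ lincomb c (Dⁿ l ∘ b)
  Dⁿ-lincomb c b zero    = ≈-refl
  Dⁿ-lincomb c b (suc l) = ≈-trans (D-cong (Dⁿ-lincomb c b l)) (D-lincomb c (Dⁿ l ∘ b))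

  length-⊞ : ∀ {L} as bs → length as ≤ L → length bs ≤ L → length (as ⊞ bs) ≤ L
  length-⊞ []       bs       _       q       = q
  length-⊞ (a ∷ as) []       q       _       = q
  length-⊞ (a ∷ as) (b ∷ bs) (s≤s q) (s≤s r) = s≤s (length-⊞ as bs q r)

  length-• : ∀ {L} c as → length as ≤ L → length (c • as) ≤ L
  length-• {L} c as q = subst (_≤ L) (sym (List.length-map (c *_) as)) q

  length-lincomb : ∀ {N L} (c : Fin N → F) b → (∀ s → length (b s) ≤ L) → length (lincomb c b) ≤ L
  length-lincomb {zero}  c b q = z≤n
  length-lincomb {suc N} c b q = length-⊞ (c zero • b zero) _ (length-• (c zero) (b zero) (q zero))
    (length-lincomb (c ∘ suc) (b ∘ suc) (q ∘ suc))

  coef-beyond : ∀ as {n} → length as ≤ n → coef as n ≡ 0#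
  coef-beyond []       _       = refl
  coef-beyond (a ∷ as) (s≤s q) = coef-beyond as q

  sum-zero : ∀ {N} (f : Fin N → F) → (∀ t → f t ≡ 0#) → sum f ≡ 0#
  sum-zero {N} f z = trans (sum-cong-≗ z) (sum-replicate-zero N)

  sum-single : ∀ {N} (f : Fin N → F) s → (∀ t → t ≢ s → f t ≡ 0#) → sum f ≡ f s
  sum-single f zero    z = trans (cong (f zero +_) (sum-zero (f ∘ suc) (λ t → z (suc t) λ ()))) (+-identityʳ _)
  sum-single f (suc s) z = trans (cong₂ _+_ (z zero λ ()) (sum-single (f ∘ suc) s (λ t t≢s → z (suc t) (t≢s ∘ Fin.suc-injective)))) (+-identityˡ _)

  funToFin-cong : ∀ {m n} {f g : Fin m → Fin n} → (∀ i → f i ≡ g i) → funToFin f ≡ funToFin g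
  funToFin-cong {zero}  e = refl
  funToFin-cong {suc m} e = cong₂ combine (e zero) (funToFin-cong (e ∘ suc))

  -- Over a finite field the pigeonhole principle replaces elimination.
  kernel : ∀ {m N} (A : Fin m → Fin N → F) → m < N →
           ∃ λ (c : Fin N → F) → (¬ (∀ s → c s ≡ 0#)) × (∀ i → sum (λ s → c s * A i s) ≡ 0#)
  kernel {m} {N} A m<N with Fin.pigeonhole (ℕ.^-monoʳ-< p 1<p m<N) (λ k → funToFin (λ i → sum (λ s → finToFun k s * A i s)))
  ... | k , k′ , k<k′ , e = c , nonzero , zeros
    where
    a = finToFun {p} {N} k
    b = finToFun {p} {N} k′
    c = λ s → a s + - b s
    nonzero : ¬ (∀ s → c s ≡ 0#)
    nonzero z = Fin.<⇒≢ k<k′ (trans (sym (Fin.funToFin-finToFin {N} {p} k))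
      (trans (funToFin-cong (λ s → +-inverse-unique (z s))) (Fin.funToFin-finToFin {N} {p} k′)))
    zeros : ∀ i → sum (λ s → c s * A i s) ≡ 0#
    zeros i = +-cancelʳ (sum (λ s → b s * A i s)) _ _ (begin
      sum (λ s → c s * A i s) + sum (λ s → b s * A i s)   ≡⟨ ∑-distrib-+ (λ s → c s * A i s) (λ s → b s * A i s) ⟨
      sum (λ s → c s * A i s + b s * A i s)               ≡⟨ sum-cong-≗ (λ s → trans (sym (distribʳ (A i s) (c s) (b s)))
                                                               (cong (_* A i s) (trans (+-assoc _ _ _) (trans (cong (a s +_) (-‿inverseˡ (b s))) (+-identityʳ _))))) ⟩
      sum (λ s → a s * A i s)                             ≡⟨ Fin.finToFun-funToFin (λ i → sum (λ s → a s * A i s)) i ⟨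
      finToFun {p} {m} (funToFin (λ i → sum (λ s → a s * A i s))) i ≡⟨ cong (λ h → finToFun {p} {m} h i) e ⟩
      finToFun {p} {m} (funToFin (λ i → sum (λ s → b s * A i s))) i ≡⟨ Fin.finToFun-funToFin (λ i → sum (λ s → b s * A i s)) i ⟩
      sum (λ s → b s * A i s)                             ≡⟨ +-identityˡ _ ⟨
      0# + sum (λ s → b s * A i s)                        ∎)
      where open ≡-Reasoning

  -- The orders of vanishing at 0 are pairwise distinct. In a vanishing combination the coefficient
  -- of X^(v s) involves only s and indices of smaller order, so the scalars vanish one after the
  -- other in increasing order.
  independent : ∀ {N} (b : Fin N → Poly) (v : Fin N → ℕ) → (∀ {s t} → v s ≡ v t → s ≡ t) →
    (∀ s n → n < v s → coef (b s) n ≡ 0#) → (∀ s → coef (b s) (v s) ≢ 0#) →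
    ∀ c → lincomb c b ≈ [] → ∀ s → c s ≡ 0#
  independent b v v-inj below lead c e s = go (suc (v s)) s ℕ.≤-refl
    where
    step : ∀ s → (∀ t → v t < v s → c t ≡ 0#) → c s ≡ 0#
    step s ih with integral (trans (sym (sum-single _ s others)) (trans (sym (coef-lincomb c b (v s))) (at e (v s))))
      where
      others : ∀ t → t ≢ s → c t * coef (b t) (v s) ≡ 0#
      others t t≢s with ℕ.<-cmp (v t) (v s)
      ... | tri< vt<vs _ _ = trans (cong (_* coef (b t) (v s)) (ih t vt<vs)) (zeroˡ _)
      ... | tri≈ _ vt≡vs _ = ⊥-elim (t≢s (v-inj vt≡vs))
      ... | tri> _ _ vs<vt = trans (cong (c t *_) (below t (v s) vs<vt)) (zeroʳ _)
    ... | inj₁ z = z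
    ... | inj₂ z = ⊥-elim (lead s z)
    go : ∀ n s → v s < n → c s ≡ 0#
    go (suc n) s (s≤s vs≤n) = step s (λ t vt<vs → go n t (ℕ.<-≤-trans vt<vs vs≤n))

  -- Stepanov's auxiliary polynomial: a nonzero combination of the b s for which the corresponding combinations
  -- of the σ l s are identically zero, so that it vanishes to order M on Z.
  auxiliary : ∀ {N} (b : Fin N → Poly) (σ : ℕ → Fin N → Poly) (r : ℕ → F → F) (Z : List F) {M d L : ℕ} →
    (∀ c → lincomb c b ≈ [] → ∀ s → c s ≡ 0#) →
    (∀ s → length (b s) ≤ L) →
    (∀ {l} → l < M → ∀ s → length (σ l s) ≤ d) →
    M ℕ.* d < N → M ≤ p → Unique Z →
    (∀ {x} → x ∈ Z → ∀ l → r l x ≢ 0#) →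
    (∀ {x} → x ∈ Z → ∀ l s → r l x * eval (Dⁿ l (b s)) x ≡ eval (σ l s) x) →
    length Z ℕ.* M ≤ L
  auxiliary {N} b σ r Z {M} {d} {L} ind lenb lenσ Md<N M≤p uZ r≢0 agree =
    ℕ.≤-trans (rootBound M Z Φ uZ M≤p vanish (λ Φ≈ → proj₁ (proj₂ ker) (ind c Φ≈))) (length-lincomb c b lenb)
    where
    A : Fin (M ℕ.* d) → Fin N → F
    A i s = coef (σ (toℕ (proj₁ (remQuot {M} d i))) s) (toℕ (proj₂ (remQuot {M} d i)))
    ker = kernel A Md<N
    c = proj₁ ker
    Φ = lincomb c b
    Σσ≈[] : ∀ l → l < M → lincomb c (σ l) ≈ []
    Σσ≈[] l l<M = mk coefs
      where
      coefs : ∀ n → coef (lincomb c (σ l)) n ≡ 0#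
      coefs n with n ℕ.<? d
      ... | no n≮d = coef-beyond (lincomb c (σ l)) (ℕ.≤-trans (length-lincomb c (σ l) (lenσ l<M)) (ℕ.≮⇒≥ n≮d))
      ... | yes n<d = trans (coef-lincomb c (σ l) n) (trans (sum-cong-≗ (λ s → cong (c s *_) (sym (A-at s)))) (proj₂ (proj₂ ker) i))
        where
        i = combine (fromℕ< l<M) (fromℕ< n<d)
        A-at : ∀ s → A i s ≡ coef (σ l s) n
        A-at s = trans (cong (λ qr → coef (σ (toℕ (proj₁ qr)) s) (toℕ (proj₂ qr))) (Fin.remQuot-combine {M} {d} (fromℕ< l<M) (fromℕ< n<d)))
                   (cong₂ (λ u v → coef (σ u s) v) (Fin.toℕ-fromℕ< l<M) (Fin.toℕ-fromℕ< n<d))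
    vanish : ∀ {x} → x ∈ Z → Vanish M Φ x
    vanish {x} x∈ l l<M = *-cancelˡ (r≢0 x∈ l) (begin
      r l x * eval (Dⁿ l Φ) x                            ≡⟨ cong (r l x *_) (trans (eval-cong x (Dⁿ-lincomb c b l)) (eval-lincomb c (Dⁿ l ∘ b) x)) ⟩
      r l x * sum (λ s → c s * eval (Dⁿ l (b s)) x)      ≡⟨ *-distribˡ-sum (r l x) (λ s → c s * eval (Dⁿ l (b s)) x) ⟩
      sum (λ s → r l x * (c s * eval (Dⁿ l (b s)) x))    ≡⟨ sum-cong-≗ (λ s → trans (S.solve 3 (λ u v w → u S.:* (v S.:* w) S.:= v S.:* (u S.:* w)) refl (r l x) (c s) _)
                                                              (cong (c s *_) (agree x∈ l s))) ⟩
      sum (λ s → c s * eval (σ l s) x)                   ≡⟨ eval-lincomb c (σ l) x ⟨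
      eval (lincomb c (σ l)) x                           ≡⟨ eval-zero _ x (Σσ≈[] l l<M) ⟩
      0#                                                 ≡⟨ zeroʳ (r l x) ⟨
      r l x * 0#                                         ∎)
      where open ≡-Reasoning

-- Products of powers of linear polynomials and their logarithmic derivatives

module LinearFactors {p : ℕ} (K : PrimeField p) where
  open FieldFacts K
  open Polynomial K
  open RootBound K

  -- (c , e) stands for the factor (x + c)^e.
  Factors : Set
  Factors = List (F × ℕ)

  -- The quotient of `logD` by `rad` is the logarithmic derivative of `expand`. Both have degree at
  -- most the number of factors, however large the exponents are.
  expand rad logD : Factors → Poly
  expand []            = 1ₚ
  expand ((c , e) ∷ t) = lin c ^ₚ e ⊠ expand t
  rad []            = 1ₚ
  rad ((c , e) ∷ t) = lin c ⊠ rad t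
  logD []            = []
  logD ((c , e) ∷ t) = (e · 1#) • rad t ⊞ lin c ⊠ logD t

  value : Factors → F → F
  value []            x = 1#
  value ((c , e) ∷ t) x = (x + c) ^ e * value t x

  NonRoot : Factors → F → Set
  NonRoot t x = All (λ ce → x + proj₁ ce ≢ 0#) t

  scale : ℕ → Factors → Factors
  scale k = map (λ ce → proj₁ ce , k ℕ.* proj₂ ce)

  degree : Factors → ℕ
  degree t = sumℕ (map proj₂ t)

  private
    ⊠-swap : ∀ f g h → f ⊠ (g ⊠ h) ≈ g ⊠ (f ⊠ h)
    ⊠-swap = PS.solve 3 (λ u v w → u PS.:* (v PS.:* w) PS.:= v PS.:* (u PS.:* w)) ≈-refl

    •-⊠ʳ : ∀ c f g → f ⊠ (c • g) ≈ c • (f ⊠ g)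
    •-⊠ʳ c f g = ≈-trans (⊠-comm f (c • g)) (≈-trans (•-⊠ c g f) (•-cong c (⊠-comm g f)))

    0•-eq : ∀ {c} f → c ≡ 0# → [] ≈ c • f
    0•-eq f refl = ≈-sym (0•≈[] f)

  -- The power rule multiplied by f, which avoids the exponent n - 1.
  ⊠-D-^ : ∀ f n → f ⊠ D (f ^ₚ n) ≈ (n · 1#) • (D f ⊠ f ^ₚ n)
  ⊠-D-^ f zero = ≈-trans (≈-trans (⊠-congʳ f 0∷[]≈[]) (⊠-zeroʳ f)) (0•-eq (D f ⊠ 1ₚ) refl)
  ⊠-D-^ f (suc n) = begin
    f ⊠ D (f ⊠ f ^ₚ n)
      ≈⟨ ⊠-congʳ f (D-⊠ f (f ^ₚ n)) ⟩
    f ⊠ (D f ⊠ f ^ₚ n ⊞ f ⊠ D (f ^ₚ n))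
      ≈⟨ PS.solve 4 (λ f d u v → f PS.:* (d PS.:* u PS.:+ v) PS.:= d PS.:* (f PS.:* u) PS.:+ f PS.:* v) ≈-refl f (D f) (f ^ₚ n) (f ⊠ D (f ^ₚ n)) ⟩
    D f ⊠ f ^ₚ suc n ⊞ f ⊠ (f ⊠ D (f ^ₚ n))
      ≈⟨ ⊞-cong (≈-refl {D f ⊠ f ^ₚ suc n}) (begin
           f ⊠ (f ⊠ D (f ^ₚ n))                  ≈⟨ ⊠-congʳ f (⊠-D-^ f n) ⟩
           f ⊠ ((n · 1#) • (D f ⊠ f ^ₚ n))       ≈⟨ •-⊠ʳ (n · 1#) f (D f ⊠ f ^ₚ n) ⟩
           (n · 1#) • (f ⊠ (D f ⊠ f ^ₚ n))       ≈⟨ •-cong (n · 1#) (⊠-swap f (D f) (f ^ₚ n)) ⟩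
           (n · 1#) • (D f ⊠ f ^ₚ suc n)         ∎) ⟩
    D f ⊠ f ^ₚ suc n ⊞ (n · 1#) • (D f ⊠ f ^ₚ suc n)
      ≈⟨ suc-• n (D f ⊠ f ^ₚ suc n) ⟩
    (suc n · 1#) • (D f ⊠ f ^ₚ suc n) ∎
    where open SetoidReasoning P.setoid

  rad-D-expand : ∀ t → rad t ⊠ D (expand t) ≈ logD t ⊠ expand t
  rad-D-expand []            = ≈-trans (⊠-congʳ 1ₚ 0∷[]≈[]) (⊠-zeroʳ 1ₚ)
  rad-D-expand ((c , e) ∷ t) = begin
    (l ⊠ R) ⊠ D (u ⊠ v)
      ≈⟨ ⊠-congʳ (l ⊠ R) (D-⊠ u v) ⟩
    (l ⊠ R) ⊠ (D u ⊠ v ⊞ u ⊠ D v)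
      ≈⟨ PS.solve 6 (λ l R u v du dv → (l PS.:* R) PS.:* (du PS.:* v PS.:+ u PS.:* dv)
           PS.:= (l PS.:* du) PS.:* (R PS.:* v) PS.:+ (l PS.:* u) PS.:* (R PS.:* dv)) ≈-refl l R u v (D u) (D v) ⟩
    (l ⊠ D u) ⊠ (R ⊠ v) ⊞ (l ⊠ u) ⊠ (R ⊠ D v)
      ≈⟨ ⊞-cong (⊠-cong (≈-trans (⊠-D-^ l e) (•-cong (e · 1#) (≈-trans (⊠-cong (D-lin c) ≈-refl) (⊠-identityˡ u)))) (≈-refl {R ⊠ v}))
                (⊠-congʳ (l ⊠ u) (rad-D-expand t)) ⟩
    ((e · 1#) • u) ⊠ (R ⊠ v) ⊞ (l ⊠ u) ⊠ (W ⊠ v)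
      ≈⟨ ⊞-cong (≈-trans (•-⊠ (e · 1#) u (R ⊠ v)) (≈-trans (•-cong (e · 1#) (⊠-swap u R v)) (≈-sym (•-⊠ (e · 1#) R (u ⊠ v)))))
                (PS.solve 4 (λ l u W v → (l PS.:* u) PS.:* (W PS.:* v) PS.:= (l PS.:* W) PS.:* (u PS.:* v)) ≈-refl l u W v) ⟩
    ((e · 1#) • R) ⊠ (u ⊠ v) ⊞ (l ⊠ W) ⊠ (u ⊠ v)
      ≈⟨ ⊠-distribʳ (u ⊠ v) ((e · 1#) • R) (l ⊠ W) ⟨
    ((e · 1#) • R ⊞ l ⊠ W) ⊠ (u ⊠ v) ∎
    where
    open SetoidReasoning P.setoid
    l = lin c
    R = rad t
    W = logD t
    u = l ^ₚ e
    v = expand t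

  eval-expand : ∀ t x → eval (expand t) x ≡ value t x
  eval-expand []            x = trans (cong (1# +_) (zeroʳ x)) (+-identityʳ 1#)
  eval-expand ((c , e) ∷ t) x = trans (eval-⊠ (lin c ^ₚ e) (expand t) x)
    (cong₂ _*_ (trans (eval-^ (lin c) e x) (cong (_^ e) (eval-lin c x))) (eval-expand t x))

  value≢0 : ∀ t x → NonRoot t x → value t x ≢ 0#
  value≢0 []            x _        = 1≢0
  value≢0 ((c , e) ∷ t) x (q ∷ qs) = *≢0 (^≢0 e q) (value≢0 t x qs)

  value-scale : ∀ k t x → value (scale k t) x ≡ value t x ^ k
  value-scale k []            x = sym (1^ k)
  value-scale k ((c , e) ∷ t) x = trans (cong₂ _*_ (trans (cong ((x + c) ^_) (ℕ.*-comm k e)) (sym (^-assocʳ (x + c) e k))) (value-scale k t x))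
    (sym (^-distrib-* ((x + c) ^ e) (value t x) k))

  rad-scale : ∀ k t → rad (scale k t) ≡ rad t
  rad-scale k []            = refl
  rad-scale k ((c , e) ∷ t) = cong (lin c ⊠_) (rad-scale k t)

  rad≢0 : ∀ t x → NonRoot t x → eval (rad t) x ≢ 0#
  rad≢0 []            x _        e = 1≢0 (trans (sym (trans (cong (1# +_) (zeroʳ x)) (+-identityʳ 1#))) e)
  rad≢0 ((c , _) ∷ t) x (q ∷ qs) e =
    *≢0 q (rad≢0 t x qs) (trans (cong (_* eval (rad t) x) (sym (eval-lin c x))) (trans (sym (eval-⊠ (lin c) (rad t) x)) e))

  infix 4 _hasDegree≤_
  _hasDegree≤_ : Poly → ℕ → Set
  f hasDegree≤ d = length f ≤ suc d

  length-D : ∀ {L} f → length f ≤ L → length (D f) ≤ L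
  length-D []       q       = q
  length-D (a ∷ as) (s≤s q) = length-⊞ as (0# ∷ D as) (ℕ.m≤n⇒m≤1+n q) (s≤s (length-D as q))

  deg-⊠ : ∀ f g {d e} → f hasDegree≤ d → g hasDegree≤ e → f ⊠ g hasDegree≤ d ℕ.+ e
  deg-⊠ f g {d} {e} q r = ℕ.≤-trans (go f) (ℕ.+-monoˡ-≤ e q)
    where
    go : ∀ f → length (f ⊠ g) ≤ length f ℕ.+ e
    go []       = z≤n
    go (a ∷ as) = length-⊞ (a • g) _ (length-• a g (ℕ.≤-trans r (s≤s (ℕ.m≤n+m e (length as))))) (s≤s (go as))

  deg-^ : ∀ f n {d} → f hasDegree≤ d → f ^ₚ n hasDegree≤ n ℕ.* d
  deg-^ f zero    q = s≤s z≤n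
  deg-^ f (suc n) q = deg-⊠ f (f ^ₚ n) q (deg-^ f n q)

  deg-lin : ∀ c → lin c hasDegree≤ 1
  deg-lin c = ℕ.≤-refl

  deg-lin-^ : ∀ c n → lin c ^ₚ n hasDegree≤ n
  deg-lin-^ c n = subst (lin c ^ₚ n hasDegree≤_) (ℕ.*-identityʳ n) (deg-^ (lin c) n (deg-lin c))

  deg-expand : ∀ t → expand t hasDegree≤ degree t
  deg-expand []            = s≤s z≤n
  deg-expand ((c , e) ∷ t) = deg-⊠ (lin c ^ₚ e) (expand t) (deg-lin-^ c e) (deg-expand t)

  deg-rad : ∀ t → rad t hasDegree≤ length t
  deg-rad []            = s≤s z≤n
  deg-rad ((c , e) ∷ t) = deg-⊠ (lin c) (rad t) (deg-lin c) (deg-rad t)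

  deg-logD : ∀ t → logD t hasDegree≤ length t
  deg-logD []            = z≤n
  deg-logD ((c , e) ∷ t) = length-⊞ ((e · 1#) • rad t) _
    (length-• (e · 1#) (rad t) (ℕ.m≤n⇒m≤1+n (deg-rad t))) (deg-⊠ (lin c) (logD t) (deg-lin c) (deg-logD t))

  degree-scale : ∀ k t → degree (scale k t) ≡ k ℕ.* degree t
  degree-scale k []            = sym (ℕ.*-zeroʳ k)
  degree-scale k ((c , e) ∷ t) = trans (cong (k ℕ.* e ℕ.+_) (degree-scale k t)) (sym (ℕ.*-distribˡ-+ k e (degree t)))

  X : Poly
  X = lin 0#

  X-⊠ : ∀ f → X ⊠ f ≈ 0# ∷ f
  X-⊠ f = ≈-trans (lin-⊠ 0# f) (⊞-cong (0•≈[] f) ≈-refl)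

  coef-X^-below : ∀ v f {n} → n < v → coef (X ^ₚ v ⊠ f) n ≡ 0#
  coef-X^-below (suc v) f {n} n<v = trans (at (≈-trans (⊠-assoc X (X ^ₚ v) f) (X-⊠ (X ^ₚ v ⊠ f))) n) (go n n<v)
    where
    go : ∀ n → n < suc v → coef (0# ∷ X ^ₚ v ⊠ f) n ≡ 0#
    go zero    _       = refl
    go (suc n) (s≤s q) = coef-X^-below v f q

  coef-X^-at : ∀ v f → coef (X ^ₚ v ⊠ f) v ≡ coef f 0
  coef-X^-at zero    f = at (⊠-identityˡ f) 0
  coef-X^-at (suc v) f = trans (at (≈-trans (⊠-assoc X (X ^ₚ v) f) (X-⊠ (X ^ₚ v ⊠ f))) (suc v)) (coef-X^-at v f)

  coef-0 : ∀ f → coef f 0 ≡ eval f 0#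
  coef-0 []       = refl
  coef-0 (a ∷ as) = sym (trans (cong (a +_) (zeroˡ _)) (+-identityʳ a))

-- Stepanov's bound for the number of points with a given character value

module Stepanov {p : ℕ} (K : PrimeField p) (o P : ℕ) (p≡ : p ≡ suc (o ℕ.* P)) where
  open FieldFacts K
  open Polynomial K hiding (module P)
  open Polynomial K using () renaming (module P to PolyRing)
  open RootBound K
  open LinearFactors K

  -- Powers of X^p are constants for `D`: the only nonzero coefficient is multiplied by a multiple
  -- of p. They enlarge the supply of auxiliary polynomials without complicating their derivatives.
  D-X^p : ∀ j → D (X ^ₚ (p ℕ.* j)) ≈ []
  D-X^p j = mk λ n → trans (coef-D (X ^ₚ (p ℕ.* j)) n) (go n)
    where
    go : ∀ n → suc n · coef (X ^ₚ (p ℕ.* j)) (suc n) ≡ 0#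
    go n with ℕ.<-cmp (suc n) (p ℕ.* j)
    ... | tri< n<  _ _ = trans (·≡·1* (suc n) _) (trans (cong (suc n · 1# *_) (trans (at X^-1 (suc n)) (coef-X^-below (p ℕ.* j) 1ₚ n<))) (zeroʳ _))
      where
      X^-1 : X ^ₚ (p ℕ.* j) ≈ X ^ₚ (p ℕ.* j) ⊠ 1ₚ
      X^-1 = PolyRing.sym (PolyRing.*-identityʳ _)
    ... | tri> _ _ n> = trans (·≡·1* (suc n) _) (trans (cong (suc n · 1# *_) (coef-beyond (X ^ₚ (p ℕ.* j)) (ℕ.≤-trans (deg-lin-^ 0# (p ℕ.* j)) n>))) (zeroʳ _))
    ... | tri≈ _ n≡ _ = trans (·≡·1* (suc n) _) (trans (cong (_* coef (X ^ₚ (p ℕ.* j)) (suc n)) (trans (cong (_· 1#) n≡) (trans (·1-homo-* p j)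
                          (trans (cong (_* (j · 1#)) p·1≡0) (zeroˡ _))))) (zeroˡ _))

  module _ (t : Factors) where
    -- A simple root at 0 is adjoined. It makes the order of vanishing of `b k j a` at 0 depend on
    -- k, which is what separates these polynomials from each other.
    all : Factors
    all = (0# , 1) ∷ t

    m : ℕ
    m = length all

    R : Poly
    R = rad all

    G H W : ℕ → Poly
    G k = expand (scale (k ℕ.* P) all)
    H k = expand (scale (k ℕ.* P) t)
    W k = logD (scale (k ℕ.* P) all)

    -- R^l D^l (b k j a) = x^(pj) G_k ρ_l, which at a point with value z equals z^k x^j ρ_l since x^p = x.
    ρ : ℕ → ℕ → ℕ → Poly
    ρ k a zero    = X ^ₚ a
    ρ k a (suc l) = D (ρ k a l) ⊠ R ⊞ ρ k a l ⊠ (W k ⊞ (- (l · 1#)) • D R)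

    b : ℕ → ℕ → ℕ → Poly
    b k j a = (X ^ₚ (p ℕ.* j) ⊠ G k) ⊠ X ^ₚ a

    -- The identity for l is differentiated and multiplied by R. The summand with `- (l · 1#)` in
    -- `ρ` compensates the derivative of R^l, and R times the derivative of Q is W k times Q because
    -- X^(pj) is constant.
    R-D-b : ∀ k j a l → R ^ₚ l ⊠ Dⁿ l (b k j a) ≈ (X ^ₚ (p ℕ.* j) ⊠ G k) ⊠ ρ k a l
    R-D-b k j a zero    = ⊠-identityˡ (b k j a)
    R-D-b k j a (suc l) = begin
      T
        -- The term λ' y is added and taken away again: added to T, it completes R times the
        -- derivative of R^l D^l B.
        ≈⟨ ≈-trans (⊞-cong (≈-refl {T}) cancel) (⊞-identityʳ T) ⟨
      T ⊞ (λ' • y ⊞ (- λ') • y)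
        ≈⟨ ≈-sym (⊞-assoc T (λ' • y) ((- λ') • y)) ⟩
      (T ⊞ λ' • y) ⊞ (- λ') • y
        ≈⟨ ⊞-cong lhs (≈-refl {(- λ') • y}) ⟩
      R ⊠ D (Q ⊠ r) ⊞ (- λ') • y
        ≈⟨ ⊞-cong (⊠-congʳ R (D-⊠ Q r)) (≈-trans (•-cong (- λ') (≈-refl {y})) (≈-sym (•-⊠ (- λ') (D R) (Q ⊠ r)))) ⟩
      R ⊠ (D Q ⊠ r ⊞ Q ⊠ D r) ⊞ ((- λ') • D R) ⊠ (Q ⊠ r)
        ≈⟨ ⊞-cong (PS.solve 5 (λ R dq q r dr → R PS.:* (dq PS.:* r PS.:+ q PS.:* dr) PS.:= (R PS.:* dq) PS.:* r PS.:+ q PS.:* (dr PS.:* R)) ≈-refl R (D Q) Q r (D r))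
             (≈-refl {((- λ') • D R) ⊠ (Q ⊠ r)}) ⟩
      ((R ⊠ D Q) ⊠ r ⊞ Q ⊠ (D r ⊠ R)) ⊞ ((- λ') • D R) ⊠ (Q ⊠ r)
        ≈⟨ ⊞-cong (⊞-cong (⊠-cong R-D-Q (≈-refl {r})) (≈-refl {Q ⊠ (D r ⊠ R)})) (≈-refl {((- λ') • D R) ⊠ (Q ⊠ r)}) ⟩
      ((W k ⊠ Q) ⊠ r ⊞ Q ⊠ (D r ⊠ R)) ⊞ ((- λ') • D R) ⊠ (Q ⊠ r)
        ≈⟨ PS.solve 5 (λ w q r u v → ((w PS.:* q) PS.:* r PS.:+ q PS.:* u) PS.:+ v PS.:* (q PS.:* r) PS.:= q PS.:* (u PS.:+ r PS.:* (w PS.:+ v))) ≈-refl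
             (W k) Q r (D r ⊠ R) ((- λ') • D R) ⟩
      Q ⊠ ρ k a (suc l) ∎
      where
      open SetoidReasoning PolyRing.setoid
      Q = X ^ₚ (p ℕ.* j) ⊠ G k
      r = ρ k a l
      B = b k j a
      λ' = l · 1#
      y = D R ⊠ (Q ⊠ r)
      T = R ^ₚ suc l ⊠ Dⁿ (suc l) B
      cancel : λ' • y ⊞ (- λ') • y ≈ []
      cancel = mk λ n → trans (coef-⊞ (λ' • y) _ n) (trans (cong₂ _+_ (coef-• λ' y n) (coef-• (- λ') y n))
        (trans (sym (distribʳ (coef y n) λ' (- λ'))) (trans (cong (_* coef y n) (-‿inverseʳ λ')) (zeroˡ _))))
      R-D-Q : R ⊠ D Q ≈ W k ⊠ Q
      R-D-Q = begin
        R ⊠ D Q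
          ≈⟨ ⊠-congʳ R (≈-trans (D-⊠ (X ^ₚ (p ℕ.* j)) (G k)) (⊞-cong (⊠-cong (D-X^p j) (≈-refl {G k})) (≈-refl {X ^ₚ (p ℕ.* j) ⊠ D (G k)}))) ⟩
        R ⊠ (X ^ₚ (p ℕ.* j) ⊠ D (G k))
          ≈⟨ ⊠-swap′ R (X ^ₚ (p ℕ.* j)) (D (G k)) ⟩
        X ^ₚ (p ℕ.* j) ⊠ (R ⊠ D (G k))
          ≈⟨ ⊠-congʳ (X ^ₚ (p ℕ.* j)) (subst (λ h → h ⊠ D (G k) ≈ W k ⊠ G k) (rad-scale (k ℕ.* P) all) (rad-D-expand (scale (k ℕ.* P) all))) ⟩
        X ^ₚ (p ℕ.* j) ⊠ (W k ⊠ G k)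
          ≈⟨ ⊠-swap′ (X ^ₚ (p ℕ.* j)) (W k) (G k) ⟩
        W k ⊠ Q ∎
        where
        ⊠-swap′ : ∀ f g h → f ⊠ (g ⊠ h) ≈ g ⊠ (f ⊠ h)
        ⊠-swap′ = PS.solve 3 (λ u v w → u PS.:* (v PS.:* w) PS.:= v PS.:* (u PS.:* w)) ≈-refl
      lhs : T ⊞ λ' • y ≈ R ⊠ D (Q ⊠ r)
      lhs = begin
        T ⊞ λ' • y
          ≈⟨ ⊞-cong (≈-refl {T}) (begin
               λ' • (D R ⊠ (Q ⊠ r))                   ≈⟨ •-⊠ λ' (D R) (Q ⊠ r) ⟨
               (λ' • D R) ⊠ (Q ⊠ r)                   ≈⟨ ⊠-congʳ (λ' • D R) (≈-sym (R-D-b k j a l)) ⟩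
               (λ' • D R) ⊠ (R ^ₚ l ⊠ Dⁿ l B)         ≈⟨ ⊠-assoc (λ' • D R) (R ^ₚ l) (Dⁿ l B) ⟨
               ((λ' • D R) ⊠ R ^ₚ l) ⊠ Dⁿ l B         ≈⟨ ⊠-cong (≈-trans (•-⊠ λ' (D R) (R ^ₚ l)) (≈-sym (⊠-D-^ R l))) (≈-refl {Dⁿ l B}) ⟩
               (R ⊠ D (R ^ₚ l)) ⊠ Dⁿ l B              ∎) ⟩
        T ⊞ (R ⊠ D (R ^ₚ l)) ⊠ Dⁿ l B
          ≈⟨ PS.solve 5 (λ R rl d dr e → (R PS.:* rl) PS.:* e PS.:+ (R PS.:* dr) PS.:* d PS.:= R PS.:* (dr PS.:* d PS.:+ rl PS.:* e)) ≈-refl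
               R (R ^ₚ l) (Dⁿ l B) (D (R ^ₚ l)) (Dⁿ (suc l) B) ⟩
        R ⊠ (D (R ^ₚ l) ⊠ Dⁿ l B ⊞ R ^ₚ l ⊠ D (Dⁿ l B))
          ≈⟨ ⊠-congʳ R (D-⊠ (R ^ₚ l) (Dⁿ l B)) ⟨
        R ⊠ D (R ^ₚ l ⊠ Dⁿ l B)
          ≈⟨ ⊠-congʳ R (D-cong (R-D-b k j a l)) ⟩
        R ⊠ D (Q ⊠ r) ∎

    -- R and W k have degree at most m, so each differentiation costs only m. That the large
    -- exponents k P leave no trace here keeps the number of equations small.
    deg-ρ : ∀ k a l → ρ k a l hasDegree≤ a ℕ.+ l ℕ.* m
    deg-ρ k a zero    = subst (X ^ₚ a hasDegree≤_) (sym (ℕ.+-identityʳ a)) (deg-lin-^ 0# a)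
    deg-ρ k a (suc l) = subst (ρ k a (suc l) hasDegree≤_)
      (+-*-Solver.solve 3 (λ a l m → (a :+ l) :+ m := a :+ (m :+ l)) refl a (l ℕ.* m) m)
      (length-⊞ (D r ⊠ R) _
        (deg-⊠ (D r) R (length-D r (deg-ρ k a l)) (deg-rad all))
        (deg-⊠ r _ (deg-ρ k a l) (length-⊞ (W k) _ degW (length-• (- (l · 1#)) (D R) (length-D R (deg-rad all))))))
      where
      open +-*-Solver using (_:+_; _:=_)
      r = ρ k a l
      degW : W k hasDegree≤ m
      degW = subst (λ n → W k hasDegree≤ suc n) (List.length-map _ t) (deg-logD (scale (k ℕ.* P) all))

    deg-b : ∀ k j a → b k j a hasDegree≤ p ℕ.* j ℕ.+ k ℕ.* P ℕ.* degree all ℕ.+ a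
    deg-b k j a = deg-⊠ (X ^ₚ (p ℕ.* j) ⊠ G k) (X ^ₚ a)
      (deg-⊠ (X ^ₚ (p ℕ.* j)) (G k) (deg-lin-^ 0# (p ℕ.* j))
        (subst (G k hasDegree≤_) (degree-scale (k ℕ.* P) all) (deg-expand (scale (k ℕ.* P) all))))
      (deg-lin-^ 0# a)

    valuation : ℕ → ℕ → ℕ → ℕ
    valuation k j a = p ℕ.* j ℕ.+ k ℕ.* P ℕ.+ a

    b-factored : ∀ k j a → b k j a ≈ X ^ₚ valuation k j a ⊠ H k
    b-factored k j a = begin
      (X ^ₚ (p ℕ.* j) ⊠ (X ^ₚ (k ℕ.* P ℕ.* 1) ⊠ H k)) ⊠ X ^ₚ a
        ≈⟨ PS.solve 4 (λ u v h w → (u PS.:* (v PS.:* h)) PS.:* w PS.:= ((u PS.:* v) PS.:* w) PS.:* h) ≈-refl (X ^ₚ (p ℕ.* j)) (X ^ₚ (k ℕ.* P ℕ.* 1)) (H k) (X ^ₚ a) ⟩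
      ((X ^ₚ (p ℕ.* j) ⊠ X ^ₚ (k ℕ.* P ℕ.* 1)) ⊠ X ^ₚ a) ⊠ H k
        ≡⟨ cong (λ n → ((X ^ₚ (p ℕ.* j) ⊠ X ^ₚ n) ⊠ X ^ₚ a) ⊠ H k) (ℕ.*-identityʳ (k ℕ.* P)) ⟩
      ((X ^ₚ (p ℕ.* j) ⊠ X ^ₚ (k ℕ.* P)) ⊠ X ^ₚ a) ⊠ H k
        ≈⟨ ⊠-cong (⊠-cong (≈-sym (^ₚ-homo-* X (p ℕ.* j) (k ℕ.* P))) (≈-refl {X ^ₚ a})) (≈-refl {H k}) ⟩
      (X ^ₚ (p ℕ.* j ℕ.+ k ℕ.* P) ⊠ X ^ₚ a) ⊠ H k
        ≈⟨ ⊠-cong (≈-sym (^ₚ-homo-* X (p ℕ.* j ℕ.+ k ℕ.* P) a)) (≈-refl {H k}) ⟩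
      X ^ₚ valuation k j a ⊠ H k ∎
      where
      open SetoidReasoning PolyRing.setoid
      open Exp PolyRing.semiring using () renaming (^-homo-* to ^ₚ-homo-*)

    eval-b : ∀ k j a l x z → value all x ^ P ≡ z →
      eval R x ^ l * eval (Dⁿ l (b k j a)) x ≡ eval (z ^ k • (X ^ₚ j ⊠ ρ k a l)) x
    eval-b k j a l x z e = begin
      eval R x ^ l * eval (Dⁿ l (b k j a)) x
        ≡⟨ trans (eval-⊠ (R ^ₚ l) _ x) (cong (_* eval (Dⁿ l (b k j a)) x) (eval-^ R l x)) ⟨
      eval (R ^ₚ l ⊠ Dⁿ l (b k j a)) x
        ≡⟨ eval-cong x (R-D-b k j a l) ⟩
      eval ((X ^ₚ (p ℕ.* j) ⊠ G k) ⊠ r) x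
        ≡⟨ trans (eval-⊠ (X ^ₚ (p ℕ.* j) ⊠ G k) r x) (cong (_* eval r x) (eval-⊠ (X ^ₚ (p ℕ.* j)) (G k) x)) ⟩
      eval (X ^ₚ (p ℕ.* j)) x * eval (G k) x * eval r x
        ≡⟨ cong₂ (λ u v → u * v * eval r x) x^pj G^k ⟩
      x ^ j * z ^ k * eval r x
        ≡⟨ S.solve 3 (λ u v w → u S.:* v S.:* w S.:= v S.:* (u S.:* w)) refl (x ^ j) (z ^ k) (eval r x) ⟩
      z ^ k * (x ^ j * eval r x)
        ≡⟨ trans (eval-• (z ^ k) (X ^ₚ j ⊠ r) x) (cong (z ^ k *_) (trans (eval-⊠ (X ^ₚ j) r x) (cong (_* eval r x) (x^ j)))) ⟨
      eval (z ^ k • (X ^ₚ j ⊠ r)) x ∎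
      where
      open ≡-Reasoning
      r = ρ k a l
      x^ : ∀ n → eval (X ^ₚ n) x ≡ x ^ n
      x^ n = trans (eval-^ X n x) (cong (_^ n) (trans (eval-lin 0# x) (+-identityʳ x)))
      x^pj : eval (X ^ₚ (p ℕ.* j)) x ≡ x ^ j
      x^pj = trans (x^ (p ℕ.* j)) (trans (sym (^-assocʳ x p j)) (cong (_^ j) (frobenius x)))
      G^k : eval (G k) x ≡ z ^ k
      G^k = trans (eval-expand (scale (k ℕ.* P) all) x) (trans (value-scale (k ℕ.* P) all x)
        (trans (cong (value all x ^_) (ℕ.*-comm k P)) (trans (sym (^-assocʳ (value all x) P k)) (cong (_^ k) e))))

  divMod-unique : ∀ {r r′ t t′} .{{_ : NonZero P}} → r < P → r′ < P → r ℕ.+ t ℕ.* P ≡ r′ ℕ.+ t′ ℕ.* P → r ≡ r′ × t ≡ t′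
  divMod-unique {r} {r′} {t} {t′} r< r′< e = r≡r′ , ℕ.*-cancelʳ-≡ t t′ P (ℕ.+-cancelˡ-≡ r _ _ (trans e (cong (ℕ._+ t′ ℕ.* P) (sym r≡r′))))
    where
    r≡r′ : r ≡ r′
    r≡r′ = begin
      r                         ≡⟨ m<n⇒m%n≡m r< ⟨
      r % P                     ≡⟨ [m+kn]%n≡m%n r t P ⟨
      (r ℕ.+ t ℕ.* P) % P       ≡⟨ cong (_% P) e ⟩
      (r′ ℕ.+ t′ ℕ.* P) % P     ≡⟨ [m+kn]%n≡m%n r′ t′ P ⟩
      r′ % P                    ≡⟨ m<n⇒m%n≡m r′< ⟩
      r′                        ∎
      where open ≡-Reasoning

  -- The unknowns are the scalars of the o J A polynomials `b t k j a` with k < o, j < J, a < A,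
  -- where a, k, j are the digits of the index in mixed radix. For each of the M orders at most J +
  -- A + M m coefficients have to vanish, m counting the factors with X included. The polynomial
  -- obtained has length at most p (J + 1 + degree t), and `rootBound` bounds `length Z ℕ.* M` by
  -- this length.
  stepanov : ∀ (t : Factors) → All (λ ce → proj₁ ce ≢ 0#) t →
    ∀ J A M .{{_ : NonZero A}} .{{_ : NonZero o}} .{{_ : NonZero P}} → A ℕ.+ J ≤ P →
    M ℕ.* (J ℕ.+ A ℕ.+ M ℕ.* suc (length t)) < o ℕ.* J ℕ.* A → M ≤ p →
    ∀ z (Z : List F) → Unique Z → (∀ {x} → x ∈ Z → NonRoot ((0# , 1) ∷ t) x × value ((0# , 1) ∷ t) x ^ P ≡ z) →
    length Z ℕ.* M ≤ p ℕ.* (J ℕ.+ suc (degree t))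
  stepanov t t≢0 J A M A+J≤P Md<N M≤p z Z uZ good =
    auxiliary bₛ σ (λ l x → eval (R t) x ^ l) Z
      (independent bₛ v v-injective
        (λ s n n< → trans (at (b-factored t (κ s) (ι s) (α s)) n) (coef-X^-below (v s) (H t (κ s)) n<))
        (λ s e → H0≢0 (κ s) (trans (sym (coef-X^-at (v s) (H t (κ s)))) (trans (sym (at (b-factored t (κ s) (ι s) (α s)) (v s))) e))))
      len-b len-σ Md<N M≤p uZ
      (λ {x} x∈ l → ^≢0 l (rad≢0 (all t) x (proj₁ (good x∈))))
      (λ {x} x∈ l s → eval-b t (κ s) (ι s) (α s) l x z (proj₂ (good x∈)))
    where
    N = o ℕ.* J ℕ.* A
    τ κ ι α : Fin N → ℕ
    τ s = toℕ s / A
    κ s = τ s % o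
    ι s = τ s / o
    α s = toℕ s % A
    τ< : ∀ s → τ s < o ℕ.* J
    τ< s = m<n*o⇒m/o<n {toℕ s} {o ℕ.* J} {A} (Fin.toℕ<n s)
    ι< : ∀ s → ι s < J
    ι< s = m<n*o⇒m/o<n {τ s} {J} {o} (subst (τ s <_) (ℕ.*-comm o J) (τ< s))
    α< : ∀ s → α s < A
    α< s = m%n<n (toℕ s) A
    κ< : ∀ s → κ s < o
    κ< s = m%n<n (τ s) o
    bₛ : Fin N → Poly
    bₛ s = b t (κ s) (ι s) (α s)
    σ : ℕ → Fin N → Poly
    σ l s = z ^ κ s • (X ^ₚ ι s ⊠ ρ t (κ s) (α s) l)
    v : Fin N → ℕ
    v s = valuation t (κ s) (ι s) (α s)
    -- Because p = o P + 1, the order p j + k P + a has quotient k + o j and remainder a + j modulo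
    -- P. The hypothesis A + J ≤ P prevents a carry, so all the digits can be recovered.
    v-alt : ∀ s → v s ≡ (α s ℕ.+ ι s) ℕ.+ τ s ℕ.* P
    v-alt s = begin
      p ℕ.* ι s ℕ.+ κ s ℕ.* P ℕ.+ α s               ≡⟨ cong (λ q → q ℕ.* ι s ℕ.+ κ s ℕ.* P ℕ.+ α s) p≡ ⟩
      suc (o ℕ.* P) ℕ.* ι s ℕ.+ κ s ℕ.* P ℕ.+ α s   ≡⟨ solve 5 (λ o P i k a → (con 1 :+ o :* P) :* i :+ k :* P :+ a := (a :+ i) :+ (k :+ i :* o) :* P) refl o P (ι s) (κ s) (α s) ⟩
      (α s ℕ.+ ι s) ℕ.+ (κ s ℕ.+ ι s ℕ.* o) ℕ.* P   ≡⟨ cong (λ q → (α s ℕ.+ ι s) ℕ.+ q ℕ.* P) (m≡m%n+[m/n]*n (τ s) o) ⟨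
      (α s ℕ.+ ι s) ℕ.+ τ s ℕ.* P                   ∎
      where
      open ≡-Reasoning
      open +-*-Solver
    offset< : ∀ s → α s ℕ.+ ι s < P
    offset< s = ℕ.<-≤-trans (ℕ.+-mono-< (α< s) (ι< s)) A+J≤P
    v-injective : ∀ {s s′} → v s ≡ v s′ → s ≡ s′
    v-injective {s} {s′} e with divMod-unique (offset< s) (offset< s′) (trans (sym (v-alt s)) (trans e (v-alt s′)))
    ... | offset≡ , τ≡ = Fin.toℕ-injective (begin
      toℕ s                  ≡⟨ m≡m%n+[m/n]*n (toℕ s) A ⟩
      α s ℕ.+ τ s ℕ.* A      ≡⟨ cong₂ (λ a q → a ℕ.+ q ℕ.* A) α≡ τ≡ ⟩
      α s′ ℕ.+ τ s′ ℕ.* A    ≡⟨ m≡m%n+[m/n]*n (toℕ s′) A ⟨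
      toℕ s′                 ∎)
      where
      open ≡-Reasoning
      α≡ : α s ≡ α s′
      α≡ = ℕ.+-cancelʳ-≡ (ι s) _ _ (trans offset≡ (cong (λ q → α s′ ℕ.+ q / o) (sym τ≡)))
    H0≢0 : ∀ k → coef (H t k) 0 ≢ 0#
    H0≢0 k e = value≢0 (scale (k ℕ.* P) t) 0# (nonRoot t t≢0)
      (trans (sym (trans (coef-0 (H t k)) (eval-expand (scale (k ℕ.* P) t) 0#))) e)
      where
      nonRoot : ∀ t → All (λ ce → proj₁ ce ≢ 0#) t → NonRoot (scale (k ℕ.* P) t) 0#
      nonRoot []      []       = []
      nonRoot (_ ∷ t) (q ∷ qs) = (λ e → q (trans (sym (+-identityˡ _)) e)) ∷ nonRoot t qs
    len-b : ∀ s → length (bₛ s) ≤ p ℕ.* (J ℕ.+ suc (degree t))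
    len-b s = begin
      length (bₛ s)                                                        ≤⟨ deg-b t (κ s) (ι s) (α s) ⟩
      suc (p ℕ.* ι s ℕ.+ κ s ℕ.* P ℕ.* d ℕ.+ α s)                          ≡⟨ solve 3 (λ u v w → con 1 :+ (u :+ v :+ w) := (u :+ (con 1 :+ w)) :+ v) refl (p ℕ.* ι s) (κ s ℕ.* P ℕ.* d) (α s) ⟩
      p ℕ.* ι s ℕ.+ suc (α s) ℕ.+ κ s ℕ.* P ℕ.* d                          ≤⟨ ℕ.+-mono-≤ (ℕ.+-monoʳ-≤ (p ℕ.* ι s) (ℕ.≤-trans (α< s) A≤p)) (ℕ.*-monoˡ-≤ d κP≤p) ⟩
      p ℕ.* ι s ℕ.+ p ℕ.+ p ℕ.* d                                          ≡⟨ solve 3 (λ p i d → p :* i :+ p :+ p :* d := p :* (con 1 :+ i) :+ p :* d) refl p (ι s) d ⟩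
      p ℕ.* suc (ι s) ℕ.+ p ℕ.* d                                          ≤⟨ ℕ.+-monoˡ-≤ (p ℕ.* d) (ℕ.*-monoʳ-≤ p (ι< s)) ⟩
      p ℕ.* J ℕ.+ p ℕ.* d                                                  ≡⟨ ℕ.*-distribˡ-+ p J d ⟨
      p ℕ.* (J ℕ.+ d)                                                      ∎
      where
      open ℕ.≤-Reasoning
      open +-*-Solver
      d = suc (degree t)
      P≤p : P ≤ p
      P≤p = subst (P ≤_) (sym p≡) (ℕ.m≤n⇒m≤1+n (ℕ.m≤n*m P o))
      A≤p : A ≤ p
      A≤p = ℕ.≤-trans (ℕ.≤-trans (ℕ.m≤m+n A J) A+J≤P) P≤p
      κP≤p : κ s ℕ.* P ≤ p
      κP≤p = subst (κ s ℕ.* P ≤_) (sym p≡) (ℕ.m≤n⇒m≤1+n (ℕ.*-monoˡ-≤ P (ℕ.<⇒≤ (κ< s))))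
    len-σ : ∀ {l} → l < M → ∀ s → length (σ l s) ≤ J ℕ.+ A ℕ.+ M ℕ.* suc (length t)
    len-σ {l} l<M s = begin
      length (σ l s)                                   ≤⟨ length-• (z ^ κ s) (X ^ₚ ι s ⊠ ρ t (κ s) (α s) l)
                                                            (deg-⊠ (X ^ₚ ι s) (ρ t (κ s) (α s) l) (deg-lin-^ 0# (ι s)) (deg-ρ t (κ s) (α s) l)) ⟩
      suc (ι s) ℕ.+ (α s ℕ.+ l ℕ.* suc (length t))     ≤⟨ ℕ.+-mono-≤ (ι< s) (ℕ.+-mono-≤ (ℕ.<⇒≤ (α< s)) (ℕ.*-monoˡ-≤ (suc (length t)) (ℕ.<⇒≤ l<M))) ⟩
      J ℕ.+ (A ℕ.+ M ℕ.* suc (length t))               ≡⟨ ℕ.+-assoc J A _ ⟨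
      J ℕ.+ A ℕ.+ M ℕ.* suc (length t)                 ∎
      where open ℕ.≤-Reasoning

-- Sums of the quartic character

mod-4-mod-2 : ∀ e → e % 4 % 2 ≡ e % 2
mod-4-mod-2 e = sym (trans (cong (_% 2) (trans (m≡m%n+[m/n]*n e 4) (cong (e % 4 ℕ.+_) (sym (ℕ.*-assoc (e / 4) 2 2)))))
  ([m+kn]%n≡m%n (e % 4) (e / 4 ℕ.* 2) 2))

indicator : ∀ {A : Set} → Dec A → ℕ
indicator d = if does d then 1 else 0

indicator-cong : ∀ {A B : Set} (d : Dec A) (e : Dec B) → (A → B) → (B → A) → indicator d ≡ indicator e
indicator-cong (yes a) (yes b) f g = refl
indicator-cong (yes a) (no ¬b) f g = ⊥-elim (¬b (f a))
indicator-cong (no ¬a) (yes b) f g = ⊥-elim (¬a (g b))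
indicator-cong (no ¬a) (no ¬b) f g = refl

module _ {A : Set} where
  Σ[_] : List A → (A → ℕ) → ℕ
  Σ[ xs ] f = sumℕ (map f xs)

  Σ-cong : ∀ xs {f g : A → ℕ} → (∀ {x} → x ∈ xs → f x ≡ g x) → Σ[ xs ] f ≡ Σ[ xs ] g
  Σ-cong []       e = refl
  Σ-cong (x ∷ xs) e = cong₂ ℕ._+_ (e (here refl)) (Σ-cong xs (e ∘ there))

  Σ-mono : ∀ xs {f g : A → ℕ} → (∀ {x} → x ∈ xs → f x ≤ g x) → Σ[ xs ] f ≤ Σ[ xs ] g
  Σ-mono []       e = z≤n
  Σ-mono (x ∷ xs) e = ℕ.+-mono-≤ (e (here refl)) (Σ-mono xs (e ∘ there))

  Σ-+ : ∀ xs (f g : A → ℕ) → Σ[ xs ] (λ x → f x ℕ.+ g x) ≡ Σ[ xs ] f ℕ.+ Σ[ xs ] g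
  Σ-+ []       f g = refl
  Σ-+ (x ∷ xs) f g = trans (cong (f x ℕ.+ g x ℕ.+_) (Σ-+ xs f g))
    (+-*-Solver.solve 4 (λ a b c d → (a :+ b) :+ (c :+ d) := (a :+ c) :+ (b :+ d)) refl (f x) (g x) _ _)
    where open +-*-Solver using (_:+_; _:=_)

  Σ-const : ∀ xs c → Σ[ xs ] (λ _ → c) ≡ length xs ℕ.* c
  Σ-const []       c = refl
  Σ-const (x ∷ xs) c = cong (c ℕ.+_) (Σ-const xs c)

  Σ-indicator : ∀ xs {Q : A → Set} (Q? : Decidable Q) → Σ[ xs ] (indicator ∘ Q?) ≡ length (filter Q? xs)
  Σ-indicator []       Q? = refl
  Σ-indicator (x ∷ xs) Q? with does (Q? x)
  ... | true  = cong suc (Σ-indicator xs Q?)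
  ... | false = Σ-indicator xs Q?

  filter-but-one : ∀ {Q : A → Set} (Q? : Decidable Q) → (∀ {x y} → ¬ Q x → ¬ Q y → x ≡ y) →
                   ∀ {xs} → Unique xs → length xs ≤ suc (length (filter Q? xs))
  filter-but-one Q? one {[]}     _        = z≤n
  filter-but-one Q? one {x ∷ xs} (x∉ ∷ u) with Q? x
  ... | yes _ = s≤s (filter-but-one Q? one u)
  ... | no ¬q = s≤s (ℕ.≤-reflexive (cong length (sym (List.filter-all Q? (rest xs x∉)))))
    where
    rest : ∀ ys → All (x ≢_) ys → All _ ys
    rest []       []       = []
    rest (y ∷ ys) (q ∷ qs) with Q? y
    ... | yes r = r ∷ rest ys qs
    ... | no ¬r = ⊥-elim (q (one ¬q ¬r))

sumTo : ℕ → (ℕ → ℕ) → ℕ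
sumTo zero    f = 0
sumTo (suc n) f = f n ℕ.+ sumTo n f

sumTo-cong : ∀ n {f g : ℕ → ℕ} → (∀ k → f k ≡ g k) → sumTo n f ≡ sumTo n g
sumTo-cong zero    e = refl
sumTo-cong (suc n) e = cong₂ ℕ._+_ (e n) (sumTo-cong n e)

Σ-sumTo : ∀ {A : Set} (xs : List A) n (f : ℕ → A → ℕ) → Σ[ xs ] (λ x → sumTo n (λ k → f k x)) ≡ sumTo n (λ k → Σ[ xs ] (f k))
Σ-sumTo xs zero    f = trans (Σ-const xs 0) (ℕ.*-zeroʳ (length xs))
Σ-sumTo xs (suc n) f = trans (Σ-+ xs (f n) _) (cong (Σ[ xs ] (f n) ℕ.+_) (Σ-sumTo xs n f))

-- A lower bound for g - f, written without subtraction, in a shape that survives summation over the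
-- powers of a character.
sumTo-≤ : ∀ n U V M (f g : ℕ → ℕ) → (∀ k → k < n → U ℕ.+ M ℕ.* f k ≤ M ℕ.* g k ℕ.+ V) →
          n ℕ.* U ℕ.+ M ℕ.* sumTo n f ≤ M ℕ.* sumTo n g ℕ.+ n ℕ.* V
sumTo-≤ zero    U V M f g q = ℕ.≤-reflexive (sym (ℕ.+-identityʳ (M ℕ.* 0)))
sumTo-≤ (suc n) U V M f g q = begin
  suc n ℕ.* U ℕ.+ M ℕ.* (f n ℕ.+ sumTo n f)
    ≡⟨ solve 5 (λ n U M a b → (con 1 :+ n) :* U :+ M :* (a :+ b) := (U :+ M :* a) :+ (n :* U :+ M :* b)) refl n U M (f n) (sumTo n f) ⟩
  (U ℕ.+ M ℕ.* f n) ℕ.+ (n ℕ.* U ℕ.+ M ℕ.* sumTo n f)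
    ≤⟨ ℕ.+-mono-≤ (q n ℕ.≤-refl) (sumTo-≤ n U V M f g (λ k k<n → q k (ℕ.m<n⇒m<1+n k<n))) ⟩
  (M ℕ.* g n ℕ.+ V) ℕ.+ (M ℕ.* sumTo n g ℕ.+ n ℕ.* V)
    ≡⟨ solve 5 (λ n V M a b → (M :* a :+ V) :+ (M :* b :+ n :* V) := M :* (a :+ b) :+ (con 1 :+ n) :* V) refl n V M (g n) (sumTo n g) ⟩
  M ℕ.* (g n ℕ.+ sumTo n g) ℕ.+ suc n ℕ.* V ∎
  where
  open ℕ.≤-Reasoning
  open +-*-Solver

-- The term 0 will contain the trivial character, which is free of error; `c` records this gain.
sumTo-≤-but-first : ∀ n U V M c (f g : ℕ → ℕ) → U ℕ.+ M ℕ.* f 0 ℕ.+ c ≤ M ℕ.* g 0 ℕ.+ V →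
  (∀ k → suc k < suc n → U ℕ.+ M ℕ.* f (suc k) ≤ M ℕ.* g (suc k) ℕ.+ V) →
  suc n ℕ.* U ℕ.+ M ℕ.* sumTo (suc n) f ℕ.+ c ≤ M ℕ.* sumTo (suc n) g ℕ.+ suc n ℕ.* V
sumTo-≤-but-first zero U V M c f g q₀ q = begin
  1 ℕ.* U ℕ.+ M ℕ.* (f 0 ℕ.+ 0) ℕ.+ c   ≡⟨ cong₂ (λ u v → u ℕ.+ M ℕ.* v ℕ.+ c) (ℕ.*-identityˡ U) (ℕ.+-identityʳ (f 0)) ⟩
  U ℕ.+ M ℕ.* f 0 ℕ.+ c                 ≤⟨ q₀ ⟩
  M ℕ.* g 0 ℕ.+ V                       ≡⟨ cong₂ (λ u v → M ℕ.* v ℕ.+ u) (ℕ.*-identityˡ V) (ℕ.+-identityʳ (g 0)) ⟨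
  M ℕ.* (g 0 ℕ.+ 0) ℕ.+ 1 ℕ.* V         ∎
  where open ℕ.≤-Reasoning
sumTo-≤-but-first (suc n) U V M c f g q₀ q = begin
  suc (suc n) ℕ.* U ℕ.+ M ℕ.* (f (suc n) ℕ.+ s) ℕ.+ c
    ≡⟨ solve 6 (λ n U M a b c → (con 1 :+ n) :* U :+ M :* (a :+ b) :+ c := (U :+ M :* a) :+ (n :* U :+ M :* b :+ c)) refl (suc n) U M (f (suc n)) s c ⟩
  (U ℕ.+ M ℕ.* f (suc n)) ℕ.+ (suc n ℕ.* U ℕ.+ M ℕ.* s ℕ.+ c)
    ≤⟨ ℕ.+-mono-≤ (q n ℕ.≤-refl) (sumTo-≤-but-first n U V M c f g q₀ (λ k k<n → q k (ℕ.m<n⇒m<1+n k<n))) ⟩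
  (M ℕ.* g (suc n) ℕ.+ V) ℕ.+ (M ℕ.* r ℕ.+ suc n ℕ.* V)
    ≡⟨ solve 5 (λ n V M a b → (M :* a :+ V) :+ (M :* b :+ n :* V) := M :* (a :+ b) :+ (con 1 :+ n) :* V) refl (suc n) V M (g (suc n)) r ⟩
  M ℕ.* (g (suc n) ℕ.+ r) ℕ.+ suc (suc n) ℕ.* V ∎
  where
  open ℕ.≤-Reasoning
  open +-*-Solver
  s = sumTo (suc n) f
  r = sumTo (suc n) g

-- The quartic character and bounds for how often it takes a value

module QuarticCharacter {p : ℕ} (K : PrimeField p) (P : ℕ) (p≡ : p ≡ suc (4 ℕ.* P)) where
  open FieldFacts K
  open LinearFactors K

  χ : F → F
  χ x = x ^ P

  χ^4 : ∀ {x} → x ≢ 0# → χ x ^ 4 ≡ 1#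
  χ^4 {x} x≢0 = trans (^-assocʳ x P 4) (trans (cong (x ^_) (ℕ.*-comm P 4)) (fermat p≡ x≢0))

  χ-* : ∀ x y → χ (x * y) ≡ χ x * χ y
  χ-* x y = ^-distrib-* x y P

  χ-^ : ∀ x n → χ (x ^ n) ≡ χ x ^ n
  χ-^ x n = trans (^-assocʳ x n P) (trans (cong (x ^_) (ℕ.*-comm n P)) (sym (^-assocʳ x P n)))

  ^-mod-4 : ∀ {y} n → y ^ 4 ≡ 1# → y ^ n ≡ y ^ (n % 4)
  ^-mod-4 {y} n e = begin
    y ^ n                               ≡⟨ cong (y ^_) (m≡m%n+[m/n]*n n 4) ⟩
    y ^ (n % 4 ℕ.+ n / 4 ℕ.* 4)         ≡⟨ ^-homo-* y (n % 4) _ ⟩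
    y ^ (n % 4) * y ^ (n / 4 ℕ.* 4)     ≡⟨ cong (y ^ (n % 4) *_) (trans (cong (y ^_) (ℕ.*-comm (n / 4) 4)) (trans (sym (^-assocʳ y 4 (n / 4))) (trans (cong (_^ (n / 4)) e) (1^ (n / 4))))) ⟩
    y ^ (n % 4) * 1#                    ≡⟨ *-identityʳ _ ⟩
    y ^ (n % 4)                         ∎
    where open ≡-Reasoning

  2≢0 : 1# + 1# ≢ 0#
  2≢0 e = char {2} (s≤s z≤n) 2<p (trans (cong (1# +_) (+-identityʳ 1#)) e)
    where
    go : ∀ P → p ≡ suc (4 ℕ.* P) → 2 < p
    go zero    e = ⊥-elim (ℕ.<-irrefl (sym e) 1<p)
    go (suc P) e = subst (2 <_) (sym e) (s≤s (s≤s (subst (1 ≤_) (sym (ℕ.+-suc P _)) (s≤s z≤n))))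
    2<p : 2 < p
    2<p = go P p≡

  1≢-1 : 1# ≢ - 1#
  1≢-1 e = 2≢0 (trans (cong (1# +_) e) (-‿inverseʳ 1#))

  -x≡1⇒x≡-1 : ∀ {x} → - x ≡ 1# → x ≡ - 1#
  -x≡1⇒x≡-1 {x} e = trans (sym (-‿involutive x)) (cong -_ e)

  square-roots : ∀ {a b} → a * a ≡ b * b → a ≡ b ⊎ a ≡ - b
  square-roots {a} {b} e with integral {a + - b} {a + b} (begin
      (a + - b) * (a + b)                        ≡⟨ S.solve 3 (λ a b n → (a S.:+ n) S.:* (a S.:+ b) S.:= a S.:* a S.:+ n S.:* b S.:+ (a S.:* (b S.:+ n))) refl a b (- b) ⟩
      a * a + - b * b + a * (b + - b)            ≡⟨ cong₂ _+_ (cong₂ _+_ e (sym (-‿distribˡ-* b b))) (trans (cong (a *_) (-‿inverseʳ b)) (zeroʳ a)) ⟩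
      b * b + - (b * b) + 0#                     ≡⟨ trans (+-identityʳ _) (-‿inverseʳ _) ⟩
      0#                                         ∎)
    where open ≡-Reasoning
  ... | inj₁ q = inj₁ (+-inverse-unique q)
  ... | inj₂ q = inj₂ (+-inverse-unique (trans (cong (a +_) (-‿involutive b)) q))

  square-one : ∀ {a} → a ^ 2 ≡ 1# → a ≡ 1# ⊎ a ≡ - 1#
  square-one {a} e = square-roots (trans (trans (cong (a *_) (sym (*-identityʳ a))) e) (sym (*-identityˡ 1#)))

  fourth-roots : ∀ {ι y} → ι * ι ≡ - 1# → y ^ 4 ≡ 1# → y ≡ 1# ⊎ y ≡ - 1# ⊎ y ≡ ι ⊎ y ≡ - ι
  fourth-roots {ι} {y} ι² e =
    [ (λ y²≡1 → [ inj₁ , inj₂ ∘ inj₁ ]′ (square-one y²≡1))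
    , (λ y²≡-1 → inj₂ (inj₂ (square-roots (trans (trans (cong (y *_) (sym (*-identityʳ y))) y²≡-1) (sym ι²))))) ]′
    (square-one {y ^ 2} (trans (^-assocʳ y 2 2) e))

  -1*-1 : - 1# * - 1# ≡ 1#
  -1*-1 = trans (sym (-‿distribˡ-* 1# (- 1#))) (trans (cong -_ (*-identityˡ (- 1#))) (-‿involutive 1#))

  -1* : ∀ x → - 1# * x ≡ - x
  -1* x = trans (sym (-‿distribˡ-* 1# x)) (cong -_ (*-identityˡ x))

  -- The chosen factor is the one to be translated to the simple root at 0 that Stepanov's bound
  -- asks for.
  module Pull {Q : F × ℕ → Set} where
    chosen : ∀ t → Any Q t → F × ℕ
    chosen (ce ∷ t) (here _)  = ce
    chosen (ce ∷ t) (there a) = chosen t a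

    others : ∀ t → Any Q t → Factors
    others (ce ∷ t) (here _)  = t
    others (ce ∷ t) (there a) = ce ∷ others t a

    chosen-Q : ∀ t a → Q (chosen t a)
    chosen-Q (ce ∷ t) (here q)  = q
    chosen-Q (ce ∷ t) (there a) = chosen-Q t a

    pull-value : ∀ t a x → value t x ≡ (x + proj₁ (chosen t a)) ^ proj₂ (chosen t a) * value (others t a) x
    pull-value (ce ∷ t) (here _)  x = refl
    pull-value (ce ∷ t) (there a) x = trans (cong ((x + proj₁ ce) ^ proj₂ ce *_) (pull-value t a x))
      (S.solve 3 (λ u v w → u S.:* (v S.:* w) S.:= v S.:* (u S.:* w)) refl ((x + proj₁ ce) ^ proj₂ ce)
        ((x + proj₁ (chosen t a)) ^ proj₂ (chosen t a)) (value (others t a) x))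

    pull-All : ∀ {R : F × ℕ → Set} t a → All R t → R (chosen t a) × All R (others t a)
    pull-All (ce ∷ t) (here _)  (r ∷ rs) = r , rs
    pull-All (ce ∷ t) (there a) (r ∷ rs) = proj₁ (pull-All t a rs) , r ∷ proj₂ (pull-All t a rs)

    length-others : ∀ t a → length t ≡ suc (length (others t a))
    length-others (ce ∷ t) (here _)  = refl
    length-others (ce ∷ t) (there a) = cong suc (length-others t a)

    others-distinct : ∀ t a → AllPairs (λ u v → proj₁ u ≢ proj₁ v) t → All (λ u → proj₁ u ≢ proj₁ (chosen t a)) (others t a)
    others-distinct (ce ∷ t) (here _)  (d ∷ ds) = All.map (λ q e → q (sym e)) d
    others-distinct (ce ∷ t) (there a) (d ∷ ds) = proj₁ (pull-All t a d) ∷ others-distinct t a ds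

  open Pull

  Distinct : Factors → Set
  Distinct = AllPairs (λ u v → proj₁ u ≢ proj₁ v)

  module Counting (J M m₀ A₄ A₂ : ℕ)
    (A₄≢0 : NonZero A₄) (A₂≢0 : NonZero A₂) (P≢0 : NonZero P)
    (A₄+J≤P : A₄ ℕ.+ J ≤ P) (A₂+J≤2P : A₂ ℕ.+ J ≤ 2 ℕ.* P)
    (unknowns₄ : (2 ℕ.* M) ℕ.* (J ℕ.+ A₄ ℕ.+ (2 ℕ.* M) ℕ.* m₀) < 4 ℕ.* J ℕ.* A₄)
    (unknowns₂ : M ℕ.* (J ℕ.+ A₂ ℕ.+ M ℕ.* m₀) < 2 ℕ.* J ℕ.* A₂)
    (2M≤p : 2 ℕ.* M ≤ p) where

    -- With M close to 2J, a value of a character of order 4 is taken at most Y / (2M), about p / 4,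
    -- times, and a value of one of order 2 at most Y / M, about p / 2, times. The summand 3 m₀
    -- bounds the degree once exponents are reduced to at most 3.
    Y : ℕ
    Y = p ℕ.* (J ℕ.+ 3 ℕ.* m₀)

    private
      -- Stepanov's bound needs a simple root at 0: translate the chosen root there, and rescale the exponents
      -- through g and k so that it becomes simple.
      count : ∀ o P′ (p≡′ : p ≡ suc (o ℕ.* P′)) A N (A≢0 : NonZero A) (o≢0 : NonZero o) (P′≢0 : NonZero P′) →
        A ℕ.+ J ≤ P′ → N ℕ.* (J ℕ.+ A ℕ.+ N ℕ.* m₀) < o ℕ.* J ℕ.* A → N ≤ p →
        ∀ {Q} t (a : Any Q t) k (g : ℕ → ℕ) → (∀ n → g n ≤ 3) →
        (∀ {y} → y ≢ 0# → y ^ P′ ≡ χ (y ^ proj₂ (chosen t a)) ^ k) →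
        All (λ ce → ∀ {y} → y ≢ 0# → (y ^ g (proj₂ ce)) ^ P′ ≡ χ (y ^ proj₂ ce) ^ k) t →
        Distinct t → length t ≤ m₀ →
        ∀ z Z → Unique Z → (∀ {x} → x ∈ Z → NonRoot t x × χ (value t x) ≡ z) → length Z ℕ.* N ≤ Y
      count o P′ p≡′ A N A≢0 o≢0 P′≢0 A+J≤P′ unknowns N≤p t a k g g≤3 simple scaled dist len z Z uZ good = begin
        length Z ℕ.* N     ≡⟨ cong (ℕ._* N) (List.length-map (_+ c₀) Z) ⟨
        length Z′ ℕ.* N    ≤⟨ stepanov t″ t″≢0 J A N {{A≢0}} {{o≢0}} {{P′≢0}} A+J≤P′ unknowns′ N≤p (z ^ k) Z′
                                (Unique.map⁺ (λ {x} {y} e → +-cancelʳ c₀ x y e) uZ) good′ ⟩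
        p ℕ.* (J ℕ.+ suc (degree t″)) ≤⟨ ℕ.*-monoʳ-≤ p (ℕ.+-monoʳ-≤ J degree-bound) ⟩
        Y                  ∎
        where
        open ℕ.≤-Reasoning
        open Stepanov K o P′ p≡′ using (stepanov)
        c₀ = proj₁ (chosen t a)
        e₀ = proj₂ (chosen t a)
        t′ = others t a
        move : F × ℕ → F × ℕ
        move ce = proj₁ ce + - c₀ , g (proj₂ ce)
        t″ = map move t′
        Z′ = map (_+ c₀) Z
        len′ : suc (length t′) ≤ m₀
        len′ = subst (_≤ m₀) (length-others t a) len
        len″ : suc (length t″) ≤ m₀
        len″ = subst (λ n → suc n ≤ m₀) (sym (List.length-map move t′)) len′
        unknowns′ : N ℕ.* (J ℕ.+ A ℕ.+ N ℕ.* suc (length t″)) < o ℕ.* J ℕ.* A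
        unknowns′ = ℕ.≤-<-trans (ℕ.*-monoʳ-≤ N (ℕ.+-monoʳ-≤ (J ℕ.+ A) (ℕ.*-monoʳ-≤ N len″))) unknowns
        t″≢0 : All (λ ce → proj₁ ce ≢ 0#) t″
        t″≢0 = All.map⁺ (All.map (λ q e → q (+-inverse-unique e)) (others-distinct t a dist))
        degree-bound : suc (degree t″) ≤ 3 ℕ.* m₀
        degree-bound = ℕ.≤-trans (go t′) (ℕ.*-monoʳ-≤ 3 len′)
          where
          go : ∀ s → suc (degree (map move s)) ≤ 3 ℕ.* suc (length s)
          go []       = s≤s z≤n
          go (ce ∷ s) = ℕ.≤-trans (ℕ.≤-reflexive (sym (ℕ.+-suc (g (proj₂ ce)) _)))
            (ℕ.≤-trans (ℕ.+-mono-≤ (g≤3 (proj₂ ce)) (go s)) (ℕ.≤-reflexive (sym (ℕ.*-suc 3 (suc (length s))))))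
        shift : ∀ x c → x + c₀ + (c + - c₀) ≡ x + c
        shift x c = trans (S.solve 4 (λ x a c b → x S.:+ a S.:+ (c S.:+ b) S.:= x S.:+ c S.:+ (a S.:+ b)) refl x c₀ c (- c₀))
          (trans (cong (x + c +_) (-‿inverseʳ c₀)) (+-identityʳ (x + c)))
        value-moved : ∀ s x → NonRoot s x → All (λ ce → ∀ {y} → y ≢ 0# → (y ^ g (proj₂ ce)) ^ P′ ≡ χ (y ^ proj₂ ce) ^ k) s →
          value (map move s) (x + c₀) ^ P′ ≡ χ (value s x) ^ k
        value-moved []             x _        _        = trans (1^ P′) (sym (trans (cong (_^ k) (1^ P)) (1^ k)))
        value-moved ((c , e) ∷ s) x (q ∷ qs) (r ∷ rs) = ≡-Reasoning.begin
          ((x + c₀ + (c + - c₀)) ^ g e * v) ^ P′      ≡-Reasoning.≡⟨ cong (λ u → (u ^ g e * v) ^ P′) (shift x c) ⟩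
          ((x + c) ^ g e * v) ^ P′                    ≡-Reasoning.≡⟨ ^-distrib-* ((x + c) ^ g e) v P′ ⟩
          ((x + c) ^ g e) ^ P′ * v ^ P′               ≡-Reasoning.≡⟨ cong₂ _*_ (r q) (value-moved s x qs rs) ⟩
          χ ((x + c) ^ e) ^ k * χ (value s x) ^ k     ≡-Reasoning.≡⟨ ^-distrib-* (χ ((x + c) ^ e)) (χ (value s x)) k ⟨
          (χ ((x + c) ^ e) * χ (value s x)) ^ k       ≡-Reasoning.≡⟨ cong (_^ k) (χ-* ((x + c) ^ e) (value s x)) ⟨
          χ ((x + c) ^ e * value s x) ^ k             ≡-Reasoning.∎
          where v = value (map move s) (x + c₀)
        good′ : ∀ {x} → x ∈ Z′ → NonRoot ((0# , 1) ∷ t″) x × value ((0# , 1) ∷ t″) x ^ P′ ≡ z ^ k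
        good′ x∈ with ∈-map⁻ (_+ c₀) x∈
        ... | x , x∈Z , refl = (λ e → x+c₀≢0 (trans (sym (+-identityʳ _)) e)) ∷ All.map⁺ (All.map (λ {ce} q e → q (trans (sym (shift x (proj₁ ce))) e)) nr′) , (≡-Reasoning.begin
          ((x + c₀ + 0#) ^ 1 * v) ^ P′                 ≡-Reasoning.≡⟨ cong (λ u → (u * v) ^ P′) (trans (*-identityʳ _) (+-identityʳ _)) ⟩
          ((x + c₀) * v) ^ P′                          ≡-Reasoning.≡⟨ ^-distrib-* (x + c₀) v P′ ⟩
          (x + c₀) ^ P′ * v ^ P′                       ≡-Reasoning.≡⟨ cong₂ _*_ (simple x+c₀≢0) (value-moved t′ x nr′ (proj₂ (pull-All t a scaled))) ⟩
          χ ((x + c₀) ^ e₀) ^ k * χ (value t′ x) ^ k   ≡-Reasoning.≡⟨ ^-distrib-* (χ ((x + c₀) ^ e₀)) (χ (value t′ x)) k ⟨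
          (χ ((x + c₀) ^ e₀) * χ (value t′ x)) ^ k     ≡-Reasoning.≡⟨ cong (_^ k) (χ-* ((x + c₀) ^ e₀) (value t′ x)) ⟨
          χ ((x + c₀) ^ e₀ * value t′ x) ^ k           ≡-Reasoning.≡⟨ cong (λ u → χ u ^ k) (pull-value t a x) ⟨
          χ (value t x) ^ k                            ≡-Reasoning.≡⟨ cong (_^ k) (proj₂ (good x∈Z)) ⟩
          z ^ k                                        ≡-Reasoning.∎)
          where
          v = value t″ (x + c₀)
          nr = pull-All t a (proj₁ (good x∈Z))
          x+c₀≢0 = proj₁ nr
          nr′ = proj₂ nr

    χ-^-mod-4 : ∀ {y} n → y ≢ 0# → χ (y ^ n) ≡ χ (y ^ (n % 4))
    χ-^-mod-4 {y} n y≢0 = trans (χ-^ y n) (trans (^-mod-4 n (χ^4 y≢0)) (sym (χ-^ y (n % 4))))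

    -- An odd exponent is its own inverse modulo 4. Raising the character value to the power e₀
    -- therefore makes the chosen factor simple, and the other exponents are reduced modulo 4.
    count-odd : ∀ t → Any (λ ce → proj₂ ce % 2 ≡ 1) t → Distinct t → length t ≤ m₀ →
      ∀ z Z → Unique Z → (∀ {x} → x ∈ Z → NonRoot t x × χ (value t x) ≡ z) → length Z ℕ.* (2 ℕ.* M) ≤ Y
    count-odd t a = count 4 P p≡ A₄ (2 ℕ.* M) A₄≢0 _ P≢0 A₄+J≤P unknowns₄ 2M≤p t a e₀ (λ n → (e₀ ℕ.* n) % 4)
      (λ n → ℕ.≤-pred (m%n<n (e₀ ℕ.* n) 4))
      (λ {y} y≢0 → trans (cong χ (trans (sym (*-identityʳ y)) (cong (y ^_) (sym (odd-square e₀ (chosen-Q t a))))))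
        (trans (sym (χ-^-mod-4 (e₀ ℕ.* e₀) y≢0)) (trans (cong χ (sym (^-assocʳ y e₀ e₀))) (χ-^ (y ^ e₀) e₀))))
      (All.tabulate (λ {ce} _ {y} y≢0 → trans (sym (χ-^-mod-4 (e₀ ℕ.* proj₂ ce) y≢0))
        (trans (cong χ (trans (cong (y ^_) (ℕ.*-comm e₀ (proj₂ ce))) (sym (^-assocʳ y (proj₂ ce) e₀)))) (χ-^ (y ^ proj₂ ce) e₀))))
      where
      e₀ = proj₂ (chosen t a)
      odd-square : ∀ e → e % 2 ≡ 1 → (e ℕ.* e) % 4 ≡ 1
      odd-square e odd = begin
        (e ℕ.* e) % 4            ≡⟨ cong (λ u → (u ℕ.* u) % 4) (trans (m≡m%n+[m/n]*n e 2) (cong (ℕ._+ e / 2 ℕ.* 2) odd)) ⟩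
        ((1 ℕ.+ h ℕ.* 2) ℕ.* (1 ℕ.+ h ℕ.* 2)) % 4 ≡⟨ cong (_% 4) (solve 1 (λ h → (con 1 :+ h :* con 2) :* (con 1 :+ h :* con 2) := con 1 :+ (h :+ h :* h) :* con 4) refl h) ⟩
        (1 ℕ.+ (h ℕ.+ h ℕ.* h) ℕ.* 4) % 4 ≡⟨ [m+kn]%n≡m%n 1 (h ℕ.+ h ℕ.* h) 4 ⟩
        1                        ∎
        where
        open ≡-Reasoning
        open +-*-Solver
        h = e / 2

    -- With all exponents even the character is quadratic: P is replaced by 2P and the exponents
    -- modulo 4 are halved, which turns the chosen exponent into 1.
    count-even : ∀ t → Any (λ ce → proj₂ ce % 4 ≡ 2) t → All (λ ce → proj₂ ce % 2 ≡ 0) t → Distinct t → length t ≤ m₀ →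
      ∀ z Z → Unique Z → (∀ {x} → x ∈ Z → NonRoot t x × χ (value t x) ≡ z) → length Z ℕ.* M ≤ Y
    count-even t a ev = count 2 (2 ℕ.* P) (trans p≡ (cong suc (ℕ.*-assoc 2 2 P))) A₂ M A₂≢0 _ (ℕ.m*n≢0 2 P {{_}} {{P≢0}}) A₂+J≤2P unknowns₂
      (ℕ.≤-trans (ℕ.m≤m+n M _) 2M≤p) t a 1 (λ n → (n % 4) / 2) (λ n → half≤3 (n % 4) (m%n<n n 4))
      (λ {y} y≢0 → trans (sym (^-assocʳ y 2 P)) (trans (cong (λ n → χ (y ^ n)) (sym (chosen-Q t a))) (trans (sym (χ-^-mod-4 (proj₂ (chosen t a)) y≢0)) (sym (*-identityʳ _)))))
      (All.map (λ {ce} q {y} y≢0 → trans (sym (^-assocʳ (y ^ (proj₂ ce % 4 / 2)) 2 P))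
         (trans (cong χ (trans (^-assocʳ y (proj₂ ce % 4 / 2) 2) (cong (y ^_) (halve (proj₂ ce) q))))
           (trans (sym (χ-^-mod-4 (proj₂ ce) y≢0)) (sym (*-identityʳ _))))) ev)
      where
      half≤3 : ∀ r → r < 4 → r / 2 ≤ 3
      half≤3 0 _ = z≤n
      half≤3 1 _ = z≤n
      half≤3 2 _ = s≤s z≤n
      half≤3 3 _ = s≤s z≤n
      half≤3 (suc (suc (suc (suc r)))) (s≤s (s≤s (s≤s (s≤s ()))))
      halve : ∀ e → e % 2 ≡ 0 → (e % 4) / 2 ℕ.* 2 ≡ e % 4
      halve e q = go (e % 4) (m%n<n e 4) (trans (mod-4-mod-2 e) q)
        where
        go : ∀ r → r < 4 → r % 2 ≡ 0 → r / 2 ℕ.* 2 ≡ r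
        go 0 _ _ = refl
        go 2 _ _ = refl
        go (suc (suc (suc (suc r)))) (s≤s (s≤s (s≤s (s≤s ())))) _

  OddBound EvenBound : (M Y m₀ : ℕ) → Set
  OddBound M Y m₀ = ∀ t → Any (λ ce → proj₂ ce % 2 ≡ 1) t → Distinct t → length t ≤ m₀ →
    ∀ z Z → Unique Z → (∀ {x} → x ∈ Z → NonRoot t x × χ (value t x) ≡ z) → length Z ℕ.* (2 ℕ.* M) ≤ Y
  EvenBound M Y m₀ = ∀ t → Any (λ ce → proj₂ ce % 4 ≡ 2) t → All (λ ce → proj₂ ce % 2 ≡ 0) t → Distinct t → length t ≤ m₀ →
    ∀ z Z → Unique Z → (∀ {x} → x ∈ Z → NonRoot t x × χ (value t x) ≡ z) → length Z ℕ.* M ≤ Y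

-- A condition τ · χ(∏ (x + cⱼ)^eⱼ) ≡ 1 on x; its values are roots of unity of the given order, 2 or 4.
record Condition (F : Set) (m : ℕ) : Set where
  constructor condition
  field
    order : ℕ
    pivot : Fin m
    τ     : F
    exps  : Vec ℕ m

open Condition

-- Multiplied by any positive k below the order, the pivot exponent stays nonzero modulo 4, so no
-- proper power of the condition is the trivial character.
Valid : ∀ {F m} → Condition F m → Set
Valid c = (order c ≡ 4 × lookup (exps c) (pivot c) % 2 ≡ 1) ⊎
          (order c ≡ 2 × lookup (exps c) (pivot c) % 4 ≡ 2 × (∀ j → lookup (exps c) j % 2 ≡ 0))

-- Each pivot is absent from all later conditions, which makes the conditions independent.
Triangular : ∀ {F m} → List (Condition F m) → Set
Triangular []       = ⊤
Triangular (c ∷ cs) = Valid c × All (λ d → lookup (exps d) (pivot c) % 4 ≡ 0) cs × Triangular cs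

triangular? : ∀ {F m} (cs : List (Condition F m)) → Dec (Triangular cs)
triangular? []       = yes tt
triangular? (c ∷ cs) =
  ((order c ℕ.≟ 4 ×-dec lookup (exps c) (pivot c) % 2 ℕ.≟ 1) ⊎-dec
   (order c ℕ.≟ 2 ×-dec (lookup (exps c) (pivot c) % 4 ℕ.≟ 2 ×-dec Fin.all? (λ j → lookup (exps c) j % 2 ℕ.≟ 0))))
  ×-dec (All.all? (λ d → lookup (exps d) (pivot c) % 4 ℕ.≟ 0) cs ×-dec triangular? cs)

residues : ∀ {k} → suc k < 4 → ∀ {r} → r < 4 → r % 2 ≡ 1 → (suc k ℕ.* r) % 4 ≢ 0
residues = λ k<4 → table (ℕ.≤-pred k<4)
  where
  table : ∀ {k} → k < 3 → ∀ {r} → r < 4 → r % 2 ≡ 1 → (suc k ℕ.* r) % 4 ≢ 0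
  table = from-yes (ℕ.allUpTo? (λ k → ℕ.allUpTo? (λ r → r % 2 ℕ.≟ 1 →-dec ¬? ((suc k ℕ.* r) % 4 ℕ.≟ 0)) 4) 3)

-- The number of products of powers of the conditions, hence the number of character sums involved.
index : ∀ {F m} → List (Condition F m) → ℕ
index []       = 1
index (c ∷ cs) = order c ℕ.* index cs

-- Solvability of triangular systems of character conditions

module Existence {p : ℕ} (K : PrimeField p) (P : ℕ) (p≡ : p ≡ suc (4 ℕ.* P))
  (ι : Fin p) (ι² : PrimeField._*_ K ι ι ≡ PrimeField.-_ K (PrimeField.1# K))
  (M Y m₀ : ℕ) (odd-bound : QuarticCharacter.OddBound K P p≡ M Y m₀) (even-bound : QuarticCharacter.EvenBound K P p≡ M Y m₀) where
  open FieldFacts K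
  open LinearFactors K
  open QuarticCharacter K P p≡

  pair : ∀ {m} → Vec F m → Vec ℕ m → Factors
  pair []       []       = []
  pair (c ∷ cs) (e ∷ es) = (c , e) ∷ pair cs es

  length-pair : ∀ {m} (cs : Vec F m) es → length (pair cs es) ≡ m
  length-pair []       []       = refl
  length-pair (c ∷ cs) (e ∷ es) = cong suc (length-pair cs es)

  pair-distinct : ∀ {m} (cs : Vec F m) es → Unique (Vec.toList cs) → Distinct (pair cs es)
  pair-distinct []       []       []      = []
  pair-distinct (c ∷ cs) (e ∷ es) (d ∷ u) = go cs es d ∷ pair-distinct cs es u
    where
    go : ∀ {m} (cs : Vec F m) es → All (c ≢_) (Vec.toList cs) → All (λ v → c ≢ proj₁ v) (pair cs es)
    go []       []       []       = []
    go (_ ∷ cs) (_ ∷ es) (q ∷ qs) = q ∷ go cs es qs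

  pair-Any : ∀ {m} {Q : ℕ → Set} (cs : Vec F m) es j → Q (lookup es j) → Any (λ ce → Q (proj₂ ce)) (pair cs es)
  pair-Any (c ∷ cs) (e ∷ es) zero    q = here q
  pair-Any (c ∷ cs) (e ∷ es) (suc j) q = there (pair-Any cs es j q)

  pair-lookup : ∀ {m} {Q : ℕ → Set} (cs : Vec F m) es j → All (λ ce → Q (proj₂ ce)) (pair cs es) → Q (lookup es j)
  pair-lookup (c ∷ cs) (e ∷ es) zero    (q ∷ qs) = q
  pair-lookup (c ∷ cs) (e ∷ es) (suc j) (q ∷ qs) = pair-lookup cs es j qs

  pair-tabulate : ∀ {m} {Q : ℕ → Set} (cs : Vec F m) es → (∀ j → Q (lookup es j)) → All (λ ce → Q (proj₂ ce)) (pair cs es)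
  pair-tabulate []       []       q = []
  pair-tabulate (c ∷ cs) (e ∷ es) q = q zero ∷ pair-tabulate cs es (q ∘ suc)

  addMul : ∀ {m} → ℕ → Vec ℕ m → Vec ℕ m → Vec ℕ m
  addMul k = Vec.zipWith (λ a b → a ℕ.+ k ℕ.* b)

  value-addMul : ∀ {m} (cs : Vec F m) k es fs x → value (pair cs (addMul k es fs)) x ≡ value (pair cs es) x * value (pair cs fs) x ^ k
  value-addMul []       k []       []       x = sym (trans (*-identityˡ _) (1^ k))
  value-addMul (c ∷ cs) k (e ∷ es) (f ∷ fs) x = begin
    y ^ (e ℕ.+ k ℕ.* f) * value (pair cs (addMul k es fs)) x
      ≡⟨ cong₂ _*_ (trans (^-homo-* y e (k ℕ.* f)) (cong (y ^ e *_) (trans (cong (y ^_) (ℕ.*-comm k f)) (sym (^-assocʳ y f k))))) (value-addMul cs k es fs x) ⟩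
    y ^ e * (y ^ f) ^ k * (u * v ^ k)
      ≡⟨ S.solve 4 (λ a b c d → a S.:* b S.:* (c S.:* d) S.:= a S.:* c S.:* (b S.:* d)) refl (y ^ e) ((y ^ f) ^ k) u (v ^ k) ⟩
    y ^ e * u * ((y ^ f) ^ k * v ^ k)
      ≡⟨ cong (y ^ e * u *_) (^-distrib-* (y ^ f) v k) ⟨
    y ^ e * u * (y ^ f * v) ^ k ∎
    where
    open ≡-Reasoning
    y = x + c
    u = value (pair cs es) x
    v = value (pair cs fs) x

  value-zero : ∀ {m} (cs : Vec F m) x → value (pair cs (Vec.replicate m 0)) x ≡ 1#
  value-zero []       x = refl
  value-zero (c ∷ cs) x = trans (*-identityˡ _) (value-zero cs x)

  nonRoots : ∀ {m} → Vec F m → List F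
  nonRoots []       = allFin p
  nonRoots (c ∷ cs) = filter (λ x → ¬? (x + c Fin.≟ 0#)) (nonRoots cs)

  nonRoots-unique : ∀ {m} (cs : Vec F m) → Unique (nonRoots cs)
  nonRoots-unique []       = Unique.allFin⁺ p
  nonRoots-unique (c ∷ cs) = Unique.filter⁺ (λ x → ¬? (x + c Fin.≟ 0#)) (nonRoots-unique cs)

  nonRoots-length : ∀ {m} (cs : Vec F m) → p ≤ m ℕ.+ length (nonRoots cs)
  nonRoots-length []       = ℕ.≤-reflexive (sym (List.length-tabulate {n = p} id))
  nonRoots-length {suc m} (c ∷ cs) = ℕ.≤-trans (nonRoots-length cs) (ℕ.≤-trans
    (ℕ.+-monoʳ-≤ m (filter-but-one (λ x → ¬? (x + c Fin.≟ 0#)) unique-root (nonRoots-unique cs)))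
    (ℕ.≤-reflexive (ℕ.+-suc m _)))
    where
    root : ∀ {x} → ¬ ¬ (x + c ≡ 0#) → x + c ≡ 0#
    root {x} ¬¬q with x + c Fin.≟ 0#
    ... | yes q = q
    ... | no ¬q = ⊥-elim (¬¬q ¬q)
    unique-root : ∀ {x y} → ¬ (x + c ≢ 0#) → ¬ (y + c ≢ 0#) → x ≡ y
    unique-root {x} {y} q r = +-cancelʳ c x y (trans (root q) (sym (root r)))

  nonRoots-lookup : ∀ {m} (cs : Vec F m) {x} → x ∈ nonRoots cs → ∀ j → x + lookup cs j ≢ 0#
  nonRoots-lookup (c ∷ cs) {x} x∈ zero    = proj₂ (∈-filter⁻ (λ x → ¬? (x + c Fin.≟ 0#)) {v = x} {xs = nonRoots cs} x∈)
  nonRoots-lookup (c ∷ cs) {x} x∈ (suc j) = nonRoots-lookup cs (proj₁ (∈-filter⁻ (λ x → ¬? (x + c Fin.≟ 0#)) {v = x} {xs = nonRoots cs} x∈)) j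

  pair-nonRoot : ∀ {m} (cs : Vec F m) es {x} → (∀ j → x + lookup cs j ≢ 0#) → NonRoot (pair cs es) x
  pair-nonRoot []       []       q = []
  pair-nonRoot (c ∷ cs) (e ∷ es) q = q zero ∷ pair-nonRoot cs es (q ∘ suc)

  -- Orthogonality of characters without complex numbers: only the terms equal to 1 are counted, and unless all
  -- the given roots of unity are 1 these are as many as the terms equal to -1.
  spread : List (ℕ × F) → F → ℕ
  spread []             w = indicator (w Fin.≟ 1#)
  spread ((o , y) ∷ ys) w = sumTo o (λ k → spread ys (w * y ^ k))

  RootOfUnity : ℕ × F → Set
  RootOfUnity (o , y) = (o ≡ 2 ⊎ o ≡ 4) × y ^ o ≡ 1#

  -- Among the powers of a root of unity y ≠ 1 of order dividing 4 there is -1. Shifting k by the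
  -- corresponding exponent permutes the terms and turns w into -w. A root y = 1 hands the claim on
  -- to the rest of the list.
  spread-balanced : ∀ ys → All RootOfUnity ys → ¬ All (λ oy → proj₂ oy ≡ 1#) ys → ∀ w → spread ys w ≡ spread ys (- w)
  spread-balanced []             []       ¬all w = ⊥-elim (¬all [])
  spread-balanced ((o , y) ∷ ys) ((o≡ , y^o) ∷ rs) ¬all w with y Fin.≟ 1#
  ... | yes refl = sumTo-cong o (λ k → trans (spread-balanced ys rs (λ all → ¬all (refl ∷ all)) (w * 1# ^ k))
                     (cong (spread ys) (-‿distribˡ-* w (1# ^ k))))
  ... | no y≢1 = go o o≡ y^o
    where
    open ≡-Reasoning
    f = λ u → spread ys u
    flip : ∀ {a b} → a ≡ - 1# * b → w * a ≡ - w * b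
    flip {a} {b} e = trans (cong (w *_) (trans e (-1* b))) (trans (sym (-‿distribʳ-* w b)) (-‿distribˡ-* w b))
    unflip : ∀ {a b} → a ≡ - 1# * b → - w * a ≡ w * b
    unflip {a} {b} e = trans (cong (- w *_) (trans e (-1* b))) (trans (sym (-‿distribʳ-* (- w) b)) (trans (cong -_ (sym (-‿distribˡ-* w b))) (-‿involutive _)))
    order₂ : y ≡ - 1# → f (w * y ^ 1) ℕ.+ (f (w * y ^ 0) ℕ.+ 0) ≡ f (- w * y ^ 1) ℕ.+ (f (- w * y ^ 0) ℕ.+ 0)
    order₂ y≡-1 = begin
      f (w * y ^ 1) ℕ.+ (f (w * 1#) ℕ.+ 0)       ≡⟨ cong₂ (λ u v → f u ℕ.+ (f v ℕ.+ 0)) (flip q) (sym (unflip q)) ⟩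
      f (- w * 1#) ℕ.+ (f (- w * y ^ 1) ℕ.+ 0)   ≡⟨ +-*-Solver.solve 2 (λ a b → a :+ (b :+ con 0) := b :+ (a :+ con 0)) refl (f (- w * 1#)) (f (- w * y ^ 1)) ⟩
      f (- w * y ^ 1) ℕ.+ (f (- w * 1#) ℕ.+ 0)   ∎
      where
      open +-*-Solver using (_:+_; _:=_; con)
      q : y ^ 1 ≡ - 1# * 1#
      q = cong (_* 1#) y≡-1
    Balanced₄ : Set
    Balanced₄ = f (w * y ^ 3) ℕ.+ (f (w * y ^ 2) ℕ.+ (f (w * y ^ 1) ℕ.+ (f (w * y ^ 0) ℕ.+ 0))) ≡
                f (- w * y ^ 3) ℕ.+ (f (- w * y ^ 2) ℕ.+ (f (- w * y ^ 1) ℕ.+ (f (- w * y ^ 0) ℕ.+ 0)))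
    primitive₄ : y ^ 2 ≡ - 1# → Balanced₄
    primitive₄ y²≡-1 = begin
      f (w * y ^ 3) ℕ.+ (f (w * y ^ 2) ℕ.+ (f (w * y ^ 1) ℕ.+ (f (w * y ^ 0) ℕ.+ 0)))
        ≡⟨ cong₂ (λ u v → u ℕ.+ v) (cong f (flip q₃)) (cong₂ ℕ._+_ (cong f (flip q₂)) (cong₂ (λ u v → f u ℕ.+ (f v ℕ.+ 0)) (sym (unflip q₃)) (sym (unflip q₂)))) ⟩
      f (- w * y ^ 1) ℕ.+ (f (- w * y ^ 0) ℕ.+ (f (- w * y ^ 3) ℕ.+ (f (- w * y ^ 2) ℕ.+ 0)))
        ≡⟨ +-*-Solver.solve 4 (λ a b c d → a :+ (b :+ (c :+ (d :+ con 0))) := c :+ (d :+ (a :+ (b :+ con 0)))) refl (f (- w * y ^ 1)) (f (- w * y ^ 0)) (f (- w * y ^ 3)) (f (- w * y ^ 2)) ⟩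
      f (- w * y ^ 3) ℕ.+ (f (- w * y ^ 2) ℕ.+ (f (- w * y ^ 1) ℕ.+ (f (- w * y ^ 0) ℕ.+ 0))) ∎
      where
      open +-*-Solver using (_:+_; _:=_; con)
      q₂ : y ^ 2 ≡ - 1# * y ^ 0
      q₂ = trans y²≡-1 (sym (*-identityʳ _))
      q₃ : y ^ 3 ≡ - 1# * y ^ 1
      q₃ = trans (^-homo-* y 2 1) (cong (_* y ^ 1) y²≡-1)
    quadratic₄ : y ≡ - 1# → Balanced₄
    quadratic₄ y≡-1 = begin
      f (w * y ^ 3) ℕ.+ (f (w * y ^ 2) ℕ.+ (f (w * y ^ 1) ℕ.+ (f (w * y ^ 0) ℕ.+ 0)))
        ≡⟨ cong₂ (λ u v → u ℕ.+ v) (cong f (flip (step 2))) (cong₂ ℕ._+_ (cong f (sym (unflip (step 2)))) (cong₂ (λ u v → f u ℕ.+ (f v ℕ.+ 0)) (flip (step 0)) (sym (unflip (step 0))))) ⟩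
      f (- w * y ^ 2) ℕ.+ (f (- w * y ^ 3) ℕ.+ (f (- w * y ^ 0) ℕ.+ (f (- w * y ^ 1) ℕ.+ 0)))
        ≡⟨ +-*-Solver.solve 4 (λ a b c d → a :+ (b :+ (c :+ (d :+ con 0))) := b :+ (a :+ (d :+ (c :+ con 0)))) refl (f (- w * y ^ 2)) (f (- w * y ^ 3)) (f (- w * y ^ 0)) (f (- w * y ^ 1)) ⟩
      f (- w * y ^ 3) ℕ.+ (f (- w * y ^ 2) ℕ.+ (f (- w * y ^ 1) ℕ.+ (f (- w * y ^ 0) ℕ.+ 0))) ∎
      where
      open +-*-Solver using (_:+_; _:=_; con)
      step : ∀ k → y ^ suc k ≡ - 1# * y ^ k
      step k = cong (_* y ^ k) y≡-1
    go : ∀ o → (o ≡ 2 ⊎ o ≡ 4) → y ^ o ≡ 1# → sumTo o (λ k → f (w * y ^ k)) ≡ sumTo o (λ k → f (- w * y ^ k))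
    go _ (inj₁ refl) e = [ (λ y≡1 → ⊥-elim (y≢1 y≡1)) , order₂ ]′ (square-one e)
    go _ (inj₂ refl) e = [ (λ y²≡1 → [ (λ y≡1 → ⊥-elim (y≢1 y≡1)) , quadratic₄ ]′ (square-one y²≡1)) , primitive₄ ]′
      (square-one {y ^ 2} (trans (^-assocʳ y 2 2) e))

  module Points {m : ℕ} (cs : Vec F m) (distinct : Unique (Vec.toList cs)) (m≤m₀ : m ≤ m₀) where
    Mon : Set
    Mon = F × Vec ℕ m

    ⟦_⟧ : Mon → F → F
    ⟦ τ , es ⟧ x = τ * χ (value (pair cs es) x)

    monomial : Condition F m → Mon
    monomial c = τ c , exps c

    _⊙_^_ : Mon → Condition F m → ℕ → Mon
    (σ , es) ⊙ c ^ k = σ * τ c ^ k , addMul k es (exps c)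

    neg : Mon → Mon
    neg (σ , es) = - σ , es

    ⟦⊙⟧ : ∀ mon c k x → ⟦ mon ⊙ c ^ k ⟧ x ≡ ⟦ mon ⟧ x * ⟦ monomial c ⟧ x ^ k
    ⟦⊙⟧ (σ , es) c k x = begin
      σ * t ^ k * χ (value (pair cs (addMul k es (exps c))) x)  ≡⟨ cong (λ u → σ * t ^ k * χ u) (value-addMul cs k es (exps c) x) ⟩
      σ * t ^ k * χ (u * v ^ k)                                 ≡⟨ cong (σ * t ^ k *_) (trans (χ-* u (v ^ k)) (cong (χ u *_) (χ-^ v k))) ⟩
      σ * t ^ k * (χ u * χ v ^ k)                               ≡⟨ S.solve 4 (λ a b c d → a S.:* b S.:* (c S.:* d) S.:= a S.:* c S.:* (b S.:* d)) refl σ (t ^ k) (χ u) (χ v ^ k) ⟩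
      σ * χ u * (t ^ k * χ v ^ k)                               ≡⟨ cong (σ * χ u *_) (^-distrib-* t (χ v) k) ⟨
      σ * χ u * (t * χ v) ^ k                                   ∎
      where
      open ≡-Reasoning
      t = τ c
      u = value (pair cs es) x
      v = value (pair cs (exps c)) x

    ⟦neg⟧ : ∀ mon x → ⟦ neg mon ⟧ x ≡ - ⟦ mon ⟧ x
    ⟦neg⟧ (σ , es) x = sym (-‿distribˡ-* σ _)

    neg-⊙ : ∀ mon c k → neg (mon ⊙ c ^ k) ≡ neg mon ⊙ c ^ k
    neg-⊙ (σ , es) c k = cong (_, addMul k es (exps c)) (-‿distribˡ-* σ _)

    xs : List F
    xs = nonRoots cs

    N : Mon → ℕ
    N mon = Σ[ xs ] (λ x → indicator (⟦ mon ⟧ x Fin.≟ 1#))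

    -- Read as a sum over characters it is estimated through `nontrivial`; read as a sum over
    -- points, by `T-spread`, it is subject to orthogonality.
    T : List (Condition F m) → Mon → ℕ
    T []       mon = N mon
    T (c ∷ cs) mon = sumTo (order c) (λ k → T cs (mon ⊙ c ^ k))

    values : List (Condition F m) → F → List (ℕ × F)
    values con x = map (λ c → order c , ⟦ monomial c ⟧ x) con

    T-spread : ∀ con mon → T con mon ≡ Σ[ xs ] (λ x → spread (values con x) (⟦ mon ⟧ x))
    T-spread []        mon = refl
    T-spread (c ∷ con) mon = trans (sumTo-cong (order c) (λ k → trans (T-spread con (mon ⊙ c ^ k))
        (Σ-cong xs (λ {x} _ → cong (spread (values con x)) (⟦⊙⟧ mon c k x)))))
      (sym (Σ-sumTo xs (order c) (λ k x → spread (values con x) (⟦ mon ⟧ x * ⟦ monomial c ⟧ x ^ k))))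

    count : Mon → F → ℕ
    count mon z = length (filter (λ x → ⟦ mon ⟧ x Fin.≟ z) xs)

    N≡count : ∀ mon → N mon ≡ count mon 1#
    N≡count mon = Σ-indicator xs (λ x → ⟦ mon ⟧ x Fin.≟ 1#)

    N-neg : ∀ mon → N (neg mon) ≡ count mon (- 1#)
    N-neg mon = trans (Σ-cong xs (λ {x} _ → indicator-cong (⟦ neg mon ⟧ x Fin.≟ 1#) (⟦ mon ⟧ x Fin.≟ - 1#)
        (λ e → -x≡1⇒x≡-1 (trans (sym (⟦neg⟧ mon x)) e))
        (λ e → trans (⟦neg⟧ mon x) (trans (cong -_ e) (-‿involutive 1#)))))
      (Σ-indicator xs (λ x → ⟦ mon ⟧ x Fin.≟ - 1#))

    n : ℕ
    n = length xs

    n-count : n ≤ Σ[ xs ] (λ x → 1)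
    n-count = ℕ.≤-reflexive (sym (trans (Σ-const xs 1) (ℕ.*-identityʳ n)))

    χ-value^4 : ∀ es {x} → x ∈ xs → χ (value (pair cs es) x) ^ 4 ≡ 1#
    χ-value^4 es {x} x∈ = χ^4 (value≢0 (pair cs es) x (pair-nonRoot cs es (nonRoots-lookup cs x∈)))

    ⟦⟧^4 : ∀ {mon x} → proj₁ mon ^ 4 ≡ 1# → x ∈ xs → ⟦ mon ⟧ x ^ 4 ≡ 1#
    ⟦⟧^4 {σ , es} {x} σ^4 x∈ = trans (^-distrib-* σ _ 4) (trans (cong₂ _*_ σ^4 (χ-value^4 es x∈)) (*-identityˡ 1#))

    partition : ∀ mon → proj₁ mon ^ 4 ≡ 1# → n ≤ count mon 1# ℕ.+ count mon (- 1#) ℕ.+ (count mon ι ℕ.+ count mon (- ι))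
    partition mon σ^4 = begin
      n                                            ≤⟨ n-count ⟩
      Σ[ xs ] (λ _ → 1)                            ≤⟨ Σ-mono xs one ⟩
      Σ[ xs ] (λ x → i 1# x ℕ.+ i (- 1#) x ℕ.+ (i ι x ℕ.+ i (- ι) x))
        ≡⟨ trans (Σ-+ xs _ _) (cong₂ ℕ._+_ (Σ-+ xs (i 1#) (i (- 1#))) (Σ-+ xs (i ι) (i (- ι)))) ⟩
      Σ[ xs ] (i 1#) ℕ.+ Σ[ xs ] (i (- 1#)) ℕ.+ (Σ[ xs ] (i ι) ℕ.+ Σ[ xs ] (i (- ι)))
        ≡⟨ cong₂ ℕ._+_ (cong₂ ℕ._+_ (s 1#) (s (- 1#))) (cong₂ ℕ._+_ (s ι) (s (- ι))) ⟩
      count mon 1# ℕ.+ count mon (- 1#) ℕ.+ (count mon ι ℕ.+ count mon (- ι)) ∎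
      where
      open ℕ.≤-Reasoning
      i : F → F → ℕ
      i z x = indicator (⟦ mon ⟧ x Fin.≟ z)
      s : ∀ z → Σ[ xs ] (i z) ≡ count mon z
      s z = Σ-indicator xs (λ x → ⟦ mon ⟧ x Fin.≟ z)
      hit : ∀ {x z} → ⟦ mon ⟧ x ≡ z → 1 ≤ i z x
      hit {x} {z} e with ⟦ mon ⟧ x Fin.≟ z
      ... | yes _ = ℕ.≤-refl
      ... | no ¬e = ⊥-elim (¬e e)
      one : ∀ {x} → x ∈ xs → 1 ≤ i 1# x ℕ.+ i (- 1#) x ℕ.+ (i ι x ℕ.+ i (- ι) x)
      one {x} x∈ =
        [ (λ e → ℕ.≤-trans (hit e) (ℕ.≤-trans (ℕ.m≤m+n (i 1# x) (i (- 1#) x)) (ℕ.m≤m+n (i 1# x ℕ.+ i (- 1#) x) _))) ,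
        [ (λ e → ℕ.≤-trans (hit e) (ℕ.≤-trans (ℕ.m≤n+m (i (- 1#) x) (i 1# x)) (ℕ.m≤m+n (i 1# x ℕ.+ i (- 1#) x) _))) ,
        [ (λ e → ℕ.≤-trans (hit e) (ℕ.≤-trans (ℕ.m≤m+n (i ι x) (i (- ι) x)) (ℕ.m≤n+m _ (i 1# x ℕ.+ i (- 1#) x)))) ,
          (λ e → ℕ.≤-trans (hit e) (ℕ.≤-trans (ℕ.m≤n+m (i (- ι) x) (i ι x)) (ℕ.m≤n+m _ (i 1# x ℕ.+ i (- 1#) x)))) ]′ ]′ ]′
        (fourth-roots ι² (⟦⟧^4 {mon} σ^4 x∈))

    private
      inv : ∀ {σ v z} → σ ^ 4 ≡ 1# → σ * v ≡ z → v ≡ σ ^ 3 * z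
      inv {σ} {v} {z} σ^4 e = begin
        v                  ≡⟨ *-identityˡ v ⟨
        1# * v             ≡⟨ cong (_* v) σ^4 ⟨
        σ ^ 4 * v          ≡⟨ S.solve 2 (λ s v → s S.:^ 4 S.:* v S.:= s S.:^ 3 S.:* (s S.:* v)) refl σ v ⟩
        σ ^ 3 * (σ * v)    ≡⟨ cong (σ ^ 3 *_) e ⟩
        σ ^ 3 * z          ∎
        where open ≡-Reasoning

      set : Mon → F → List F
      set mon z = filter (λ x → ⟦ mon ⟧ x Fin.≟ z) xs

      set-unique : ∀ mon z → Unique (set mon z)
      set-unique mon z = Unique.filter⁺ (λ x → ⟦ mon ⟧ x Fin.≟ z) (nonRoots-unique cs)

      set-good : ∀ mon z → proj₁ mon ^ 4 ≡ 1# → ∀ {x} → x ∈ set mon z →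
        NonRoot (pair cs (proj₂ mon)) x × χ (value (pair cs (proj₂ mon)) x) ≡ proj₁ mon ^ 3 * z
      set-good mon@(σ , es) z σ^4 {x} x∈ with ∈-filter⁻ (λ x → ⟦ mon ⟧ x Fin.≟ z) {v = x} {xs = xs} x∈
      ... | x∈xs , e = pair-nonRoot cs es (nonRoots-lookup cs x∈xs) , inv σ^4 e

      empty : ∀ mon z → (∀ {x} → x ∈ xs → ⟦ mon ⟧ x ≢ z) → count mon z ≡ 0
      empty mon z none = cong length (List.filter-none (λ x → ⟦ mon ⟧ x Fin.≟ z) (All.tabulate none))

      even-or-odd : ∀ e → e % 2 ≢ 1 → e % 2 ≡ 0
      even-or-odd e q with e % 2 | m%n<n e 2
      ... | 0 | _ = refl
      ... | 1 | _ = ⊥-elim (q refl)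
      ... | suc (suc _) | s≤s (s≤s ())

      two-mod-4 : ∀ e → e % 2 ≡ 0 → e % 4 ≢ 0 → e % 4 ≡ 2
      two-mod-4 e q r = go (e % 4) (m%n<n e 4) (trans (mod-4-mod-2 e) q) r
        where
        go : ∀ r → r < 4 → r % 2 ≡ 0 → r ≢ 0 → r ≡ 2
        go 0 _ _ r = ⊥-elim (r refl)
        go 2 _ _ _ = refl
        go (suc (suc (suc (suc r)))) (s≤s (s≤s (s≤s (s≤s ())))) _ _

      value-even^2 : ∀ es x → x ∈ xs → All (λ ce → proj₂ ce % 2 ≡ 0) (pair cs es) → χ (value (pair cs es) x) ^ 2 ≡ 1#
      value-even^2 es x x∈ ev = go (pair cs es) (pair-nonRoot cs es (nonRoots-lookup cs x∈)) ev
        where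
        go : ∀ t → NonRoot t x → All (λ ce → proj₂ ce % 2 ≡ 0) t → χ (value t x) ^ 2 ≡ 1#
        go [] _ _ = trans (cong (_^ 2) (1^ P)) (1^ 2)
        go ((c , e) ∷ t) (q ∷ qs) (r ∷ rs) = begin
          χ ((x + c) ^ e * value t x) ^ 2                  ≡⟨ trans (cong (_^ 2) (χ-* ((x + c) ^ e) (value t x))) (^-distrib-* (χ ((x + c) ^ e)) (χ (value t x)) 2) ⟩
          χ ((x + c) ^ e) ^ 2 * χ (value t x) ^ 2          ≡⟨ cong₂ _*_ sq (go t qs rs) ⟩
          1# * 1#                                          ≡⟨ *-identityˡ 1# ⟩
          1#                                               ∎
          where
          open ≡-Reasoning
          e≡ : e ℕ.* 2 ≡ 4 ℕ.* (e / 2)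
          e≡ = trans (cong (ℕ._* 2) (trans (m≡m%n+[m/n]*n e 2) (cong (ℕ._+ e / 2 ℕ.* 2) r))) (trans (ℕ.*-assoc (e / 2) 2 2) (ℕ.*-comm (e / 2) 4))
          sq : χ ((x + c) ^ e) ^ 2 ≡ 1#
          sq = begin
            χ ((x + c) ^ e) ^ 2             ≡⟨ trans (cong (_^ 2) (χ-^ (x + c) e)) (^-assocʳ (χ (x + c)) e 2) ⟩
            χ (x + c) ^ (e ℕ.* 2)           ≡⟨ cong (χ (x + c) ^_) e≡ ⟩
            χ (x + c) ^ (4 ℕ.* (e / 2))     ≡⟨ ^-assocʳ (χ (x + c)) 4 (e / 2) ⟨
            (χ (x + c) ^ 4) ^ (e / 2)       ≡⟨ trans (cong (_^ (e / 2)) (χ^4 q)) (1^ (e / 2)) ⟩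
            1#                              ∎

    -- Only upper bounds for the four value counts a, b, c, d are at hand, but n ≤ a + b + c + d
    -- turns them into a lower bound for a - b: n - a + b is at most 2b + c + d. When all exponents
    -- are even, only the values ±1 or only the values ±ι occur, depending on σ², and the quadratic
    -- bound is applied to those.
    nontrivial : ∀ mon → proj₁ mon ^ 4 ≡ 1# → ∀ j → lookup (proj₂ mon) j % 4 ≢ 0 →
      M ℕ.* n ℕ.+ M ℕ.* N (neg mon) ≤ M ℕ.* N mon ℕ.+ 2 ℕ.* Y
    nontrivial mon@(σ , es) σ^4 j ej≢0 = subst₂ (λ u v → M ℕ.* n ℕ.+ M ℕ.* v ≤ M ℕ.* u ℕ.+ 2 ℕ.* Y) (sym (N≡count mon)) (sym (N-neg mon)) main
      where
      open ℕ.≤-Reasoning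
      open +-*-Solver using (solve; _:+_; _:*_; _:=_; con)
      t = pair cs es
      len : length t ≤ m₀
      len = subst (_≤ m₀) (sym (length-pair cs es)) m≤m₀
      a b c d : ℕ
      a = count mon 1#
      b = count mon (- 1#)
      c = count mon ι
      d = count mon (- ι)
      n≤ : n ≤ a ℕ.+ b ℕ.+ (c ℕ.+ d)
      n≤ = partition mon σ^4
      main : M ℕ.* n ℕ.+ M ℕ.* b ≤ M ℕ.* a ℕ.+ 2 ℕ.* Y
      main with Any.any? (λ ce → proj₂ ce % 2 ℕ.≟ 1) t
      ... | yes odd = ℕ.*-cancelˡ-≤ 2 (begin
        2 ℕ.* (M ℕ.* n ℕ.+ M ℕ.* b)
          ≤⟨ ℕ.*-monoʳ-≤ 2 (ℕ.+-monoˡ-≤ (M ℕ.* b) (ℕ.*-monoʳ-≤ M n≤)) ⟩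
        2 ℕ.* (M ℕ.* (a ℕ.+ b ℕ.+ (c ℕ.+ d)) ℕ.+ M ℕ.* b)
          ≡⟨ solve 5 (λ M a b c d → con 2 :* (M :* (a :+ b :+ (c :+ d)) :+ M :* b) := con 2 :* (M :* a) :+ (b :* (con 2 :* M) :+ b :* (con 2 :* M) :+ (c :* (con 2 :* M) :+ d :* (con 2 :* M)))) refl M a b c d ⟩
        2 ℕ.* (M ℕ.* a) ℕ.+ (b ℕ.* (2 ℕ.* M) ℕ.+ b ℕ.* (2 ℕ.* M) ℕ.+ (c ℕ.* (2 ℕ.* M) ℕ.+ d ℕ.* (2 ℕ.* M)))
          ≤⟨ ℕ.+-monoʳ-≤ (2 ℕ.* (M ℕ.* a)) (ℕ.+-mono-≤ (ℕ.+-mono-≤ (B (- 1#)) (B (- 1#))) (ℕ.+-mono-≤ (B ι) (B (- ι)))) ⟩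
        2 ℕ.* (M ℕ.* a) ℕ.+ (Y ℕ.+ Y ℕ.+ (Y ℕ.+ Y))
          ≡⟨ solve 2 (λ u Y → con 2 :* u :+ (Y :+ Y :+ (Y :+ Y)) := con 2 :* (u :+ con 2 :* Y)) refl (M ℕ.* a) Y ⟩
        2 ℕ.* (M ℕ.* a ℕ.+ 2 ℕ.* Y) ∎)
        where
        B : ∀ z → count mon z ℕ.* (2 ℕ.* M) ≤ Y
        B z = odd-bound t odd (pair-distinct cs es distinct) len (σ ^ 3 * z) (set mon z) (set-unique mon z) (set-good mon z σ^4)
      ... | no ¬odd = even-case (square-one {σ ^ 2} (trans (^-assocʳ σ 2 2) σ^4))
        where
        ev : All (λ ce → proj₂ ce % 2 ≡ 0) t
        ev = All.map (λ {ce} → even-or-odd (proj₂ ce)) (All.¬Any⇒All¬ t ¬odd)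
        B : ∀ z → count mon z ℕ.* M ≤ Y
        B z = even-bound t (pair-Any {Q = λ e → e % 4 ≡ 2} cs es j (two-mod-4 (lookup es j) (pair-lookup {Q = λ e → e % 2 ≡ 0} cs es j ev) ej≢0)) ev
                (pair-distinct cs es distinct) len (σ ^ 3 * z) (set mon z) (set-unique mon z) (set-good mon z σ^4)
        square : ∀ {x} → x ∈ xs → ⟦ mon ⟧ x ^ 2 ≡ σ ^ 2
        square {x} x∈ = trans (^-distrib-* σ _ 2) (trans (cong (σ ^ 2 *_) (value-even^2 es x x∈ ev)) (*-identityʳ _))
        sq² : ∀ {z w} → z * z ≡ w → z ^ 2 ≡ w
        sq² {z} e = trans (cong (z *_) (*-identityʳ z)) e
        ι²′ : - ι * - ι ≡ - 1#
        ι²′ = trans (sym (-‿distribˡ-* ι (- ι))) (trans (cong -_ (sym (-‿distribʳ-* ι ι))) (trans (-‿involutive _) ι²))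
        none : ∀ {z w v} → z * z ≡ w → σ ^ 2 ≡ v → w ≢ v → count mon z ≡ 0
        none {z} zz σσ w≢v = empty mon z (λ x∈ e → w≢v (trans (sym (sq² zz)) (trans (cong (_^ 2) (sym e)) (trans (square x∈) σσ))))
        even-case : σ ^ 2 ≡ 1# ⊎ σ ^ 2 ≡ - 1# → M ℕ.* n ℕ.+ M ℕ.* b ≤ M ℕ.* a ℕ.+ 2 ℕ.* Y
        even-case (inj₁ σ²≡1) = begin
          M ℕ.* n ℕ.+ M ℕ.* b                                ≤⟨ ℕ.+-monoˡ-≤ (M ℕ.* b) (ℕ.*-monoʳ-≤ M n≤) ⟩
          M ℕ.* (a ℕ.+ b ℕ.+ (c ℕ.+ d)) ℕ.+ M ℕ.* b          ≡⟨ cong₂ (λ u v → M ℕ.* (a ℕ.+ b ℕ.+ (u ℕ.+ v)) ℕ.+ M ℕ.* b)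
                                                                 (none ι² σ²≡1 (λ e → 1≢-1 (sym e))) (none ι²′ σ²≡1 (λ e → 1≢-1 (sym e))) ⟩
          M ℕ.* (a ℕ.+ b ℕ.+ 0) ℕ.+ M ℕ.* b                  ≡⟨ solve 3 (λ M a b → M :* (a :+ b :+ con 0) :+ M :* b := M :* a :+ (b :* M :+ b :* M)) refl M a b ⟩
          M ℕ.* a ℕ.+ (b ℕ.* M ℕ.+ b ℕ.* M)                  ≤⟨ ℕ.+-monoʳ-≤ (M ℕ.* a) (ℕ.+-mono-≤ (B (- 1#)) (B (- 1#))) ⟩
          M ℕ.* a ℕ.+ (Y ℕ.+ Y)                              ≡⟨ solve 2 (λ u Y → u :+ (Y :+ Y) := u :+ con 2 :* Y) refl (M ℕ.* a) Y ⟩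
          M ℕ.* a ℕ.+ 2 ℕ.* Y                                ∎
        even-case (inj₂ σ²≡-1) = begin
          M ℕ.* n ℕ.+ M ℕ.* b                                ≤⟨ ℕ.+-monoˡ-≤ (M ℕ.* b) (ℕ.*-monoʳ-≤ M n≤) ⟩
          M ℕ.* (a ℕ.+ b ℕ.+ (c ℕ.+ d)) ℕ.+ M ℕ.* b          ≡⟨ cong (λ u → M ℕ.* (a ℕ.+ u ℕ.+ (c ℕ.+ d)) ℕ.+ M ℕ.* u) (none -1*-1 σ²≡-1 1≢-1) ⟩
          M ℕ.* (a ℕ.+ 0 ℕ.+ (c ℕ.+ d)) ℕ.+ M ℕ.* 0          ≡⟨ solve 4 (λ M a c d → M :* (a :+ con 0 :+ (c :+ d)) :+ M :* con 0 := M :* a :+ (c :* M :+ d :* M)) refl M a c d ⟩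
          M ℕ.* a ℕ.+ (c ℕ.* M ℕ.+ d ℕ.* M)                  ≤⟨ ℕ.+-monoʳ-≤ (M ℕ.* a) (ℕ.+-mono-≤ (B ι) (B (- ι))) ⟩
          M ℕ.* a ℕ.+ (Y ℕ.+ Y)                              ≡⟨ solve 2 (λ u Y → u :+ (Y :+ Y) := u :+ con 2 :* Y) refl (M ℕ.* a) Y ⟩
          M ℕ.* a ℕ.+ 2 ℕ.* Y                                ∎

    Unit : Condition F m → Set
    Unit c = τ c ^ 4 ≡ 1#

    ⊙-unit : ∀ mon c k → proj₁ mon ^ 4 ≡ 1# → Unit c → proj₁ (mon ⊙ c ^ k) ^ 4 ≡ 1#
    ⊙-unit (σ , es) c k σ^4 c^4 = trans (^-distrib-* σ (τ c ^ k) 4) (trans (cong₂ _*_ σ^4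
      (trans (^-assocʳ (τ c) k 4) (trans (cong (τ c ^_) (ℕ.*-comm k 4)) (trans (sym (^-assocʳ (τ c) 4 k)) (trans (cong (_^ k) c^4) (1^ k)))))) (*-identityˡ 1#))

    lookup-⊙ : ∀ mon c k j → lookup (proj₂ (mon ⊙ c ^ k)) j ≡ lookup (proj₂ mon) j ℕ.+ k ℕ.* lookup (exps c) j
    lookup-⊙ (σ , es) c k j = Vec.lookup-zipWith (λ a b → a ℕ.+ k ℕ.* b) j es (exps c)

    -- No condition in the list affects the exponent at j modulo 4, so every product in the sum
    -- remains nontrivial.
    T-nontrivial : ∀ con → All Unit con → ∀ mon → proj₁ mon ^ 4 ≡ 1# → ∀ j → lookup (proj₂ mon) j % 4 ≢ 0 →
      All (λ c → lookup (exps c) j % 4 ≡ 0) con →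
      index con ℕ.* (M ℕ.* n) ℕ.+ M ℕ.* T con (neg mon) ≤ M ℕ.* T con mon ℕ.+ index con ℕ.* (2 ℕ.* Y)
    T-nontrivial [] [] mon σ^4 j ej≢0 [] = subst₂ (λ u v → u ℕ.+ M ℕ.* N (neg mon) ≤ M ℕ.* N mon ℕ.+ v)
      (sym (ℕ.*-identityˡ (M ℕ.* n))) (sym (ℕ.*-identityˡ (2 ℕ.* Y))) (nontrivial mon σ^4 j ej≢0)
    T-nontrivial (c ∷ con) (u ∷ us) mon σ^4 j ej≢0 (q ∷ qs) =
      subst₂ (λ a b → a ℕ.+ M ℕ.* T (c ∷ con) (neg mon) ≤ M ℕ.* T (c ∷ con) mon ℕ.+ b)
        (sym (ℕ.*-assoc (order c) (index con) (M ℕ.* n))) (sym (ℕ.*-assoc (order c) (index con) (2 ℕ.* Y)))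
        (sumTo-≤ (order c) (index con ℕ.* (M ℕ.* n)) (index con ℕ.* (2 ℕ.* Y)) M
          (λ k → T con (neg mon ⊙ c ^ k)) (λ k → T con (mon ⊙ c ^ k))
          (λ k _ → subst (λ v → index con ℕ.* (M ℕ.* n) ℕ.+ M ℕ.* T con v ≤ M ℕ.* T con (mon ⊙ c ^ k) ℕ.+ index con ℕ.* (2 ℕ.* Y))
            (neg-⊙ mon c k) (T-nontrivial con us (mon ⊙ c ^ k) (⊙-unit mon c k σ^4 u) j (λ e → ej≢0 (trans (sym (same k)) e)) qs)))
      where
      same : ∀ k → lookup (proj₂ (mon ⊙ c ^ k)) j % 4 ≡ lookup (proj₂ mon) j % 4
      same k = trans (cong (_% 4) (trans (lookup-⊙ mon c k j) (cong (λ e → lookup (proj₂ mon) j ℕ.+ k ℕ.* e)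
          (trans (m≡m%n+[m/n]*n (lookup (exps c) j) 4) (cong (ℕ._+ lookup (exps c) j / 4 ℕ.* 4) q)))))
        (trans (cong (λ e → (lookup (proj₂ mon) j ℕ.+ e) % 4) (sym (ℕ.*-assoc k (lookup (exps c) j / 4) 4)))
          ([m+kn]%n≡m%n (lookup (proj₂ mon) j) (k ℕ.* (lookup (exps c) j / 4)) 4))

    -- A positive power of the first condition brings in its pivot, which the later ones cannot
    -- remove, and `T-nontrivial` applies. Only the product with all exponents zero is trivial: it
    -- equals 1 at every point and never -1, so it saves the error 2Y once.
    T-trivial : ∀ con → All Unit con → Triangular con → ∀ mon → proj₁ mon ^ 4 ≡ 1# →
      (∀ {x} → x ∈ xs → ⟦ mon ⟧ x ≡ 1#) → (∀ j → lookup (proj₂ mon) j % 4 ≡ 0) →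
      index con ℕ.* (M ℕ.* n) ℕ.+ M ℕ.* T con (neg mon) ℕ.+ 2 ℕ.* Y ≤ M ℕ.* T con mon ℕ.+ index con ℕ.* (2 ℕ.* Y)
    T-trivial [] [] tt mon σ^4 one _ = ℕ.≤-reflexive (begin
      1 ℕ.* (M ℕ.* n) ℕ.+ M ℕ.* N (neg mon) ℕ.+ 2 ℕ.* Y   ≡⟨ cong₂ (λ u v → u ℕ.+ M ℕ.* v ℕ.+ 2 ℕ.* Y) (ℕ.*-identityˡ (M ℕ.* n)) (trans (N-neg mon) (empty mon (- 1#) (λ x∈ e → 1≢-1 (trans (sym (one x∈)) e)))) ⟩
      M ℕ.* n ℕ.+ M ℕ.* 0 ℕ.+ 2 ℕ.* Y                     ≡⟨ cong (ℕ._+ 2 ℕ.* Y) (trans (cong (M ℕ.* n ℕ.+_) (ℕ.*-zeroʳ M)) (ℕ.+-identityʳ _)) ⟩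
      M ℕ.* n ℕ.+ 2 ℕ.* Y                                 ≡⟨ cong₂ (λ u v → M ℕ.* u ℕ.+ v) full (ℕ.*-identityˡ (2 ℕ.* Y)) ⟨
      M ℕ.* N mon ℕ.+ 1 ℕ.* (2 ℕ.* Y)                     ∎)
      where
      open ≡-Reasoning
      full : N mon ≡ n
      full = trans (N≡count mon) (cong length (List.filter-all (λ x → ⟦ mon ⟧ x Fin.≟ 1#) (All.tabulate one)))
    T-trivial (c ∷ con) (u ∷ us) (valid , fresh , tri) mon@(σ , es) σ^4 one es%4 =
      subst₂ (λ a b → a ℕ.+ M ℕ.* T (c ∷ con) (neg mon) ℕ.+ 2 ℕ.* Y ≤ M ℕ.* T (c ∷ con) mon ℕ.+ b)
        (sym (ℕ.*-assoc (order c) (index con) (M ℕ.* n))) (sym (ℕ.*-assoc (order c) (index con) (2 ℕ.* Y))) (by-order valid)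
      where
      f g : ℕ → ℕ
      f k = T con (neg mon ⊙ c ^ k)
      g k = T con (mon ⊙ c ^ k)
      A = index con ℕ.* (M ℕ.* n)
      B = index con ℕ.* (2 ℕ.* Y)
      j = pivot c
      mod0 : ∀ k i → lookup (proj₂ (mon ⊙ c ^ k)) i % 4 ≡ (k ℕ.* lookup (exps c) i) % 4
      mod0 k i = trans (cong (_% 4) (trans (lookup-⊙ mon c k i) (trans (cong (ℕ._+ k ℕ.* lookup (exps c) i)
          (trans (m≡m%n+[m/n]*n (lookup es i) 4) (cong (ℕ._+ lookup es i / 4 ℕ.* 4) (es%4 i)))) (ℕ.+-comm (lookup es i / 4 ℕ.* 4) _))))
        ([m+kn]%n≡m%n (k ℕ.* lookup (exps c) i) (lookup es i / 4) 4)
      one₀ : ∀ {x} → x ∈ xs → ⟦ mon ⊙ c ^ 0 ⟧ x ≡ 1#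
      one₀ {x} x∈ = trans (⟦⊙⟧ mon c 0 x) (trans (*-identityʳ _) (one x∈))
      first : A ℕ.+ M ℕ.* f 0 ℕ.+ 2 ℕ.* Y ≤ M ℕ.* g 0 ℕ.+ B
      first = subst (λ v → A ℕ.+ M ℕ.* T con v ℕ.+ 2 ℕ.* Y ≤ M ℕ.* g 0 ℕ.+ B) (neg-⊙ mon c 0)
        (T-trivial con us tri (mon ⊙ c ^ 0) (⊙-unit mon c 0 σ^4 u) one₀ (mod0 0))
      later : ∀ k → (k ℕ.* lookup (exps c) j) % 4 ≢ 0 → A ℕ.+ M ℕ.* f k ≤ M ℕ.* g k ℕ.+ B
      later k q = subst (λ v → A ℕ.+ M ℕ.* T con v ≤ M ℕ.* g k ℕ.+ B) (neg-⊙ mon c k)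
        (T-nontrivial con us (mon ⊙ c ^ k) (⊙-unit mon c k σ^4 u) j (λ e → q (trans (sym (mod0 k j)) e)) fresh)
      not0 : ∀ k e → suc k < 4 → e % 2 ≡ 1 → (suc k ℕ.* e) % 4 ≢ 0
      not0 k e k<4 odd q = residues k<4 (m%n<n e 4) (trans (mod-4-mod-2 e) odd) (trans (sym red) q)
        where
        red : (suc k ℕ.* e) % 4 ≡ (suc k ℕ.* (e % 4)) % 4
        red = trans (cong (λ v → (suc k ℕ.* v) % 4) (m≡m%n+[m/n]*n e 4))
          (trans (cong (_% 4) (trans (ℕ.*-distribˡ-+ (suc k) (e % 4) _) (cong (suc k ℕ.* (e % 4) ℕ.+_) (sym (ℕ.*-assoc (suc k) (e / 4) 4)))))
            ([m+kn]%n≡m%n (suc k ℕ.* (e % 4)) (suc k ℕ.* (e / 4)) 4))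
      by-order : Valid c →
        order c ℕ.* A ℕ.+ M ℕ.* sumTo (order c) f ℕ.+ 2 ℕ.* Y ≤ M ℕ.* sumTo (order c) g ℕ.+ order c ℕ.* B
      by-order (inj₁ (o≡4 , odd)) = subst (λ o → o ℕ.* A ℕ.+ M ℕ.* sumTo o f ℕ.+ 2 ℕ.* Y ≤ M ℕ.* sumTo o g ℕ.+ o ℕ.* B) (sym o≡4)
        (sumTo-≤-but-first 3 A B M (2 ℕ.* Y) f g first (λ k k<3 → later (suc k) (not0 k (lookup (exps c) j) k<3 odd)))
      by-order (inj₂ (o≡2 , two , _)) = subst (λ o → o ℕ.* A ℕ.+ M ℕ.* sumTo o f ℕ.+ 2 ℕ.* Y ≤ M ℕ.* sumTo o g ℕ.+ o ℕ.* B) (sym o≡2)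
        (sumTo-≤-but-first 1 A B M (2 ℕ.* Y) f g first only)
        where
        only : ∀ k → suc k < 2 → A ℕ.+ M ℕ.* f (suc k) ≤ M ℕ.* g (suc k) ℕ.+ B
        only zero    _             = later 1 (λ q → absurd (trans (sym two) (trans (cong (_% 4) (sym (ℕ.*-identityˡ (lookup (exps c) j)))) q)))
          where
          absurd : ¬ (2 ≡ 0)
          absurd ()
        only (suc k) (s≤s (s≤s ()))

    Satisfies : F → Condition F m → Set
    Satisfies x c = ⟦ monomial c ⟧ x ≡ 1#

    -- For a condition of order 2 the character takes the values ±1, and the factor `τ` must do so
    -- too.
    Unit₂ : Condition F m → Set
    Unit₂ c = order c ≡ 2 → τ c ^ 2 ≡ 1#

    -- Without a solution, orthogonality at every point gives T(1) = T(-1). Inserted into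
    -- `T-trivial`, this leaves I M n + 2Y ≤ 2 I Y with I the index, against the hypothesis.
    solution : ∀ con → Triangular con → All Unit con → All Unit₂ con →
      index con ℕ.* (2 ℕ.* Y) < index con ℕ.* (M ℕ.* n) ℕ.+ 2 ℕ.* Y →
      ∃ λ x → (∀ j → x + lookup cs j ≢ 0#) × All (Satisfies x) con
    solution con tri us us₂ small with Any.any? (λ x → All.all? (λ c → ⟦ monomial c ⟧ x Fin.≟ 1#) con) xs
    ... | yes a = let x , x∈ , sat = find a in x , nonRoots-lookup cs x∈ , sat
    ... | no ¬a = ⊥-elim (ℕ.<⇒≱ small (ℕ.+-cancelˡ-≤ (M ℕ.* T con unit) _ _ (begin
      M ℕ.* T con unit ℕ.+ (index con ℕ.* (M ℕ.* n) ℕ.+ 2 ℕ.* Y)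
        ≡⟨ solve 3 (λ u v w → u :+ (v :+ w) := v :+ u :+ w) refl (M ℕ.* T con unit) (index con ℕ.* (M ℕ.* n)) (2 ℕ.* Y) ⟩
      index con ℕ.* (M ℕ.* n) ℕ.+ M ℕ.* T con unit ℕ.+ 2 ℕ.* Y
        ≡⟨ cong (λ u → index con ℕ.* (M ℕ.* n) ℕ.+ M ℕ.* u ℕ.+ 2 ℕ.* Y) balanced ⟩
      index con ℕ.* (M ℕ.* n) ℕ.+ M ℕ.* T con (neg unit) ℕ.+ 2 ℕ.* Y
        ≤⟨ T-trivial con us tri unit (1^ 4) one (λ j → cong (_% 4) (Vec.lookup-replicate j 0)) ⟩
      M ℕ.* T con unit ℕ.+ index con ℕ.* (2 ℕ.* Y) ∎)))
      where
      open ℕ.≤-Reasoning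
      open +-*-Solver using (solve; _:+_; _:=_)
      unit : Mon
      unit = 1# , Vec.replicate m 0
      one : ∀ {x} → x ∈ xs → ⟦ unit ⟧ x ≡ 1#
      one {x} _ = trans (*-identityˡ _) (trans (cong χ (value-zero cs x)) (1^ P))
      roots : ∀ con → Triangular con → All Unit con → All Unit₂ con → ∀ {x} → x ∈ xs → All RootOfUnity (values con x)
      roots []        _                []       []       x∈ = []
      roots (c ∷ con) (v , _ , tri) (u ∷ us) (w ∷ ws) {x} x∈ = root v ∷ roots con tri us ws x∈
        where
        root : Valid c → RootOfUnity (order c , ⟦ monomial c ⟧ x)
        root (inj₁ (o≡4 , _)) = inj₂ o≡4 , subst (λ o → ⟦ monomial c ⟧ x ^ o ≡ 1#) (sym o≡4) (⟦⟧^4 {monomial c} u x∈)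
        root (inj₂ (o≡2 , _ , ev)) = inj₁ o≡2 , subst (λ o → ⟦ monomial c ⟧ x ^ o ≡ 1#) (sym o≡2)
          (trans (^-distrib-* (τ c) _ 2) (trans (cong₂ _*_ (w o≡2) (value-even^2 (exps c) x x∈ (pair-tabulate {Q = λ e → e % 2 ≡ 0} cs (exps c) ev))) (*-identityˡ 1#)))
      balanced : T con unit ≡ T con (neg unit)
      balanced = begin-equality
        T con unit                                                    ≡⟨ T-spread con unit ⟩
        Σ[ xs ] (λ x → spread (values con x) (⟦ unit ⟧ x))            ≡⟨ Σ-cong xs (λ {x} x∈ → trans (spread-balanced (values con x) (roots con tri us us₂ x∈)
                                                                            (λ all → ¬a (lose x∈ (All.map⁻ all))) (⟦ unit ⟧ x))
                                                                            (cong (spread (values con x)) (sym (⟦neg⟧ unit x)))) ⟩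
        Σ[ xs ] (λ x → spread (values con x) (⟦ neg unit ⟧ x))        ≡⟨ T-spread con (neg unit) ⟨
        T con (neg unit)                                              ∎

-- Difference families from four parameters

module _ {A : Set} where
  Σ-zero : ∀ (xs : List A) {f : A → ℕ} → (∀ {x} → x ∈ xs → f x ≡ 0) → Σ[ xs ] f ≡ 0
  Σ-zero []       z = refl
  Σ-zero (x ∷ xs) z = cong₂ ℕ._+_ (z (here refl)) (Σ-zero xs (z ∘ there))

  Σ-one : ∀ {xs : List A} {x} {f : A → ℕ} → Unique xs → x ∈ xs → f x ≡ 1 → (∀ {y} → y ∈ xs → y ≢ x → f y ≡ 0) → Σ[ xs ] f ≡ 1
  Σ-one {x ∷ xs} (x∉ ∷ u) (here refl) fx z = cong₂ ℕ._+_ fx (Σ-zero xs (λ y∈ → z (there y∈) (λ e → All.lookup x∉ y∈ (sym e))))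
  Σ-one {y ∷ xs} (y∉ ∷ u) (there x∈)  fx z = cong₂ ℕ._+_ (z (here refl) (All.lookup y∉ x∈)) (Σ-one u x∈ fx (z ∘ there))

-- The nonzero points of a block are (±2^s, ι^k b_s), with sign (-1)^k; the point 0 is `nothing`.
label : Fin 17 → Maybe (Fin 4 × Fin 4)
label zero    = nothing
label (suc i) = just (remQuot {4} 4 i)

abscissa : Maybe (Fin 4 × Fin 4) → Fin 17
abscissa nothing        = 0F
abscissa (just (s , k)) = ((if does (toℕ k % 2 ℕ.≟ 0) then 1 else 16) ℕ.* 2 ℕ.^ toℕ s) mod 17

-- (s , nothing) is b_s and (s , just (t , c)) is b_s + ι^c b_t.
Form : Set
Form = Fin 4 × Maybe (Fin 4 × Fin 4)

_≟Form_ : (f g : Form) → Dec (f ≡ g)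
_≟Form_ = Product.≡-dec Fin._≟_ (Maybe.≡-dec (Product.≡-dec Fin._≟_ Fin._≟_))

-- (u , f) stands for ι^u times the form f.
difference : Maybe (Fin 4 × Fin 4) → Maybe (Fin 4 × Fin 4) → Fin 4 × Form
difference nothing        nothing        = 0F , 0F , nothing
difference nothing        (just (t , l)) = (toℕ l ℕ.+ 2) mod 4 , t , nothing
difference (just (s , k)) nothing        = k , s , nothing
difference (just (s , k)) (just (t , l)) =
  -- The smaller index goes first, and b_s + ι³ b_s is rewritten as ι³ (b_s + ι b_s), so that forms
  -- differing by a power of ι coincide. Modulo 4 the exponent c is l - k + 2, the 2 standing for
  -- the minus sign.
  if does (toℕ s ℕ.<? toℕ t ⊎-dec (s Fin.≟ t ×-dec ¬? (c Fin.≟ 3F)))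
  then (k , s , just (t , c))
  else ((toℕ l ℕ.+ 2) mod 4 , t , just (s , (toℕ k ℕ.+ (6 ∸ toℕ l)) mod 4))
  where
  c = (toℕ l ℕ.+ (6 ∸ toℕ k)) mod 4

-- The four forms arising from the differences with first coordinate ±h, for 0 ≤ h ≤ 8.
formTable : Vec (Vec Form 4) 9
formTable =
  (plus 0F 0F 0F ∷ plus 1F 1F 0F ∷ plus 2F 2F 0F ∷ plus 3F 3F 0F ∷ []) ∷
  (only 0F       ∷ plus 0F 1F 2F ∷ plus 0F 1F 0F ∷ plus 3F 3F 1F ∷ []) ∷
  (only 1F       ∷ plus 0F 0F 1F ∷ plus 1F 2F 2F ∷ plus 1F 2F 0F ∷ []) ∷
  (plus 0F 1F 3F ∷ plus 0F 1F 1F ∷ plus 0F 2F 2F ∷ plus 0F 2F 0F ∷ []) ∷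
  (only 2F       ∷ plus 1F 1F 1F ∷ plus 2F 3F 2F ∷ plus 2F 3F 0F ∷ []) ∷
  (plus 0F 2F 3F ∷ plus 0F 2F 1F ∷ plus 2F 3F 1F ∷ plus 2F 3F 3F ∷ []) ∷
  (plus 1F 2F 3F ∷ plus 1F 2F 1F ∷ plus 1F 3F 2F ∷ plus 1F 3F 0F ∷ []) ∷
  (plus 0F 3F 2F ∷ plus 0F 3F 0F ∷ plus 1F 3F 1F ∷ plus 1F 3F 3F ∷ []) ∷
  (only 3F       ∷ plus 0F 3F 1F ∷ plus 0F 3F 3F ∷ plus 2F 2F 1F ∷ []) ∷ []
  where
  only : Fin 4 → Form
  only s = s , nothing
  plus : Fin 4 → Fin 4 → Fin 4 → Form
  plus s t c = s , just (t , c)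

form : Fin 9 → Fin 4 → Form
form h r = lookup (lookup formTable h) r

-- Negating a difference multiplies its form by -1 = ι², so h and -h share their forms.
fold17 : Fin 17 → Fin 9
fold17 h = (if does (toℕ h ℕ.≤? 8) then toℕ h else 17 ∸ toℕ h) mod 9

forms : Fin 17 → Fin 4 → Form
forms h = form (fold17 h)

searchFin : ∀ {n} {A : Set} → A → (Fin n → Maybe A) → A
searchFin {zero}  d f = d
searchFin {suc n} d f with f zero
... | just a  = a
... | nothing = searchFin d (f ∘ suc)

δ : Fin 17 → Fin 17 → Fin 17
δ i j = subMod (abscissa (label i)) (abscissa (label j))

pointAt : Fin 4 → Fin 4 → Fin 17
pointAt s k = suc (combine s k)

-- A form times ι^u arises from at most two pairs of points, one for each sign of the first coordinate.
candidates : Form → Fin 4 → (Fin 17 × Fin 17) × (Fin 17 × Fin 17)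
candidates (s , nothing)      u = (pointAt s u , zero) , (zero , pointAt s ((toℕ u ℕ.+ 2) mod 4))
candidates (s , just (t , c)) u = (pointAt s u , pointAt t ((toℕ u ℕ.+ toℕ c ℕ.+ 2) mod 4)) , (pointAt t ((toℕ u ℕ.+ toℕ c) mod 4) , pointAt s ((toℕ u ℕ.+ 2) mod 4))

Realises : Fin 17 → Fin 4 → Fin 4 → Fin 17 × Fin 17 → Set
Realises h r u (i , j) = i ≢ j × δ i j ≡ h × difference (label i) (label j) ≡ (u , forms h r)

abstract
  -- The default `0F` is reached only for i = j.
  row : Fin 17 → Fin 17 → Fin 4
  row i j = searchFin 0F λ r → if does (forms (δ i j) r ≟Form proj₂ (difference (label i) (label j))) then just r else nothing

  realise : Fin 17 → Fin 4 → Fin 4 → Fin 17 × Fin 17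
  realise h r u = let (a , b) = candidates (forms h r) u in if does (uncurry δ a Fin.≟ h) then a else b

  -- Checked by exhaustion, like the next two: the 17 · 16 ordered pairs of distinct points
  -- correspond one to one to the 17 · 4 · 4 triples of a first coordinate, a form and a power of ι,
  -- with `realise` as the inverse map.
  row-correct : ∀ i j → i ≡ j ⊎ proj₂ (difference (label i) (label j)) ≡ forms (δ i j) (row i j)
  row-correct = from-yes (Fin.all? λ i → Fin.all? λ j → i Fin.≟ j ⊎-dec proj₂ (difference (label i) (label j)) ≟Form forms (δ i j) (row i j))

  realise-unique : ∀ i j → i ≡ j ⊎ realise (δ i j) (row i j) (proj₁ (difference (label i) (label j))) ≡ (i , j)
  realise-unique = from-yes (Fin.all? λ i → Fin.all? λ j → i Fin.≟ j ⊎-dec Product.≡-dec Fin._≟_ Fin._≟_ (realise (δ i j) (row i j) (proj₁ (difference (label i) (label j)))) (i , j))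

  realise-correct : ∀ h r u → Realises h r u (realise h r u)
  realise-correct = from-yes (Fin.all? λ h → Fin.all? λ r → Fin.all? λ u → let (i , j) = realise h r u in
    ¬? (i Fin.≟ j) ×-dec δ i j Fin.≟ h ×-dec Product.≡-dec Fin._≟_ _≟Form_ (difference (label i) (label j)) (u , forms h r))

argmin : ∀ {n} (f : Fin (suc n) → ℕ) → ∃ λ i → ∀ j → f i ≤ f j
argmin {zero}  f = zero , λ { zero → ℕ.≤-refl }
argmin {suc n} f with argmin (f ∘ suc)
... | i , least with f zero ℕ.≤? f (suc i)
...   | yes q = zero , λ { zero → ℕ.≤-refl ; (suc j) → ℕ.≤-trans q (least j) }
...   | no ¬q = suc i , λ { zero → ℕ.<⇒≤ (ℕ.≰⇒> ¬q) ; (suc j) → least j }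

-- Counting the occurrences of a difference

module Hits {p q k : ℕ} {A : Set} (B : A → Block p q k) where
  Hit : Grp p q → A → Fin k → Fin k → Set
  Hit g s i j = i ≢ j × B s i -G B s j ≡ g

  term : Grp p q → A → Fin k → Fin k → ℕ
  term g s i j = if ⌊ i Fin.≟ j ⌋ then 0 else (if ⌊ (B s i -G B s j) ≟G g ⌋ then 1 else 0)

  term-hit : ∀ {g s i j} → Hit g s i j → term g s i j ≡ 1
  term-hit {g} {s} {i} {j} (i≢j , e) with i Fin.≟ j | (B s i -G B s j) ≟G g
  ... | yes q | _     = ⊥-elim (i≢j q)
  ... | no _  | yes _ = refl
  ... | no _  | no ¬e = ⊥-elim (¬e e)

  term-miss : ∀ {g s i j} → ¬ Hit g s i j → term g s i j ≡ 0
  term-miss {g} {s} {i} {j} ¬hit with i Fin.≟ j | (B s i -G B s j) ≟G g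
  ... | yes _  | _     = refl
  ... | no i≢j | yes e = ⊥-elim (¬hit (i≢j , e))
  ... | no _   | no _  = refl

  diffCount≡ : ∀ xs g → diffCount (map B xs) g ≡ Σ[ xs ] (λ s → Σ[ allFin k ] (λ i → Σ[ allFin k ] (term g s i)))
  diffCount≡ xs g = cong sumℕ (sym (List.map-∘ xs))

  no-hit : ∀ xs g → (∀ {s} → s ∈ xs → ∀ i j → ¬ Hit g s i j) → diffCount (map B xs) g ≡ 0
  no-hit xs g none = trans (diffCount≡ xs g) (Σ-zero xs (λ s∈ → Σ-zero (allFin k) (λ {i} _ → Σ-zero (allFin k) (λ {j} _ → term-miss (none s∈ i j)))))

  one-hit : ∀ {xs} g {s i j} → Unique xs → s ∈ xs → Hit g s i j →
    (∀ {s′} → s′ ∈ xs → ∀ i′ j′ → Hit g s′ i′ j′ → s′ ≡ s × i′ ≡ i × j′ ≡ j) → diffCount (map B xs) g ≡ 1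
  one-hit {xs} g {s} {i} {j} u s∈ hit unique = trans (diffCount≡ xs g)
    (Σ-one u s∈
      (Σ-one (Unique.allFin⁺ k) (∈-allFin i)
        (Σ-one (Unique.allFin⁺ k) (∈-allFin j) (term-hit hit)
          (λ {j′} _ j′≢j → term-miss (λ h → j′≢j (proj₂ (proj₂ (unique s∈ i j′ h))))))
        (λ {i′} _ i′≢i → Σ-zero (allFin k) (λ {j′} _ → term-miss (λ h → i′≢i (proj₁ (proj₂ (unique s∈ i′ j′ h)))))))
      (λ {s′} s′∈ s′≢s → Σ-zero (allFin k) (λ {i′} _ → Σ-zero (allFin k) (λ {j′} _ → term-miss (λ h → s′≢s (proj₁ (unique s′∈ i′ j′ h)))))))

module QuarticUnit {p : ℕ} (K : PrimeField p) (P R : ℕ) (P≡ : P ≡ 4 ℕ.* R) (p≡ : p ≡ suc (4 ℕ.* P))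
  (ι : Fin p) (ι² : PrimeField._*_ K ι ι ≡ PrimeField.-_ K (PrimeField.1# K)) where
  open FieldFacts K
  open QuarticCharacter K P p≡

  ι^2 : ι ^ 2 ≡ - 1#
  ι^2 = trans (cong (ι *_) (*-identityʳ ι)) ι²

  ι^4 : ι ^ 4 ≡ 1#
  ι^4 = trans (sym (^-assocʳ ι 2 2)) (trans (cong (_^ 2) ι^2) (trans (cong (- 1# *_) (*-identityʳ _)) -1*-1))

  ι≢0 : ι ≢ 0#
  ι≢0 e = 1≢0 (trans (sym ι^4) (trans (cong (_^ 4) e) (zeroˡ _)))

  χ-ι : χ ι ≡ 1#
  χ-ι = trans (cong (ι ^_) P≡) (trans (sym (^-assocʳ ι 4 R)) (trans (cong (_^ R) ι^4) (1^ R)))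

  χ-ι^ : ∀ n → χ (ι ^ n) ≡ 1#
  χ-ι^ n = trans (χ-^ ι n) (trans (cong (_^ n) χ-ι) (1^ n))

  ι^-mod : ∀ m n → m % 4 ≡ n % 4 → ι ^ m ≡ ι ^ n
  ι^-mod m n e = trans (^-mod-4 m ι^4) (trans (cong (ι ^_) e) (sym (^-mod-4 n ι^4)))

  ι^-injective : ∀ (u v : Fin 4) → ι ^ toℕ u ≡ ι ^ toℕ v → u ≡ v
  ι^-injective = λ
    { 0F 0F e → refl ; 1F 1F e → refl ; 2F 2F e → refl ; 3F 3F e → refl
    ; 0F 1F e → ⊥-elim (distinct₁ (trans (sym (*-identityʳ ι)) (sym e))) ; 1F 0F e → ⊥-elim (distinct₁ (trans (sym (*-identityʳ ι)) e))
    ; 0F 2F e → ⊥-elim (1≢-1 (trans e ι^2)) ; 2F 0F e → ⊥-elim (1≢-1 (trans (sym e) ι^2))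
    ; 0F 3F e → ⊥-elim (distinct₃ (sym e)) ; 3F 0F e → ⊥-elim (distinct₃ e)
    ; 1F 2F e → ⊥-elim (distinct₁ (*-cancelˡ ι≢0 (trans (trans (cong (ι *_) (sym (*-identityʳ ι))) (sym e)) refl)))
    ; 2F 1F e → ⊥-elim (distinct₁ (*-cancelˡ ι≢0 (trans (cong (ι *_) (sym (*-identityʳ ι))) e)))
    ; 1F 3F e → ⊥-elim (1≢-1 (trans (*-cancelˡ ι≢0 e) ι^2)) ; 3F 1F e → ⊥-elim (1≢-1 (trans (sym (*-cancelˡ ι≢0 e)) ι^2))
    ; 2F 3F e → ⊥-elim (distinct₁ (trans (sym (*-identityʳ ι)) (sym (*-cancelˡ ι≢0 (*-cancelˡ ι≢0 e)))))
    ; 3F 2F e → ⊥-elim (distinct₁ (trans (sym (*-identityʳ ι)) (*-cancelˡ ι≢0 (*-cancelˡ ι≢0 e)))) }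
    where
    distinct₁ : ι ≢ 1#
    distinct₁ e = 1≢-1 (trans (sym (*-identityˡ 1#)) (trans (cong₂ _*_ (sym e) (sym e)) ι²))
    distinct₃ : ι ^ 3 ≢ 1#
    distinct₃ e = distinct₁ (trans (sym (*-identityʳ ι)) (trans (cong (ι *_) (sym e)) ι^4))

  toℕ-mod4 : ∀ n → toℕ (n mod 4) ≡ n % 4
  toℕ-mod4 n = Fin.toℕ-fromℕ< (m%n<n n 4)

  ι^-mod4 : ∀ n → ι ^ toℕ (n mod 4) ≡ ι ^ n
  ι^-mod4 n = trans (cong (ι ^_) (toℕ-mod4 n)) (sym (^-mod-4 n ι^4))

  -ι^ : ∀ n x → - (ι ^ n * x) ≡ ι ^ (n ℕ.+ 2) * x
  -ι^ n x = trans (sym (-1* _)) (trans (cong (_* (ι ^ n * x)) (sym ι^2))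
    (trans (S.solve 3 (λ u v x → u S.:* (v S.:* x) S.:= (v S.:* u) S.:* x) refl (ι ^ 2) (ι ^ n) x) (cong (_* x) (sym (^-homo-* ι n 2)))))

  complement : ∀ (u : Fin 4) → (toℕ u ℕ.+ (4 ∸ toℕ u)) % 4 ≡ 0
  complement = from-yes (Fin.all? {4} λ u → (toℕ u ℕ.+ (4 ∸ toℕ u)) % 4 ℕ.≟ 0)

  fourth-root-index : ∀ {z} → z ^ 4 ≡ 1# → ∃ λ (k : Fin 4) → z ≡ ι ^ toℕ k
  fourth-root-index {z} e =
    [ (λ q → 0F , q) , [ (λ q → 2F , trans q (sym ι^2)) , [ (λ q → 1F , trans q (sym (*-identityʳ ι))) ,
      (λ q → 3F , trans q (trans (sym (-1* ι)) (trans (cong₂ _*_ (sym ι^2) (sym (*-identityʳ ι))) (sym (^-homo-* ι 2 1))))) ]′ ]′ ]′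
    (fourth-roots ι² e)

-- The blocks and the verification of the difference property

module DifferenceFamily {p : ℕ} (K : PrimeField p) (P R : ℕ) (P≡ : P ≡ 4 ℕ.* R) (p≡ : p ≡ suc (4 ℕ.* P))
  (ι : Fin p) (ι² : PrimeField._*_ K ι ι ≡ PrimeField.-_ K (PrimeField.1# K))
  (b : Fin 4 → Fin p) where
  open FieldFacts K
  open QuarticCharacter K P p≡
  open QuarticUnit K P R P≡ p≡ ι ι²

  point : Maybe (Fin 4 × Fin 4) → F
  point nothing        = 0#
  point (just (s , k)) = ι ^ toℕ k * b s

  ⟦_⟧ : Form → F
  ⟦ s , nothing ⟧      = b s
  ⟦ s , just (t , c) ⟧ = b s + ι ^ toℕ c * b t

  private
    exponents : ∀ (k l : Fin 4) → (toℕ k ℕ.+ toℕ ((toℕ l ℕ.+ (6 ∸ toℕ k)) mod 4)) % 4 ≡ (toℕ l ℕ.+ 2) % 4 ×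
                                 (toℕ ((toℕ l ℕ.+ 2) mod 4) ℕ.+ toℕ ((toℕ k ℕ.+ (6 ∸ toℕ l)) mod 4)) % 4 ≡ toℕ k % 4
    exponents = from-yes (Fin.all? {4} λ k → Fin.all? {4} λ l →
      (toℕ k ℕ.+ toℕ ((toℕ l ℕ.+ (6 ∸ toℕ k)) mod 4)) % 4 ℕ.≟ (toℕ l ℕ.+ 2) % 4 ×-dec
      (toℕ ((toℕ l ℕ.+ 2) mod 4) ℕ.+ toℕ ((toℕ k ℕ.+ (6 ∸ toℕ l)) mod 4)) % 4 ℕ.≟ toℕ k % 4)

  difference-correct : ∀ x y → x ≢ nothing ⊎ y ≢ nothing →
    point x + - point y ≡ ι ^ toℕ (proj₁ (difference x y)) * ⟦ proj₂ (difference x y) ⟧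
  difference-correct nothing        nothing        (inj₁ q) = ⊥-elim (q refl)
  difference-correct nothing        nothing        (inj₂ q) = ⊥-elim (q refl)
  difference-correct nothing        (just (t , l)) _ = trans (+-identityˡ _) (trans (-ι^ (toℕ l) (b t)) (cong (_* b t) (sym (ι^-mod4 (toℕ l ℕ.+ 2)))))
  difference-correct (just (s , k)) nothing        _ = trans (cong (ι ^ toℕ k * b s +_) -0#≈0#) (+-identityʳ _)
  difference-correct (just (s , k)) (just (t , l)) _ = trans (cong (ι ^ toℕ k * b s +_) (-ι^ (toℕ l) (b t))) (choose (does (toℕ s ℕ.<? toℕ t ⊎-dec (s Fin.≟ t ×-dec ¬? (c Fin.≟ 3F)))))
    where
    open ≡-Reasoning
    c = (toℕ l ℕ.+ (6 ∸ toℕ k)) mod 4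
    c′ = (toℕ k ℕ.+ (6 ∸ toℕ l)) mod 4
    l+2 = (toℕ l ℕ.+ 2) mod 4
    factor : ∀ m n {x y} → ι ^ m * (x + ι ^ n * y) ≡ ι ^ m * x + ι ^ (m ℕ.+ n) * y
    factor m n {x} {y} = trans (S.solve 4 (λ u v x y → u S.:* (x S.:+ v S.:* y) S.:= u S.:* x S.:+ (u S.:* v) S.:* y) refl (ι ^ m) (ι ^ n) x y)
      (cong (λ z → ι ^ m * x + z * y) (sym (^-homo-* ι m n)))
    choose : ∀ β → let d = if β then (k , s , just (t , c)) else (l+2 , t , just (s , c′)) in
      ι ^ toℕ k * b s + ι ^ (toℕ l ℕ.+ 2) * b t ≡ ι ^ toℕ (proj₁ d) * ⟦ proj₂ d ⟧
    choose true = sym (begin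
      ι ^ toℕ k * (b s + ι ^ toℕ c * b t)                 ≡⟨ factor (toℕ k) (toℕ c) ⟩
      ι ^ toℕ k * b s + ι ^ (toℕ k ℕ.+ toℕ c) * b t       ≡⟨ cong (λ z → ι ^ toℕ k * b s + z * b t) (ι^-mod (toℕ k ℕ.+ toℕ c) (toℕ l ℕ.+ 2) (proj₁ (exponents k l))) ⟩
      ι ^ toℕ k * b s + ι ^ (toℕ l ℕ.+ 2) * b t           ∎)
    choose false = sym (begin
      ι ^ toℕ l+2 * (b t + ι ^ toℕ c′ * b s)              ≡⟨ factor (toℕ l+2) (toℕ c′) ⟩
      ι ^ toℕ l+2 * b t + ι ^ (toℕ l+2 ℕ.+ toℕ c′) * b s  ≡⟨ cong₂ (λ y z → y * b t + z * b s) (ι^-mod4 (toℕ l ℕ.+ 2)) (ι^-mod (toℕ l+2 ℕ.+ toℕ c′) (toℕ k) (proj₂ (exponents k l))) ⟩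
      ι ^ (toℕ l ℕ.+ 2) * b t + ι ^ toℕ k * b s           ≡⟨ +-comm _ _ ⟩
      ι ^ toℕ k * b s + ι ^ (toℕ l ℕ.+ 2) * b t           ∎)

  -- Representatives of the fourth powers modulo the powers of ι.
  Representative : F → Set
  Representative s = χ s ≡ 1# × (∀ (u : Fin 4) → toℕ s ≤ toℕ (ι ^ toℕ u * s))

  representative? : ∀ s → Dec (Representative s)
  representative? s = χ s Fin.≟ 1# ×-dec Fin.all? (λ u → toℕ s ℕ.≤? toℕ (ι ^ toℕ u * s))

  representative≢0 : ∀ {s} → Representative s → s ≢ 0#
  representative≢0 (χs , _) refl = 1≢0 (trans (sym χs) (χ-0 P refl))
    where
    χ-0 : ∀ n → P ≡ n → 0# ^ n ≡ 0#
    χ-0 zero    e = ⊥-elim (ℕ.<-irrefl (sym (trans p≡ (cong (λ n → suc (4 ℕ.* n)) e))) 1<p)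
    χ-0 (suc n) _ = zeroˡ _

  represent : ∀ {t} → χ t ≡ 1# → ∃ λ s → ∃ λ (u : Fin 4) → Representative s × s * ι ^ toℕ u ≡ t
  represent {t} χt with argmin (λ (u : Fin 4) → toℕ (ι ^ toℕ u * t))
  ... | v , least = s , w , (χs , least′) , (begin
      s * ι ^ toℕ w                 ≡⟨ *-comm s _ ⟩
      ι ^ toℕ w * s                 ≡⟨ shift w ⟩
      ι ^ toℕ ((toℕ w ℕ.+ toℕ v) mod 4) * t ≡⟨ cong (_* t) (trans (ι^-mod4 (toℕ w ℕ.+ toℕ v)) (trans (^-mod-4 (toℕ w ℕ.+ toℕ v) ι^4) (cong (ι ^_) (inverse-exponent v)))) ⟩
      1# * t                        ≡⟨ *-identityˡ t ⟩
      t                             ∎)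
    where
    open ≡-Reasoning
    s = ι ^ toℕ v * t
    w = (4 ∸ toℕ v) mod 4
    inverse-exponent : ∀ (v : Fin 4) → (toℕ ((4 ∸ toℕ v) mod 4) ℕ.+ toℕ v) % 4 ≡ 0
    inverse-exponent = from-yes (Fin.all? {4} λ v → (toℕ ((4 ∸ toℕ v) mod 4) ℕ.+ toℕ v) % 4 ℕ.≟ 0)
    χs : χ s ≡ 1#
    χs = trans (χ-* (ι ^ toℕ v) t) (trans (cong₂ _*_ (χ-ι^ (toℕ v)) χt) (*-identityˡ 1#))
    shift : ∀ (u : Fin 4) → ι ^ toℕ u * s ≡ ι ^ toℕ ((toℕ u ℕ.+ toℕ v) mod 4) * t
    shift u = trans (sym (*-assoc _ _ t)) (cong (_* t) (trans (sym (^-homo-* ι (toℕ u) (toℕ v))) (sym (ι^-mod4 (toℕ u ℕ.+ toℕ v)))))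
    least′ : ∀ u → toℕ s ≤ toℕ (ι ^ toℕ u * s)
    least′ u = subst (λ z → toℕ s ≤ toℕ z) (sym (shift u)) (least ((toℕ u ℕ.+ toℕ v) mod 4))

  -- Both elements lie in one orbit under multiplication by ι, and each has the least numerical
  -- value there.
  represent-unique : ∀ {s s′} {u u′ : Fin 4} → Representative s → Representative s′ →
    s * ι ^ toℕ u ≡ s′ * ι ^ toℕ u′ → s ≡ s′ × u ≡ u′
  represent-unique {s} {s′} {u} {u′} r r′ e = s≡s′ , ι^-injective u u′ (*-cancelˡ (representative≢0 r) (trans e (cong (_* ι ^ toℕ u′) (sym s≡s′))))
    where
    open ≡-Reasoning
    rotate : ∀ {s s′} (u u′ : Fin 4) → s * ι ^ toℕ u ≡ s′ * ι ^ toℕ u′ → s′ ≡ ι ^ toℕ ((toℕ u ℕ.+ (4 ∸ toℕ u′)) mod 4) * s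
    rotate {s} {s′} u u′ e = begin
      s′                                               ≡⟨ *-identityʳ s′ ⟨
      s′ * 1#                                          ≡⟨ cong (s′ *_) (sym (trans (^-mod-4 (toℕ u′ ℕ.+ (4 ∸ toℕ u′)) ι^4) (cong (ι ^_) (complement u′)))) ⟩
      s′ * ι ^ (toℕ u′ ℕ.+ (4 ∸ toℕ u′))               ≡⟨ trans (cong (s′ *_) (^-homo-* ι (toℕ u′) (4 ∸ toℕ u′))) (sym (*-assoc s′ _ _)) ⟩
      s′ * ι ^ toℕ u′ * ι ^ (4 ∸ toℕ u′)               ≡⟨ cong (_* ι ^ (4 ∸ toℕ u′)) e ⟨
      s * ι ^ toℕ u * ι ^ (4 ∸ toℕ u′)                 ≡⟨ trans (*-assoc s _ _) (cong (s *_) (sym (^-homo-* ι (toℕ u) (4 ∸ toℕ u′)))) ⟩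
      s * ι ^ (toℕ u ℕ.+ (4 ∸ toℕ u′))                 ≡⟨ trans (*-comm s _) (cong (_* s) (sym (ι^-mod4 (toℕ u ℕ.+ (4 ∸ toℕ u′))))) ⟩
      ι ^ toℕ ((toℕ u ℕ.+ (4 ∸ toℕ u′)) mod 4) * s     ∎
    s≡s′ : s ≡ s′
    s≡s′ = Fin.toℕ-injective (ℕ.≤-antisym
      (subst (λ z → toℕ s ≤ toℕ z) (sym (rotate u u′ e)) (proj₂ r ((toℕ u ℕ.+ (4 ∸ toℕ u′)) mod 4)))
      (subst (λ z → toℕ s′ ≤ toℕ z) (sym (rotate u′ u (sym e))) (proj₂ r′ ((toℕ u′ ℕ.+ (4 ∸ toℕ u)) mod 4))))

  block : F → Block 17 p 17
  block s i = abscissa (label i) , s * point (label i)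

  S-list : List F
  S-list = filter representative? (allFin p)

  family : List (Block 17 p 17)
  family = map block S-list

  module _ (form≢0 : ∀ h r → ⟦ form h r ⟧ ≢ 0#)
           (rainbow : ∀ h {r r′} → χ ⟦ form h r ⟧ ≡ χ ⟦ form h r′ ⟧ → r ≡ r′) where

    not-both : ∀ i j → i ≢ j → label i ≢ nothing ⊎ label j ≢ nothing
    not-both zero    zero    i≢j = ⊥-elim (i≢j refl)
    not-both zero    (suc j) _   = inj₂ λ ()
    not-both (suc i) j       _   = inj₁ λ ()

    u_ : Fin 17 × Fin 17 → Fin 4
    u (i , j) = proj₁ (difference (label i) (label j))

    block-difference : ∀ s i j → i ≢ j →
      block s i -G block s j ≡ (δ i j , s * ι ^ toℕ (u (i , j)) * ⟦ forms (δ i j) (row i j) ⟧)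
    block-difference s i j i≢j = cong (δ i j ,_) (begin
      subMod (s * x) (s * y)        ≡⟨ subMod≡ (s * x) (s * y) ⟩
      s * x + - (s * y)             ≡⟨ cong (s * x +_) (-‿distribʳ-* s y) ⟩
      s * x + s * - y               ≡⟨ distribˡ s x (- y) ⟨
      s * (x + - y)                 ≡⟨ cong (s *_) (difference-correct (label i) (label j) (not-both i j i≢j)) ⟩
      s * (ι ^ toℕ (u (i , j)) * ⟦ proj₂ (difference (label i) (label j)) ⟧) ≡⟨ *-assoc s _ _ ⟨
      s * ι ^ toℕ (u (i , j)) * ⟦ proj₂ (difference (label i) (label j)) ⟧   ≡⟨ cong (λ f → s * ι ^ toℕ (u (i , j)) * ⟦ f ⟧) (form≡ (row-correct i j)) ⟩
      s * ι ^ toℕ (u (i , j)) * ⟦ forms (δ i j) (row i j) ⟧ ∎)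
      where
      open ≡-Reasoning
      x = point (label i)
      y = point (label j)
      form≡ : i ≡ j ⊎ proj₂ (difference (label i) (label j)) ≡ forms (δ i j) (row i j) → proj₂ (difference (label i) (label j)) ≡ forms (δ i j) (row i j)
      form≡ (inj₁ e) = ⊥-elim (i≢j e)
      form≡ (inj₂ e) = e

    scaled≢0 : ∀ {s} → Representative s → ∀ (v : Fin 4) h r → s * ι ^ toℕ v * ⟦ forms h r ⟧ ≢ 0#
    scaled≢0 r v h k = *≢0 (*≢0 (representative≢0 r) (^≢0 (toℕ v) ι≢0)) (form≢0 (fold17 h) k)

    block-injective : ∀ {s} → Representative s → IsKSubset (block s)
    block-injective {s} r {i} {j} e with i Fin.≟ j
    ... | yes q  = q
    ... | no i≢j = ⊥-elim (scaled≢0 r (u (i , j)) (δ i j) (row i j) (begin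
      s * ι ^ toℕ (u (i , j)) * ⟦ forms (δ i j) (row i j) ⟧  ≡⟨ cong proj₂ (block-difference s i j i≢j) ⟨
      proj₂ (block s i -G block s j)                         ≡⟨ cong (λ z → proj₂ (z -G block s j)) e ⟩
      subMod (s * point (label j)) (s * point (label j))     ≡⟨ trans (subMod≡ _ _) (-‿inverseʳ _) ⟩
      0#                                                     ∎))
      where open ≡-Reasoning

    open Hits block

    S-representative : ∀ {s} → s ∈ S-list → Representative s
    S-representative {s} s∈ = proj₂ (∈-filter⁻ representative? {v = s} {xs = allFin p} s∈)

    -- Five character values among four roots of unity must collide; the four forms do not collide
    -- with each other, so χ y equals the value of one of them.
    matching-form : ∀ h {y} → y ≢ 0# → ∃ λ r → χ ⟦ form h r ⟧ ≡ χ y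
    matching-form h {y} y≢0 = go (Fin.pigeonhole (ℕ.n<1+n 4) slot)
      where
      z : Fin 5 → F
      z zero    = χ y
      z (suc r) = χ ⟦ form h r ⟧
      z^4 : ∀ k → z k ^ 4 ≡ 1#
      z^4 zero    = χ^4 y≢0
      z^4 (suc r) = χ^4 (form≢0 h r)
      slot : Fin 5 → Fin 4
      slot k = proj₁ (fourth-root-index (z^4 k))
      same : ∀ {k k′} → slot k ≡ slot k′ → z k ≡ z k′
      same {k} {k′} e = trans (proj₂ (fourth-root-index (z^4 k))) (trans (cong (λ v → ι ^ toℕ v) e) (sym (proj₂ (fourth-root-index (z^4 k′)))))
      go : (∃ λ k → ∃ λ k′ → k Fin.< k′ × slot k ≡ slot k′) → ∃ λ r → χ ⟦ form h r ⟧ ≡ χ y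
      go (zero  , suc r′ , _ , e)   = r′ , sym (same {zero} {suc r′} e)
      go (suc r , suc r′ , lt , e) = ⊥-elim (Fin.<⇒≢ lt (cong suc (rainbow h (same {suc r} {suc r′} e))))

    χ-scaled : ∀ {s} (v : Fin 4) x → Representative s → χ (s * ι ^ toℕ v * x) ≡ χ x
    χ-scaled {s} v x (χs , _) = trans (χ-* _ x) (trans (cong (_* χ x) (trans (χ-* s _) (trans (cong₂ _*_ χs (χ-ι^ (toℕ v))) (*-identityˡ 1#)))) (*-identityˡ _))

    -- χ does not see the factor s ι^u, so the second coordinate determines the form. Cancelling the
    -- form leaves s ι^u, which determines s and u, and `realise` recovers the pair of points.
    hits-agree : ∀ {h y s s′} i j i′ j′ → Representative s → Representative s′ → Hit (h , y) s i j → Hit (h , y) s′ i′ j′ →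
      s′ ≡ s × i′ ≡ i × j′ ≡ j
    hits-agree {h} {y} {s} {s′} i j i′ j′ rep rep′ (i≢j , e) (i′≢j′ , e′) =
      sym (proj₁ su) , cong proj₁ ij≡ , cong proj₂ ij≡
      where
      open ≡-Reasoning
      e₁ = trans (sym (block-difference s i j i≢j)) e
      e₁′ = trans (sym (block-difference s′ i′ j′ i′≢j′)) e′
      δ≡ : δ i j ≡ δ i′ j′
      δ≡ = trans (cong proj₁ e₁) (sym (cong proj₁ e₁′))
      f = ⟦ forms (δ i j) (row i j) ⟧
      f′ = ⟦ forms (δ i j) (row i′ j′) ⟧
      scaled≡ : s * ι ^ toℕ (u (i , j)) * f ≡ s′ * ι ^ toℕ (u (i′ , j′)) * f′
      scaled≡ = trans (cong proj₂ e₁) (trans (sym (cong proj₂ e₁′)) (cong (λ d → s′ * ι ^ toℕ (u (i′ , j′)) * ⟦ forms d (row i′ j′) ⟧) (sym δ≡)))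
      row≡ : row i j ≡ row i′ j′
      row≡ = rainbow (fold17 (δ i j)) (trans (sym (χ-scaled (u (i , j)) f rep)) (trans (cong χ scaled≡) (χ-scaled (u (i′ , j′)) f′ rep′)))
      su : s ≡ s′ × u (i , j) ≡ u (i′ , j′)
      su = represent-unique rep rep′ (*-cancelˡ (form≢0 (fold17 (δ i j)) (row i j)) (trans (*-comm f _)
        (trans scaled≡ (trans (cong (λ r → s′ * ι ^ toℕ (u (i′ , j′)) * ⟦ forms (δ i j) r ⟧) (sym row≡)) (*-comm _ f)))))
      realised : ∀ i j → i ≢ j → realise (δ i j) (row i j) (u (i , j)) ≡ (i , j)
      realised i j i≢j with realise-unique i j
      ... | inj₁ q = ⊥-elim (i≢j q)
      ... | inj₂ q = q
      ij≡ : (i′ , j′) ≡ (i , j)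
      ij≡ = begin
        (i′ , j′)                                      ≡⟨ realised i′ j′ i′≢j′ ⟨
        realise (δ i′ j′) (row i′ j′) (u (i′ , j′))    ≡⟨ cong (λ d → realise d (row i′ j′) (u (i′ , j′))) δ≡ ⟨
        realise (δ i j) (row i′ j′) (u (i′ , j′))      ≡⟨ cong₂ (realise (δ i j)) row≡ (proj₂ su) ⟨
        realise (δ i j) (row i j) (u (i , j))          ≡⟨ realised i j i≢j ⟩
        (i , j)                                        ∎

    isRelDF : IsRelDF 17 p 17 1 family
    isRelDF = All.map⁺ (All.tabulate (λ s∈ → block-injective (S-representative s∈))) , counts
      where
      counts : ∀ (g : Grp 17 p) → (InN g → diffCount family g ≡ 0) × (¬ InN g → diffCount family g ≡ 1)
      counts (h , y) = inN , notInN
        where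
        inN : toℕ y ≡ 0 → diffCount family (h , y) ≡ 0
        inN y≡0 = no-hit S-list (h , y) (λ {s} s∈ i j (i≢j , e) → scaled≢0 (S-representative s∈) (u (i , j)) (δ i j) (row i j)
          (trans (cong proj₂ (trans (sym (block-difference s i j i≢j)) e)) (toℕ≡0 y≡0)))
        notInN : ¬ toℕ y ≡ 0 → diffCount family (h , y) ≡ 1
        notInN y≢ = one-hit (h , y) {s} {i} {j} (Unique.filter⁺ representative? (Unique.allFin⁺ p)) (∈-filter⁺ representative? (∈-allFin s) rep) hit
          (λ s′∈ i′ j′ hit′ → hits-agree i j i′ j′ rep (S-representative s′∈) hit hit′)
          where
          open ≡-Reasoning
          y≢0 : y ≢ 0#
          y≢0 e = y≢ (trans (cong toℕ e) toℕ-0#)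
          match = matching-form (fold17 h) y≢0
          r = proj₁ match
          l = ⟦ forms h r ⟧
          l⁻¹ = inverse (form≢0 (fold17 h) r)
          -- Then y = t l with χ t = 1, and t is a representative times a power of ι.
          t = proj₁ l⁻¹ * y
          χt : χ t ≡ 1#
          χt = *-cancelˡ (^≢0 P (form≢0 (fold17 h) r)) (begin
            χ l * χ t              ≡⟨ χ-* l t ⟨
            χ (l * (proj₁ l⁻¹ * y)) ≡⟨ cong χ (trans (sym (*-assoc l _ y)) (trans (cong (_* y) (proj₂ (proj₂ l⁻¹))) (*-identityˡ y))) ⟩
            χ y                    ≡⟨ proj₂ match ⟨
            χ l                    ≡⟨ *-identityʳ _ ⟨
            χ l * 1#               ∎)
          rp = represent χt
          s = proj₁ rp
          v = proj₁ (proj₂ rp)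
          rep = proj₁ (proj₂ (proj₂ rp))
          ij = realise h r v
          i = proj₁ ij
          j = proj₂ ij
          correct : Realises h r v ij
          correct = realise-correct h r v
          hit : Hit (h , y) s i j
          hit = proj₁ correct , (begin
            block s i -G block s j
              ≡⟨ cong₂ _,_ (proj₁ (proj₂ correct)) (trans (subMod≡ _ _) (trans (cong (s * point (label i) +_) (-‿distribʳ-* s _)) (sym (distribˡ s _ _)))) ⟩
            (h , s * (point (label i) + - point (label j)))
              ≡⟨ cong (λ z → h , s * z) (difference-correct (label i) (label j) (not-both i j (proj₁ correct))) ⟩
            (h , s * (ι ^ toℕ (proj₁ (difference (label i) (label j))) * ⟦ proj₂ (difference (label i) (label j)) ⟧))
              ≡⟨ cong (λ d → h , s * (ι ^ toℕ (proj₁ d) * ⟦ proj₂ d ⟧)) (proj₂ (proj₂ correct)) ⟩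
            (h , s * (ι ^ toℕ v * l))
              ≡⟨ cong (h ,_) (begin
                   s * (ι ^ toℕ v * l)      ≡⟨ *-assoc s _ l ⟨
                   s * ι ^ toℕ v * l        ≡⟨ cong (_* l) (proj₂ (proj₂ (proj₂ rp))) ⟩
                   proj₁ l⁻¹ * y * l        ≡⟨ S.solve 3 (λ a y l → a S.:* y S.:* l S.:= l S.:* a S.:* y) refl (proj₁ l⁻¹) y l ⟩
                   l * proj₁ l⁻¹ * y        ≡⟨ trans (cong (_* y) (proj₂ (proj₂ l⁻¹))) (*-identityˡ y) ⟩
                   y                        ∎) ⟩
            (h , y) ∎)

-- Large primes

-- The exponents of χ prescribed for the forms of the rows 1, 2, 4, 8 of the table, where χ (1 + ι) = ι^e and
-- b₁ , b₂ , b₄ , b₈ have exponents 0 , 1 , 2 , 3.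
Separated : ℕ → ℕ → ℕ → Set
Separated e r₁ r₂ = ∀ (s r r′ : Fin 4) → lookup (k s) r % 4 ≡ lookup (k s) r′ % 4 → r ≡ r′
  where
  k : Fin 4 → Vec ℕ 4
  k s = lookup
    ((0 ∷ r₁ ∷ r₂ ∷ e ℕ.+ 3 ∷ []) ∷
     (1 ∷ e ∷ 1 ℕ.+ r₁ ∷ 1 ℕ.+ r₂ ∷ []) ∷
     (2 ∷ e ℕ.+ 1 ∷ 2 ℕ.+ r₁ ∷ 2 ℕ.+ r₂ ∷ []) ∷
     (3 ∷ 3 ℕ.+ r₁ ∷ 3 ℕ.+ r₂ ∷ e ℕ.+ 2 ∷ []) ∷ []) s

separated? : ∀ e r₁ r₂ → Dec (Separated e r₁ r₂)
separated? e r₁ r₂ = Fin.all? λ s → Fin.all? λ r → Fin.all? λ r′ → _ ℕ.≟ _ →-dec r Fin.≟ r′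

-- For equal indices c = 2 would give the zero form; c ≤ 1 leaves the multiples of b_s by 1 + 1 and
-- 1 + ι.
Normal : Form → Set
Normal (s , nothing)      = ⊤
Normal (s , just (t , c)) = toℕ s < toℕ t ⊎ (s ≡ t × toℕ c ≤ 1)

normal? : ∀ f → Dec (Normal f)
normal? (s , nothing)      = yes tt
normal? (s , just (t , c)) = toℕ s ℕ.<? toℕ t ⊎-dec (s Fin.≟ t ×-dec toℕ c ℕ.≤? 1)

form-normal : ∀ h r → Normal (form h r)
form-normal = from-yes (Fin.all? {9} λ h → Fin.all? {4} λ r → normal? (form h r))

nth : ∀ {A : Set} {Q : A → Set} {xs} → All Q xs → ∀ i → Q (List.lookup xs i)
nth (q ∷ qs) zero    = q
nth (q ∷ qs) (suc i) = nth qs i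

-- Successive choice of the parameters of the block

module Choice {p : ℕ} (K : PrimeField p) (P R : ℕ) (P≡ : P ≡ 4 ℕ.* R) (p≡ : p ≡ suc (4 ℕ.* P))
  (M Y m₀ : ℕ) (odd-bound : QuarticCharacter.OddBound K P p≡ M Y m₀) (even-bound : QuarticCharacter.EvenBound K P p≡ M Y m₀)
  (13≤m₀ : 13 ≤ m₀)
  (enough : ∀ I n → I ≤ 2097152 → p ≤ 13 ℕ.+ n → I ℕ.* (2 ℕ.* Y) < I ℕ.* (M ℕ.* n) ℕ.+ 2 ℕ.* Y)
  (ι : Fin p) (ι² : PrimeField._*_ K ι ι ≡ PrimeField.-_ K (PrimeField.1# K)) where
  open FieldFacts K
  open LinearFactors K using (value)
  open QuarticCharacter K P p≡
  open QuarticUnit K P R P≡ p≡ ι ι²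
  open Existence K P p≡ ι ι² M Y m₀ odd-bound even-bound

  ι^-^4 : ∀ n → (ι ^ n) ^ 4 ≡ 1#
  ι^-^4 n = trans (^-assocʳ ι n 4) (trans (cong (ι ^_) (ℕ.*-comm n 4)) (trans (sym (^-assocʳ ι 4 n)) (trans (cong (_^ n) ι^4) (1^ n))))

  -- In `0# ∷ orb bs` the position 1 + 4i + d holds ι^d times entry i of `bs`, where the latest
  -- parameter comes first. This decodes the positions named in `con₁`, `con₂` and `con₃`.
  orb : ∀ {t} → Vec F t → Vec F (t ℕ.* 4)
  orb []       = []
  orb (b ∷ bs) = ι ^ 0 * b ∷ ι ^ 1 * b ∷ ι ^ 2 * b ∷ ι ^ 3 * b ∷ orb bs

  single : ∀ {m} → Fin m → ℕ → Vec ℕ m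
  single {m} j a = Vec.replicate m 0 [ j ]≔ a

  value-single : ∀ {m} (cs : Vec F m) j a x → value (pair cs (single j a)) x ≡ (x + lookup cs j) ^ a
  value-single (c ∷ cs) zero    a x = trans (cong ((x + c) ^ a *_) (value-zero cs x)) (*-identityʳ _)
  value-single (c ∷ cs) (suc j) a x = trans (*-identityˡ _) (value-single cs j a x)

  -- The condition χ (x + c_j) = ι^k, as ι^(3k) is the inverse of ι^k.
  isClass : ∀ {m} → Fin m → ℕ → Condition F m
  isClass j k = condition 4 j (ι ^ (3 ℕ.* k)) (single j 1)

  -- The condition χ (x + c_j) = - χ (x + c_i): the exponent 3 inverts and ι² is -1.
  opposite : ∀ {m} → Fin m → Fin m → Condition F m
  opposite i j = condition 4 j (ι ^ 2) (addMul 1 (single i 1) (single j 3))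

  -- For k = 0 it restricts χ (x + c_i) to ±1, for k = 1 to ±ι.
  square : ∀ {m} → Fin m → ℕ → Condition F m
  square i k = condition 2 i (ι ^ (2 ℕ.* k)) (single i 2)

  -- One of the two values is ±1 and the other ±ι, without deciding which: one binary condition
  -- instead of two.
  product : ∀ {m} → Fin m → Fin m → Condition F m
  product i j = condition 2 i (ι ^ 2) (addMul 1 (single i 2) (single j 2))

  -- Keeps the linear polynomials of later stages distinct and the forms in two different parameters
  -- nonzero.
  Fresh : ∀ {t} → F → Vec F t → Set
  Fresh x bs = x ≢ 0# × (∀ s n → x + ι ^ n * lookup bs s ≢ 0#)

  data Admissible : ∀ {t} → Vec F t → Set where
    []  : Admissible []
    _∷_ : ∀ {t x} {bs : Vec F t} → Fresh x bs → Admissible bs → Admissible (x ∷ bs)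

  cancel-ι^ : ∀ d {x y} → ι ^ d * x ≡ ι ^ d * y → x ≡ y
  cancel-ι^ d = *-cancelˡ (^≢0 d ι≢0)

  orb-nonzero : ∀ {t} {bs : Vec F t} → Admissible bs → All (0# ≢_) (Vec.toList (orb bs))
  orb-nonzero []                  = []
  orb-nonzero ((x≢0 , _) ∷ adm) = nz 0 ∷ nz 1 ∷ nz 2 ∷ nz 3 ∷ orb-nonzero adm
    where
    nz : ∀ d → 0# ≢ ι ^ d * _
    nz d e = *≢0 (^≢0 d ι≢0) x≢0 (sym e)

  orb-distinct : ∀ {t} {bs : Vec F t} → Admissible bs → Unique (Vec.toList (orb bs))
  orb-distinct []                         = []
  orb-distinct {bs = x ∷ bs} (fr@(x≢0 , x+) ∷ adm) =
    (ne 0F 1F (λ ()) ∷ ne 0F 2F (λ ()) ∷ ne 0F 3F (λ ()) ∷ other 0F bs (λ s n → x+ s n)) ∷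
    (ne 1F 2F (λ ()) ∷ ne 1F 3F (λ ()) ∷ other 1F bs (λ s n → x+ s n)) ∷
    (ne 2F 3F (λ ()) ∷ other 2F bs (λ s n → x+ s n)) ∷
    other 3F bs (λ s n → x+ s n) ∷ orb-distinct adm
    where
    ne : ∀ (d d′ : Fin 4) → d ≢ d′ → ι ^ toℕ d * x ≢ ι ^ toℕ d′ * x
    ne d d′ d≢ e = d≢ (ι^-injective d d′ (*-cancelˡ x≢0 (trans (*-comm x _) (trans e (*-comm _ x)))))
    clash : ∀ (d : Fin 4) d′ b → (∀ n → x + ι ^ n * b ≢ 0#) → ι ^ toℕ d * x ≢ ι ^ d′ * b
    clash d d′ b x+b e = x+b (d′ ℕ.+ (4 ∸ toℕ d) ℕ.+ 2) (begin
      x + ι ^ (d′ ℕ.+ (4 ∸ toℕ d) ℕ.+ 2) * b    ≡⟨ cong (x +_) (-ι^ (d′ ℕ.+ (4 ∸ toℕ d)) b) ⟨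
      x + - (ι ^ (d′ ℕ.+ (4 ∸ toℕ d)) * b)      ≡⟨ cong (λ y → x + - y) x≡ ⟨
      x + - x                                   ≡⟨ -‿inverseʳ x ⟩
      0#                                        ∎)
      where
      open ≡-Reasoning
      x≡ : x ≡ ι ^ (d′ ℕ.+ (4 ∸ toℕ d)) * b
      x≡ = cancel-ι^ (toℕ d) (begin
        ι ^ toℕ d * x                                       ≡⟨ e ⟩
        ι ^ d′ * b                                          ≡⟨ cong (_* b) (trans (sym (*-identityˡ _)) (cong (_* ι ^ d′) (trans (sym ι^4) (cong (ι ^_) (sym (ℕ.m+[n∸m]≡n (ℕ.<⇒≤ (Fin.toℕ<n d)))))))) ⟩
        ι ^ (toℕ d ℕ.+ (4 ∸ toℕ d)) * ι ^ d′ * b            ≡⟨ cong (λ y → y * ι ^ d′ * b) (^-homo-* ι (toℕ d) (4 ∸ toℕ d)) ⟩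
        ι ^ toℕ d * ι ^ (4 ∸ toℕ d) * ι ^ d′ * b            ≡⟨ S.solve 4 (λ u v w b → u S.:* v S.:* w S.:* b S.:= u S.:* (w S.:* v S.:* b)) refl (ι ^ toℕ d) (ι ^ (4 ∸ toℕ d)) (ι ^ d′) b ⟩
        ι ^ toℕ d * (ι ^ d′ * ι ^ (4 ∸ toℕ d) * b)          ≡⟨ cong (λ y → ι ^ toℕ d * (y * b)) (^-homo-* ι d′ (4 ∸ toℕ d)) ⟨
        ι ^ toℕ d * (ι ^ (d′ ℕ.+ (4 ∸ toℕ d)) * b)          ∎)
    other : ∀ {t} (d : Fin 4) (bs : Vec F t) → (∀ s n → x + ι ^ n * lookup bs s ≢ 0#) → All (ι ^ toℕ d * x ≢_) (Vec.toList (orb bs))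
    other d []       q = []
    other d (b ∷ bs) q = clash d 0 b (q zero) ∷ clash d 1 b (q zero) ∷ clash d 2 b (q zero) ∷ clash d 3 b (q zero) ∷ other d bs (q ∘ suc)

  fresh : ∀ {t} (bs : Vec F t) x → (∀ j → x + lookup (0# ∷ orb bs) j ≢ 0#) → Fresh x bs
  fresh bs x q = (λ e → q zero (trans (+-identityʳ x) e)) , go bs (q ∘ suc)
    where
    go : ∀ {t} (bs : Vec F t) → (∀ j → x + lookup (orb bs) j ≢ 0#) → ∀ s n → x + ι ^ n * lookup bs s ≢ 0#
    go (b ∷ bs) q (suc s) n = go bs (λ j → q (suc (suc (suc (suc j))))) s n
    go (b ∷ bs) q zero    n e = at (n mod 4) (trans (cong (λ y → x + y * b) (ι^-mod4 n)) e)
      where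
      at : ∀ (d : Fin 4) → x + ι ^ toℕ d * b ≢ 0#
      at 0F = q 0F
      at 1F = q 1F
      at 2F = q 2F
      at 3F = q 3F

  module Step {t} (bs : Vec F t) (adm : Admissible bs) (t≤3 : t ≤ 3) where
    cs : Vec F (suc (t ℕ.* 4))
    cs = 0# ∷ orb bs

    m≤13 : suc (t ℕ.* 4) ≤ 13
    m≤13 = s≤s (ℕ.*-monoˡ-≤ 4 t≤3)

    open Points cs (orb-nonzero adm ∷ orb-distinct adm) (ℕ.≤-trans m≤13 13≤m₀) public

    y : F → Fin (suc (t ℕ.* 4)) → F
    y x j = χ (x + lookup cs j)

    χ-single : ∀ x j a → χ (value (pair cs (single j a)) x) ≡ y x j ^ a
    χ-single x j a = trans (cong χ (value-single cs j a x)) (χ-^ _ a)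

    χ-double : ∀ x i j a b → χ (value (pair cs (addMul 1 (single i a) (single j b))) x) ≡ y x i ^ a * y x j ^ b
    χ-double x i j a b = trans (cong χ (trans (value-addMul cs 1 (single i a) (single j b) x) (cong (value (pair cs (single i a)) x *_) (*-identityʳ _))))
      (trans (χ-* _ _) (cong₂ _*_ (χ-single x i a) (χ-single x j b)))

    Avoids : F → Set
    Avoids x = ∀ j → x + lookup cs j ≢ 0#

    class-sound : ∀ {x} j k → Satisfies x (isClass j k) → y x j ≡ ι ^ k
    class-sound {x} j k e = *-cancelˡ (^≢0 (3 ℕ.* k) ι≢0) (begin
      ι ^ (3 ℕ.* k) * y x j            ≡⟨ cong (ι ^ (3 ℕ.* k) *_) (trans (sym (*-identityʳ _)) (sym (χ-single x j 1))) ⟩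
      ⟦ monomial (isClass j k) ⟧ x     ≡⟨ e ⟩
      1#                               ≡⟨ trans (cong (_^ k) ι^4) (1^ k) ⟨
      (ι ^ 4) ^ k                      ≡⟨ ^-assocʳ ι 4 k ⟩
      ι ^ (k ℕ.+ 3 ℕ.* k)              ≡⟨ cong (ι ^_) (ℕ.+-comm k (3 ℕ.* k)) ⟩
      ι ^ (3 ℕ.* k ℕ.+ k)              ≡⟨ ^-homo-* ι (3 ℕ.* k) k ⟩
      ι ^ (3 ℕ.* k) * ι ^ k            ∎)
      where open ≡-Reasoning

    opposite-sound : ∀ {x} i j → Avoids x → Satisfies x (opposite i j) → y x j ≡ - y x i
    opposite-sound {x} i j av e = sym (begin
      - u                              ≡⟨ trans (sym (-1* u)) (cong (_* u) (sym ι^2)) ⟩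
      ι ^ 2 * u                        ≡⟨ trans (sym (*-identityʳ _)) (cong (ι ^ 2 * u *_) (sym (χ^4 (av j)))) ⟩
      ι ^ 2 * u * v ^ 4                ≡⟨ S.solve 3 (λ a u v → a S.:* u S.:* v S.:^ 4 S.:= a S.:* (u S.:^ 1 S.:* v S.:^ 3) S.:* v) refl (ι ^ 2) u v ⟩
      ι ^ 2 * (u ^ 1 * v ^ 3) * v      ≡⟨ cong (_* v) (trans (cong (ι ^ 2 *_) (sym (χ-double x i j 1 3))) e) ⟩
      1# * v                           ≡⟨ *-identityˡ v ⟩
      v                                ∎)
      where
      open ≡-Reasoning
      u = y x i
      v = y x j

    square-sound : ∀ {x} i k → Satisfies x (square i k) → ι ^ (2 ℕ.* k) * y x i ^ 2 ≡ 1#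
    square-sound {x} i k e = trans (cong (ι ^ (2 ℕ.* k) *_) (sym (χ-single x i 2))) e

    product-sound : ∀ {x} i j → Satisfies x (product i j) → ι ^ 2 * (y x i ^ 2 * y x j ^ 2) ≡ 1#
    product-sound {x} i j e = trans (cong (ι ^ 2 *_) (sym (χ-double x i j 2 2))) e

    solve : ∀ con → Triangular con → All Unit con → All Unit₂ con → index con ≤ 2097152 →
      ∃ λ x → Avoids x × All (Satisfies x) con
    solve con tri u u₂ I≤ = solution con tri u u₂ (enough (index con) n I≤ (ℕ.≤-trans (nonRoots-length cs) (ℕ.+-monoˡ-≤ n m≤13)))

  unit₂ : ∀ k → (ι ^ (2 ℕ.* k)) ^ 2 ≡ 1#
  unit₂ k = trans (^-assocʳ ι (2 ℕ.* k) 2) (trans (cong (ι ^_) (trans (ℕ.*-comm (2 ℕ.* k) 2) (sym (ℕ.*-assoc 2 2 k))))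
    (trans (sym (^-assocʳ ι 4 k)) (trans (cong (_^ k) ι^4) (1^ k))))

  module _ (e r₁ r₂ : ℕ) (sep : Separated e r₁ r₂) (χ1+ι : χ (1# + ι) ≡ ι ^ e) where

    adm₁ : Admissible (1# ∷ [])
    adm₁ = (1≢0 , λ ()) ∷ []

    module S₁ = Step (1# ∷ []) adm₁ (s≤s z≤n)

    -- The parameter at abscissa 1 is normalised to 1; `b₁`, `b₂`, `b₃` belong to 2, 4, 8. A form is
    -- constrained at the stage of its later parameter: here `b₁` itself, two forms of row 1 and the
    -- first pair of row 3. The pivot of `opposite` is the position that the `square` after it
    -- leaves untouched.
    con₁ : List (Condition F 5)
    con₁ = isClass (# 0) 1 ∷ isClass (# 3) r₁ ∷ isClass (# 1) r₂ ∷ opposite (# 2) (# 4) ∷ square (# 2) 0 ∷ []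

    abstract
      sol₁ : ∃ λ x → S₁.Avoids x × All (S₁.Satisfies x) con₁
      sol₁ = S₁.solve con₁ (from-yes (triangular? con₁))
        (ι^-^4 3 ∷ ι^-^4 (3 ℕ.* r₁) ∷ ι^-^4 (3 ℕ.* r₂) ∷ ι^-^4 2 ∷ ι^-^4 0 ∷ [])
        ((λ ()) ∷ (λ ()) ∷ (λ ()) ∷ (λ ()) ∷ (λ _ → unit₂ 0) ∷ [])
        (ℕ.≤ᵇ⇒≤ (index con₁) 2097152 tt)

    b₁ : F
    b₁ = proj₁ sol₁

    adm₂ : Admissible (b₁ ∷ 1# ∷ [])
    adm₂ = fresh (1# ∷ []) b₁ (proj₁ (proj₂ sol₁)) ∷ adm₁

    module S₂ = Step (b₁ ∷ 1# ∷ []) adm₂ (s≤s (s≤s z≤n))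

    -- The first pair of row 3 already has values ±1, so its second pair is sent to ±ι; the rows 5
    -- and 6 receive their first pairs, with values ±1.
    con₂ : List (Condition F 9)
    con₂ = isClass (# 0) 2 ∷ isClass (# 3) (1 ℕ.+ r₁) ∷ isClass (# 1) (1 ℕ.+ r₂) ∷
      opposite (# 7) (# 5) ∷ square (# 7) 1 ∷ opposite (# 6) (# 8) ∷ square (# 6) 0 ∷ opposite (# 2) (# 4) ∷ square (# 2) 0 ∷ []

    abstract
      sol₂ : ∃ λ x → S₂.Avoids x × All (S₂.Satisfies x) con₂
      sol₂ = S₂.solve con₂ (from-yes (triangular? con₂))
        (ι^-^4 6 ∷ ι^-^4 (3 ℕ.* (1 ℕ.+ r₁)) ∷ ι^-^4 (3 ℕ.* (1 ℕ.+ r₂)) ∷ ι^-^4 2 ∷ ι^-^4 2 ∷ ι^-^4 2 ∷ ι^-^4 0 ∷ ι^-^4 2 ∷ ι^-^4 0 ∷ [])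
        ((λ ()) ∷ (λ ()) ∷ (λ ()) ∷ (λ ()) ∷ (λ _ → unit₂ 1) ∷ (λ ()) ∷ (λ _ → unit₂ 0) ∷ (λ ()) ∷ (λ _ → unit₂ 0) ∷ [])
        (ℕ.≤ᵇ⇒≤ (index con₂) 2097152 tt)

    b₂ : F
    b₂ = proj₁ sol₂

    adm₃ : Admissible (b₂ ∷ b₁ ∷ 1# ∷ [])
    adm₃ = fresh (b₁ ∷ 1# ∷ []) b₂ (proj₁ (proj₂ sol₂)) ∷ adm₂

    module S₃ = Step (b₂ ∷ b₁ ∷ 1# ∷ []) adm₃ (s≤s (s≤s (s≤s z≤n)))

    -- The rows 4 and 8 are settled and the rows 5 and 6 completed by pairs with values ±ι. In row 7
    -- both pairs involve `b₃`, so `product` is enough there. Nine conditions of order 4 and three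
    -- of order 2 give the index 2^21.
    con₃ : List (Condition F 13)
    con₃ = isClass (# 0) 3 ∷ isClass (# 3) (2 ℕ.+ r₁) ∷ isClass (# 1) (2 ℕ.+ r₂) ∷
      isClass (# 12) (3 ℕ.+ r₁) ∷ isClass (# 10) (3 ℕ.+ r₂) ∷
      opposite (# 4) (# 2) ∷ square (# 4) 1 ∷ opposite (# 7) (# 5) ∷ square (# 7) 1 ∷
      opposite (# 11) (# 9) ∷ opposite (# 8) (# 6) ∷ product (# 11) (# 8) ∷ []

    abstract
      sol₃ : ∃ λ x → S₃.Avoids x × All (S₃.Satisfies x) con₃
      sol₃ = S₃.solve con₃ (from-yes (triangular? con₃))
        (ι^-^4 9 ∷ ι^-^4 (3 ℕ.* (2 ℕ.+ r₁)) ∷ ι^-^4 (3 ℕ.* (2 ℕ.+ r₂)) ∷ ι^-^4 (3 ℕ.* (3 ℕ.+ r₁)) ∷ ι^-^4 (3 ℕ.* (3 ℕ.+ r₂)) ∷ ι^-^4 2 ∷ ι^-^4 2 ∷ ι^-^4 2 ∷ ι^-^4 2 ∷ ι^-^4 2 ∷ ι^-^4 2 ∷ ι^-^4 2 ∷ [])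
        ((λ ()) ∷ (λ ()) ∷ (λ ()) ∷ (λ ()) ∷ (λ ()) ∷ (λ ()) ∷ (λ _ → unit₂ 1) ∷ (λ ()) ∷ (λ _ → unit₂ 1) ∷ (λ ()) ∷ (λ ()) ∷ (λ _ → unit₂ 1) ∷ [])
        (ℕ.≤ᵇ⇒≤ (index con₃) 2097152 tt)

    b₃ : F
    b₃ = proj₁ sol₃

    b : Fin 4 → F
    b = lookup (1# ∷ b₁ ∷ b₂ ∷ b₃ ∷ [])

    open DifferenceFamily K P R P≡ p≡ ι ι² b using (⟦_⟧; isRelDF; family)

    -- Makes the form monic in the new parameter x; the power of ι split off is invisible to χ.
    link : ∀ c d x a → (c ℕ.+ d) % 4 ≡ 0 → a + ι ^ c * x ≡ ι ^ c * (x + ι ^ d * a)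
    link c d x a z = begin
      a + ι ^ c * x                   ≡⟨ +-comm a _ ⟩
      ι ^ c * x + a                   ≡⟨ cong (ι ^ c * x +_) (trans (sym (*-identityˡ a)) (cong (_* a) (trans (sym (trans (^-mod-4 (c ℕ.+ d) ι^4) (cong (ι ^_) z))) (^-homo-* ι c d)))) ⟩
      ι ^ c * x + ι ^ c * ι ^ d * a   ≡⟨ S.solve 4 (λ u v x a → u S.:* x S.:+ u S.:* v S.:* a S.:= u S.:* (x S.:+ v S.:* a)) refl (ι ^ c) (ι ^ d) x a ⟩
      ι ^ c * (x + ι ^ d * a)         ∎
      where open ≡-Reasoning

    χ-link : ∀ c d x a → (c ℕ.+ d) % 4 ≡ 0 → χ (a + ι ^ c * x) ≡ χ (x + ι ^ d * a)
    χ-link c d x a z = trans (cong χ (link c d x a z)) (trans (χ-* _ _) (trans (cong (_* χ (x + ι ^ d * a)) (χ-ι^ c)) (*-identityˡ _)))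

    double : ∀ n a → a + ι ^ n * a ≡ (1# + ι ^ n) * a
    double n a = sym (trans (distribʳ a 1# (ι ^ n)) (cong (_+ ι ^ n * a) (*-identityˡ a)))

    χ-half : ∀ a k → χ a ≡ ι ^ k → χ (a + ι ^ 1 * a) ≡ ι ^ (e ℕ.+ k)
    χ-half a k q = trans (cong χ (double 1 a)) (trans (χ-* _ a) (trans (cong₂ _*_ (trans (cong (λ z → χ (1# + z)) (*-identityʳ ι)) χ1+ι) q) (sym (^-homo-* ι e k))))

    1+ι≢0 : 1# + ι ^ 1 ≢ 0#
    1+ι≢0 z = 2≢0 (trans (cong (1# +_) (sym (begin
      - 1#            ≡⟨ ι² ⟨
      ι * ι           ≡⟨ cong₂ _*_ ι≡-1 ι≡-1 ⟩
      - 1# * - 1#     ≡⟨ -1*-1 ⟩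
      1#              ∎))) (-‿inverseʳ 1#))
      where
      open ≡-Reasoning
      ι≡-1 : ι ≡ - 1#
      ι≡-1 = sym (+-inverse-unique (begin
        - 1# + - ι    ≡⟨ cong₂ _+_ (-1* 1#) (-1* ι) ⟨
        - 1# * 1# + - 1# * ι ≡⟨ distribˡ (- 1#) 1# ι ⟨
        - 1# * (1# + ι) ≡⟨ cong (λ w → - 1# * (1# + w)) (*-identityʳ ι) ⟨
        - 1# * (1# + ι ^ 1) ≡⟨ trans (cong (- 1# *_) z) (zeroʳ _) ⟩
        0#            ∎))

    b≢0 : ∀ s → b s ≢ 0#
    b≢0 0F = 1≢0
    b≢0 1F with adm₂
    ... | fr ∷ _ = proj₁ fr
    b≢0 2F with adm₃
    ... | fr ∷ _ = proj₁ fr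
    b≢0 3F = proj₁ (fresh (b₂ ∷ b₁ ∷ 1# ∷ []) b₃ (proj₁ (proj₂ sol₃)))

    sums≢0 : ∀ s t → toℕ s < toℕ t → ∀ n → b t + ι ^ n * b s ≢ 0#
    sums≢0 0F 1F _ = proj₂ (fresh (1# ∷ []) b₁ (proj₁ (proj₂ sol₁))) 0F
    sums≢0 0F 2F _ = proj₂ (fresh (b₁ ∷ 1# ∷ []) b₂ (proj₁ (proj₂ sol₂))) 1F
    sums≢0 1F 2F _ = proj₂ (fresh (b₁ ∷ 1# ∷ []) b₂ (proj₁ (proj₂ sol₂))) 0F
    sums≢0 0F 3F _ = proj₂ (fresh (b₂ ∷ b₁ ∷ 1# ∷ []) b₃ (proj₁ (proj₂ sol₃))) 2F
    sums≢0 1F 3F _ = proj₂ (fresh (b₂ ∷ b₁ ∷ 1# ∷ []) b₃ (proj₁ (proj₂ sol₃))) 1F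
    sums≢0 2F 3F _ = proj₂ (fresh (b₂ ∷ b₁ ∷ 1# ∷ []) b₃ (proj₁ (proj₂ sol₃))) 0F
    sums≢0 1F 1F (s≤s ())
    sums≢0 2F 1F (s≤s ())
    sums≢0 3F 1F (s≤s ())
    sums≢0 2F 2F (s≤s (s≤s ()))
    sums≢0 3F 2F (s≤s (s≤s ()))
    sums≢0 3F 3F (s≤s (s≤s (s≤s ())))

    normal≢0 : ∀ f → Normal f → ⟦ f ⟧ ≢ 0#
    normal≢0 (s , nothing)      _          = b≢0 s
    normal≢0 (s , just (t , c)) (inj₁ s<t) = λ z → *≢0 (^≢0 (toℕ c) ι≢0) (sums≢0 s t s<t (4 ∸ toℕ c))
      (trans (sym (link (toℕ c) (4 ∸ toℕ c) (b t) (b s) (complement c))) z)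
    normal≢0 (s , just (_ , 0F)) (inj₂ (refl , _))      = λ z → *≢0 2≢0 (b≢0 s) (trans (sym (double 0 (b s))) z)
    normal≢0 (s , just (_ , 1F)) (inj₂ (refl , _))      = λ z → *≢0 1+ι≢0 (b≢0 s) (trans (sym (double 1 (b s))) z)
    normal≢0 (s , just (_ , suc (suc _))) (inj₂ (refl , s≤s ()))

    exponents-injective : ∀ (f : Fin 4 → Form) (k : Fin 4 → ℕ) → (∀ r → χ ⟦ f r ⟧ ≡ ι ^ k r) →
      (∀ r r′ → k r % 4 ≡ k r′ % 4 → r ≡ r′) → ∀ {r r′} → χ ⟦ f r ⟧ ≡ χ ⟦ f r′ ⟧ → r ≡ r′
    exponents-injective f k f≡ inj {r} {r′} q = inj r r′ (begin
      k r % 4                 ≡⟨ Fin.toℕ-fromℕ< _ ⟨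
      toℕ (k r mod 4)         ≡⟨ cong toℕ (ι^-injective (k r mod 4) (k r′ mod 4) (begin
        ι ^ toℕ (k r mod 4)     ≡⟨ ι^-mod4 (k r) ⟩
        ι ^ k r                 ≡⟨ trans (sym (f≡ r)) (trans q (f≡ r′)) ⟩
        ι ^ k r′                ≡⟨ ι^-mod4 (k r′) ⟨
        ι ^ toℕ (k r′ mod 4)    ∎)) ⟩
      toℕ (k r′ mod 4)        ≡⟨ Fin.toℕ-fromℕ< _ ⟩
      k r′ % 4                ∎)
      where
      open ≡-Reasoning

    -- The last hypothesis says u² w² = -1 for the values u and w at `0F` and `2F`, whereas u² = w²
    -- would make this product u⁴ = 1. So the pairs ±u and ±w are disjoint.
    opposites-injective : ∀ (f : Fin 4 → Form) → (∀ r → ⟦ f r ⟧ ≢ 0#) →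
      χ ⟦ f 1F ⟧ ≡ - χ ⟦ f 0F ⟧ → χ ⟦ f 3F ⟧ ≡ - χ ⟦ f 2F ⟧ →
      ι ^ 2 * (χ ⟦ f 0F ⟧ ^ 2 * χ ⟦ f 2F ⟧ ^ 2) ≡ 1# →
      ∀ {r r′} → χ ⟦ f r ⟧ ≡ χ ⟦ f r′ ⟧ → r ≡ r′
    opposites-injective f f≢0 v≡-u z≡-w squares {r} {r′} = go r r′
      where
      open ≡-Reasoning
      u = χ ⟦ f 0F ⟧
      w = χ ⟦ f 2F ⟧
      negated-square : ∀ a → (- a) ^ 2 ≡ a ^ 2
      negated-square a = trans (cong (_^ 2) (sym (-1* a))) (trans (^-distrib-* (- 1#) a 2)
        (trans (cong (_* a ^ 2) (trans (cong (- 1# *_) (*-identityʳ _)) -1*-1)) (*-identityˡ _)))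
      u²≢w² : u ^ 2 ≢ w ^ 2
      u²≢w² q = 1≢-1 (begin
        1#                        ≡⟨ squares ⟨
        ι ^ 2 * (u ^ 2 * w ^ 2)   ≡⟨ cong₂ _*_ ι^2 (trans (cong (u ^ 2 *_) (sym q)) (trans (sym (^-homo-* u 2 2)) (χ^4 (f≢0 0F)))) ⟩
        - 1# * 1#                 ≡⟨ *-identityʳ _ ⟩
        - 1#                      ∎)
      self : ∀ {a} → a ≢ 0# → a ≢ - a
      self {a} a≢0 q = *≢0 2≢0 a≢0 (trans (distribʳ a 1# 1#) (trans (cong₂ _+_ (*-identityˡ a) (trans (*-identityˡ a) q)) (-‿inverseʳ a)))
      χ≢0 : ∀ r → χ ⟦ f r ⟧ ≢ 0#
      χ≢0 r = ^≢0 P (f≢0 r)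
      u² : ∀ {a} → a ≡ - u → a ^ 2 ≡ u ^ 2
      u² q = trans (cong (_^ 2) q) (negated-square u)
      w² : ∀ {a} → a ≡ - w → a ^ 2 ≡ w ^ 2
      w² q = trans (cong (_^ 2) q) (negated-square w)
      cross : ∀ {a c} → a ^ 2 ≡ u ^ 2 → c ^ 2 ≡ w ^ 2 → a ≢ c
      cross qa qc q = u²≢w² (trans (sym qa) (trans (cong (_^ 2) q) qc))
      go : ∀ r r′ → χ ⟦ f r ⟧ ≡ χ ⟦ f r′ ⟧ → r ≡ r′
      go 0F 0F _ = refl
      go 1F 1F _ = refl
      go 2F 2F _ = refl
      go 3F 3F _ = refl
      go 0F 1F q = ⊥-elim (self (χ≢0 0F) (trans q v≡-u))
      go 1F 0F q = ⊥-elim (self (χ≢0 0F) (trans (sym q) v≡-u))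
      go 2F 3F q = ⊥-elim (self (χ≢0 2F) (trans q z≡-w))
      go 3F 2F q = ⊥-elim (self (χ≢0 2F) (trans (sym q) z≡-w))
      go 0F 2F q = ⊥-elim (cross refl refl q)
      go 2F 0F q = ⊥-elim (cross refl refl (sym q))
      go 0F 3F q = ⊥-elim (cross refl (w² z≡-w) q)
      go 3F 0F q = ⊥-elim (cross refl (w² z≡-w) (sym q))
      go 1F 2F q = ⊥-elim (cross (u² v≡-u) refl q)
      go 2F 1F q = ⊥-elim (cross (u² v≡-u) refl (sym q))
      go 1F 3F q = ⊥-elim (cross (u² v≡-u) (w² z≡-w) q)
      go 3F 1F q = ⊥-elim (cross (u² v≡-u) (w² z≡-w) (sym q))

    private
      sat₁ = proj₂ (proj₂ sol₁)
      sat₂ = proj₂ (proj₂ sol₂)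
      sat₃ = proj₂ (proj₂ sol₃)
      av₁ = proj₁ (proj₂ sol₁)
      av₂ = proj₁ (proj₂ sol₂)
      av₃ = proj₁ (proj₂ sol₃)

      class : ∀ s → χ (b s) ≡ ι ^ toℕ s
      class 0F = 1^ P
      class 1F = trans (cong χ (sym (+-identityʳ b₁))) (S₁.class-sound {b₁} 0F 1 (nth sat₁ (# 0)))
      class 2F = trans (cong χ (sym (+-identityʳ b₂))) (S₂.class-sound {b₂} 0F 2 (nth sat₂ (# 0)))
      class 3F = trans (cong χ (sym (+-identityʳ b₃))) (S₃.class-sound {b₃} 0F 3 (nth sat₃ (# 0)))

      form≢0 : ∀ h r → ⟦ form h r ⟧ ≢ 0#
      form≢0 h r = normal≢0 (form h r) (form-normal h r)

      squares : ∀ {u w} → ι ^ 0 * u ≡ 1# → ι ^ 2 * w ≡ 1# → ι ^ 2 * (u * w) ≡ 1#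
      squares {u} {w} p q = trans (cong (λ z → ι ^ 2 * (z * w)) (trans (sym (*-identityˡ u)) p))
        (trans (cong (ι ^ 2 *_) (*-identityˡ w)) q)

      opp : ∀ c d c′ d′ x a → (c ℕ.+ d) % 4 ≡ 0 → (c′ ℕ.+ d′) % 4 ≡ 0 → χ (x + ι ^ d′ * a) ≡ - χ (x + ι ^ d * a) →
        χ (a + ι ^ c′ * x) ≡ - χ (a + ι ^ c * x)
      opp c d c′ d′ x a z z′ q = trans (χ-link c′ d′ x a z′) (trans q (cong -_ (sym (χ-link c d x a z))))

      sq : ∀ k c d x a → (c ℕ.+ d) % 4 ≡ 0 → ι ^ k * χ (x + ι ^ d * a) ^ 2 ≡ 1# → ι ^ k * χ (a + ι ^ c * x) ^ 2 ≡ 1#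
      sq k c d x a z q = trans (cong (λ y → ι ^ k * y ^ 2) (χ-link c d x a z)) q

      -- Row 0 consists of the doubles of the four parameters, of classes 0 to 3. In the rows 1, 2,
      -- 4, 8 the exponents are known and `sep` applies; the others consist of two opposite pairs.
      rainbow : ∀ h {r r′} → χ ⟦ form h r ⟧ ≡ χ ⟦ form h r′ ⟧ → r ≡ r′
      rainbow 0F {r} {r′} q = ι^-injective r r′ (*-cancelˡ (^≢0 P 2≢0) (trans (sym (doubled r)) (trans q (doubled r′))))
        where
        twice : ∀ s → χ (b s + ι ^ 0 * b s) ≡ χ (1# + 1#) * ι ^ toℕ s
        twice s = trans (cong χ (double 0 (b s))) (trans (χ-* _ (b s)) (cong (χ (1# + 1#) *_) (class s)))
        doubled : ∀ r → χ ⟦ form 0F r ⟧ ≡ χ (1# + 1#) * ι ^ toℕ r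
        doubled 0F = twice 0F
        doubled 1F = twice 1F
        doubled 2F = twice 2F
        doubled 3F = twice 3F
      rainbow 1F = exponents-injective (form 1F) (lookup (0 ∷ r₁ ∷ r₂ ∷ e ℕ.+ 3 ∷ [])) (λ
        { 0F → class 0F
        ; 1F → trans (χ-link 2 2 b₁ 1# refl) (S₁.class-sound {b₁} (# 3) r₁ (nth sat₁ (# 1)))
        ; 2F → trans (χ-link 0 0 b₁ 1# refl) (S₁.class-sound {b₁} (# 1) r₂ (nth sat₁ (# 2)))
        ; 3F → χ-half b₃ 3 (class 3F) }) (sep 0F)
      rainbow 2F = exponents-injective (form 2F) (lookup (1 ∷ e ∷ 1 ℕ.+ r₁ ∷ 1 ℕ.+ r₂ ∷ [])) (λ
        { 0F → class 1F
        ; 1F → trans (χ-half 1# 0 (class 0F)) (cong (ι ^_) (ℕ.+-identityʳ e))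
        ; 2F → trans (χ-link 2 2 b₂ b₁ refl) (S₂.class-sound {b₂} (# 3) (1 ℕ.+ r₁) (nth sat₂ (# 1)))
        ; 3F → trans (χ-link 0 0 b₂ b₁ refl) (S₂.class-sound {b₂} (# 1) (1 ℕ.+ r₂) (nth sat₂ (# 2))) }) (sep 1F)
      rainbow 4F = exponents-injective (form 4F) (lookup (2 ∷ e ℕ.+ 1 ∷ 2 ℕ.+ r₁ ∷ 2 ℕ.+ r₂ ∷ [])) (λ
        { 0F → class 2F
        ; 1F → χ-half b₁ 1 (class 1F)
        ; 2F → trans (χ-link 2 2 b₃ b₂ refl) (S₃.class-sound {b₃} (# 3) (2 ℕ.+ r₁) (nth sat₃ (# 1)))
        ; 3F → trans (χ-link 0 0 b₃ b₂ refl) (S₃.class-sound {b₃} (# 1) (2 ℕ.+ r₂) (nth sat₃ (# 2))) }) (sep 2F)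
      rainbow 8F = exponents-injective (form 8F) (lookup (3 ∷ 3 ℕ.+ r₁ ∷ 3 ℕ.+ r₂ ∷ e ℕ.+ 2 ∷ [])) (λ
        { 0F → class 3F
        ; 1F → trans (χ-link 1 3 b₃ 1# refl) (S₃.class-sound {b₃} (# 12) (3 ℕ.+ r₁) (nth sat₃ (# 3)))
        ; 2F → trans (χ-link 3 1 b₃ 1# refl) (S₃.class-sound {b₃} (# 10) (3 ℕ.+ r₂) (nth sat₃ (# 4)))
        ; 3F → χ-half b₂ 2 (class 2F) }) (sep 3F)
      rainbow 3F = opposites-injective (form 3F) (form≢0 3F)
        (opp 3 1 1 3 b₁ 1# refl refl (S₁.opposite-sound {b₁} (# 2) (# 4) av₁ (nth sat₁ (# 3))))
        (opp 2 2 0 0 b₂ 1# refl refl (S₂.opposite-sound {b₂} (# 7) (# 5) av₂ (nth sat₂ (# 3))))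
        (squares (sq 0 3 1 b₁ 1# refl (S₁.square-sound {b₁} (# 2) 0 (nth sat₁ (# 4)))) (sq 2 2 2 b₂ 1# refl (S₂.square-sound {b₂} (# 7) 1 (nth sat₂ (# 4)))))
      rainbow 5F = opposites-injective (form 5F) (form≢0 5F)
        (opp 3 1 1 3 b₂ 1# refl refl (S₂.opposite-sound {b₂} (# 6) (# 8) av₂ (nth sat₂ (# 5))))
        (opp 1 3 3 1 b₃ b₂ refl refl (S₃.opposite-sound {b₃} (# 4) (# 2) av₃ (nth sat₃ (# 5))))
        (squares (sq 0 3 1 b₂ 1# refl (S₂.square-sound {b₂} (# 6) 0 (nth sat₂ (# 6)))) (sq 2 1 3 b₃ b₂ refl (S₃.square-sound {b₃} (# 4) 1 (nth sat₃ (# 6)))))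
      rainbow 6F = opposites-injective (form 6F) (form≢0 6F)
        (opp 3 1 1 3 b₂ b₁ refl refl (S₂.opposite-sound {b₂} (# 2) (# 4) av₂ (nth sat₂ (# 7))))
        (opp 2 2 0 0 b₃ b₁ refl refl (S₃.opposite-sound {b₃} (# 7) (# 5) av₃ (nth sat₃ (# 7))))
        (squares (sq 0 3 1 b₂ b₁ refl (S₂.square-sound {b₂} (# 2) 0 (nth sat₂ (# 8)))) (sq 2 2 2 b₃ b₁ refl (S₃.square-sound {b₃} (# 7) 1 (nth sat₃ (# 8)))))
      rainbow 7F = opposites-injective (form 7F) (form≢0 7F)
        (opp 2 2 0 0 b₃ 1# refl refl (S₃.opposite-sound {b₃} (# 11) (# 9) av₃ (nth sat₃ (# 9))))
        (opp 1 3 3 1 b₃ b₁ refl refl (S₃.opposite-sound {b₃} (# 8) (# 6) av₃ (nth sat₃ (# 10))))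
        (trans (cong₂ (λ y z → ι ^ 2 * (y ^ 2 * z ^ 2)) (χ-link 2 2 b₃ 1# refl) (χ-link 1 3 b₃ b₁ refl)) (S₃.product-sound {b₃} (# 11) (# 8) (nth sat₃ (# 11))))

    choice : ∃ λ F → IsRelDF 17 p 17 1 F
    choice = family , isRelDF form≢0 rainbow

-- A square root of -1

module _ {p : ℕ} (K : PrimeField p) (P : ℕ) (p≡ : p ≡ suc (4 ℕ.* P)) where
  open FieldFacts K
  open Polynomial K hiding (module P)
  open RootBound K
  open LinearFactors K
  open QuarticCharacter K P p≡

  private
    nonzero : List F
    nonzero = filter (λ x → ¬? (x Fin.≟ 0#)) (allFin p)

    p≤ : p ≤ suc (length nonzero)
    p≤ = subst (_≤ suc (length nonzero)) (List.length-tabulate {n = p} id)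
      (filter-but-one (λ x → ¬? (x Fin.≟ 0#)) (λ {x} {y} q r → trans (stable q) (sym (stable r))) (Unique.allFin⁺ p))
      where
      stable : ∀ {x} → ¬ (x ≢ 0#) → x ≡ 0#
      stable {x} q with x Fin.≟ 0#
      ... | yes r = r
      ... | no ¬r = ⊥-elim (q ¬r)

    0<P : 0 < P
    0<P = go P p≡
      where
      go : ∀ n → p ≡ suc (4 ℕ.* n) → 0 < n
      go zero    e = ⊥-elim (ℕ.<-irrefl (sym e) 1<p)
      go (suc n) _ = s≤s z≤n

    f : Poly
    f = X ^ₚ (P ℕ.* 2) ⊞ (- 1# ∷ [])

    eval-f : ∀ x → eval f x ≡ χ x ^ 2 + - 1#
    eval-f x = trans (eval-⊞ (X ^ₚ (P ℕ.* 2)) _ x) (cong₂ _+_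
      (trans (eval-^ X (P ℕ.* 2) x) (trans (cong (_^ (P ℕ.* 2)) (trans (eval-lin 0# x) (+-identityʳ x))) (sym (^-assocʳ x P 2))))
      (trans (cong (- 1# +_) (zeroʳ x)) (+-identityʳ _)))

    f≉[] : ¬ f ≈ []
    f≉[] e = 1≢0 (trans (sym (-‿involutive 1#)) (trans (cong -_ (trans (sym (+-identityˡ (- 1#))) (trans (cong (_+ - 1#) (sym χ0^2)) (trans (sym (eval-f 0#)) (eval-zero f 0# e))))) -0#≈0#))
      where
      χ0 : ∀ n → 0 < n → 0# ^ n ≡ 0#
      χ0 (suc n) _ = zeroˡ _
      χ0^2 : χ 0# ^ 2 ≡ 0#
      χ0^2 = trans (cong (_^ 2) (χ0 P 0<P)) (zeroˡ _)

  -- If χ x² were 1 for every nonzero x, then X^(2P) - 1 would have 4P roots. Otherwise some χ x has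
  -- the square -1.
  quartic-unit : ∃ λ ι → ι * ι ≡ - 1#
  quartic-unit with any? (λ x → ¬? (χ x ^ 2 Fin.≟ 1#)) nonzero
  ... | yes a = let x , x∈ , q = find a in χ x , root x (proj₂ (∈-filter⁻ (λ x → ¬? (x Fin.≟ 0#)) {v = x} {xs = allFin p} x∈)) q
    where
    root : ∀ x → x ≢ 0# → χ x ^ 2 ≢ 1# → χ x * χ x ≡ - 1#
    root x x≢0 q with square-one {χ x ^ 2} (trans (^-assocʳ (χ x) 2 2) (χ^4 x≢0))
    ... | inj₁ r = ⊥-elim (q r)
    ... | inj₂ r = trans (cong (χ x *_) (sym (*-identityʳ (χ x)))) r
  ... | no ¬a = ⊥-elim (ℕ.<⇒≱ too-few (ℕ.≤-trans bound len))
    where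
    vanish : ∀ {x} → x ∈ nonzero → Vanish 1 f x
    vanish {x} x∈ zero _ with χ x ^ 2 Fin.≟ 1#
    ... | yes r = trans (eval-f x) (trans (cong (_+ - 1#) r) (-‿inverseʳ 1#))
    ... | no ¬r = ⊥-elim (¬a (lose x∈ ¬r))
    vanish x∈ (suc l) (s≤s ())
    bound : length nonzero ≤ length f
    bound = subst (_≤ length f) (ℕ.*-identityʳ (length nonzero))
      (rootBound 1 nonzero f (Unique.filter⁺ (λ x → ¬? (x Fin.≟ 0#)) (Unique.allFin⁺ p)) (ℕ.<⇒≤ 1<p) vanish f≉[])
    len : length f ≤ suc (P ℕ.* 2)
    len = length-⊞ (X ^ₚ (P ℕ.* 2)) _ (deg-lin-^ 0# (P ℕ.* 2)) (s≤s z≤n)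
    too-few : suc (P ℕ.* 2) < length nonzero
    too-few = ℕ.≤-trans (s≤s (s≤s (ℕ.≤-refl))) (ℕ.≤-trans (ℕ.≤-trans
      (ℕ.+-monoˡ-≤ (P ℕ.* 2) (ℕ.*-monoˡ-≤ 2 0<P))
      (ℕ.≤-reflexive (+-*-Solver.solve 1 (λ P → P :* con 2 :+ P :* con 2 := con 4 :* P) refl P)))
      (ℕ.≤-pred (subst (_≤ suc (length nonzero)) p≡ p≤)))
      where open +-*-Solver using (_:+_; _:*_; _:=_; con)

module _ {p : ℕ} (K : PrimeField p) (P R : ℕ) (P≡ : P ≡ 4 ℕ.* R) (p≡ : p ≡ suc (4 ℕ.* P))
  (M Y m₀ : ℕ) (odd-bound : QuarticCharacter.OddBound K P p≡ M Y m₀) (even-bound : QuarticCharacter.EvenBound K P p≡ M Y m₀)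
  (13≤m₀ : 13 ≤ m₀)
  (enough : ∀ I n → I ≤ 2097152 → p ≤ 13 ℕ.+ n → I ℕ.* (2 ℕ.* Y) < I ℕ.* (M ℕ.* n) ℕ.+ 2 ℕ.* Y) where
  open FieldFacts K
  open QuarticCharacter K P p≡

  family-from-bounds : ∃ λ F → IsRelDF 17 p 17 1 F
  family-from-bounds = go (quartic-unit K P p≡)
    where
    go : (∃ λ ι → ι * ι ≡ - 1#) → ∃ λ F → IsRelDF 17 p 17 1 F
    go (ι , ι²) = by-class (QU.fourth-root-index (χ^4 1+ι≢0))
      where
      module QU = QuarticUnit K P R P≡ p≡ ι ι²
      choose = Choice.choice K P R P≡ p≡ M Y m₀ odd-bound even-bound 13≤m₀ enough
      ι′ = - ι
      ι′² : ι′ * ι′ ≡ - 1#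
      ι′² = trans (sym (-‿distribˡ-* ι (- ι))) (trans (cong -_ (sym (-‿distribʳ-* ι ι))) (trans (-‿involutive _) ι²))
      1+ι≢0 : 1# + ι ≢ 0#
      1+ι≢0 z = 1≢-1 (trans (sym -1*-1) (trans (cong₂ _*_ -1≡ι -1≡ι) ι²))
        where
        -1≡ι : - 1# ≡ ι
        -1≡ι = sym (trans (sym (+-identityˡ ι)) (trans (cong (_+ ι) (sym (-‿inverseˡ 1#))) (trans (+-assoc (- 1#) 1# ι) (trans (cong (- 1# +_) z) (+-identityʳ _)))))
      -- Replacing ι by - ι fixes χ (1 + ι) and inverts exponents, so the exponent 1 can be avoided.
      by-class : (∃ λ (k : Fin 4) → χ (1# + ι) ≡ ι ^ toℕ k) → ∃ λ F → IsRelDF 17 p 17 1 F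
      by-class (0F , q) = choose ι ι² 0 1 2 (from-yes (separated? 0 1 2)) q
      by-class (2F , q) = choose ι ι² 2 2 3 (from-yes (separated? 2 2 3)) q
      by-class (3F , q) = choose ι ι² 3 1 3 (from-yes (separated? 3 1 3)) q
      by-class (1F , q) = choose ι′ ι′² 3 1 3 (from-yes (separated? 3 1 3)) (begin
        χ (1# + ι′)           ≡⟨ cong χ 1+ι′≡ ⟩
        χ (ι′ * (1# + ι))     ≡⟨ χ-* ι′ _ ⟩
        χ ι′ * χ (1# + ι)     ≡⟨ cong₂ _*_ (QuarticUnit.χ-ι K P R P≡ p≡ ι′ ι′²) q ⟩
        1# * (ι * 1#)         ≡⟨ trans (*-identityˡ _) (*-identityʳ ι) ⟩
        ι                     ≡⟨ -‿involutive ι ⟨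
        - ι′                  ≡⟨ -1* ι′ ⟨
        - 1# * ι′             ≡⟨ cong (_* ι′) ι′² ⟨
        ι′ * ι′ * ι′          ≡⟨ S.solve 1 (λ x → x S.:* x S.:* x S.:= x S.:^ 3) refl ι′ ⟩
        ι′ ^ 3                ∎)
        where
        open ≡-Reasoning
        1+ι′≡ : 1# + ι′ ≡ ι′ * (1# + ι)
        1+ι′≡ = sym (trans (distribˡ ι′ 1# ι) (trans (cong₂ _+_ (*-identityʳ ι′) (trans (sym (-‿distribˡ-* ι ι)) (trans (cong -_ ι²) (-‿involutive 1#)))) (+-comm ι′ 1#)))

-- Since N + c = o J, the terms with factor A cancel except for c A, which has to pay for the
-- remaining equations.
unknowns-suffice : ∀ N J A c o m → N ℕ.+ c ≡ o ℕ.* J → N ℕ.* (J ℕ.+ N ℕ.* m) < c ℕ.* A → N ℕ.* (J ℕ.+ A ℕ.+ N ℕ.* m) < o ℕ.* J ℕ.* A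
unknowns-suffice N J A c o m e q = begin-strict
  N ℕ.* (J ℕ.+ A ℕ.+ N ℕ.* m)             ≡⟨ solve 4 (λ N J A X → N :* (J :+ A :+ X) := N :* A :+ N :* (J :+ X)) refl N J A (N ℕ.* m) ⟩
  N ℕ.* A ℕ.+ N ℕ.* (J ℕ.+ N ℕ.* m)       <⟨ ℕ.+-monoʳ-< (N ℕ.* A) q ⟩
  N ℕ.* A ℕ.+ c ℕ.* A                     ≡⟨ ℕ.*-distribʳ-+ A N c ⟨
  (N ℕ.+ c) ℕ.* A                         ≡⟨ cong (ℕ._* A) e ⟩
  o ℕ.* J ℕ.* A                           ∎
  where
  open ℕ.≤-Reasoning
  open +-*-Solver

-- Here 2Y = q (M + 130), with 130 = 52 + 2 · 39: 52 is the shortfall of M against 2J and 39 = 3 ·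
-- 13 comes from the degrees. Each of the I sums may thus lose 130 q, and 13 M more for the excluded
-- roots; c q covers the latter. The total must stay below the gain 2Y of the trivial character.
main-term-dominates : ∀ q J M c L → M ℕ.+ 52 ≡ 2 ℕ.* J → L ℕ.* 130 ℕ.+ c ≤ M → 13 ℕ.* L ℕ.* M < c ℕ.* q →
  ∀ I n → I ≤ L → q ≤ 13 ℕ.+ n → I ℕ.* (2 ℕ.* (q ℕ.* (J ℕ.+ 39))) < I ℕ.* (M ℕ.* n) ℕ.+ 2 ℕ.* (q ℕ.* (J ℕ.+ 39))
main-term-dominates q J M c L e small₁ small₂ I n I≤L q≤ = begin-strict
  I ℕ.* (2 ℕ.* (q ℕ.* (J ℕ.+ 39)))                          ≡⟨ cong (I ℕ.*_) 2Y≡ ⟩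
  I ℕ.* (q ℕ.* (M ℕ.+ 130))                                 ≡⟨ solve 3 (λ I q M → I :* (q :* (M :+ con 130)) := I :* M :* q :+ I :* con 130 :* q) refl I q M ⟩
  I ℕ.* M ℕ.* q ℕ.+ I ℕ.* 130 ℕ.* q                         ≤⟨ ℕ.+-mono-≤ (ℕ.*-monoʳ-≤ (I ℕ.* M) q≤) (ℕ.*-monoˡ-≤ q (ℕ.*-monoˡ-≤ 130 I≤L)) ⟩
  I ℕ.* M ℕ.* (13 ℕ.+ n) ℕ.+ L ℕ.* 130 ℕ.* q                ≡⟨ solve 4 (λ I M n X → I :* M :* (con 13 :+ n) :+ X := I :* (M :* n) :+ (con 13 :* I :* M :+ X)) refl I M n (L ℕ.* 130 ℕ.* q) ⟩
  I ℕ.* (M ℕ.* n) ℕ.+ (13 ℕ.* I ℕ.* M ℕ.+ L ℕ.* 130 ℕ.* q)  <⟨ ℕ.+-monoʳ-< (I ℕ.* (M ℕ.* n)) (begin-strict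
      13 ℕ.* I ℕ.* M ℕ.+ L ℕ.* 130 ℕ.* q    ≤⟨ ℕ.+-monoˡ-≤ (L ℕ.* 130 ℕ.* q) (ℕ.*-monoˡ-≤ M (ℕ.*-monoʳ-≤ 13 I≤L)) ⟩
      13 ℕ.* L ℕ.* M ℕ.+ L ℕ.* 130 ℕ.* q    <⟨ ℕ.+-monoˡ-< (L ℕ.* 130 ℕ.* q) small₂ ⟩
      c ℕ.* q ℕ.+ L ℕ.* 130 ℕ.* q           ≡⟨ solve 3 (λ c q X → c :* q :+ X :* q := (X :+ c) :* q) refl c q (L ℕ.* 130) ⟩
      (L ℕ.* 130 ℕ.+ c) ℕ.* q               ≤⟨ ℕ.*-monoˡ-≤ q small₁ ⟩
      M ℕ.* q                               ≤⟨ ℕ.*-monoˡ-≤ q (ℕ.m≤m+n M 130) ⟩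
      (M ℕ.+ 130) ℕ.* q                     ≡⟨ ℕ.*-comm _ q ⟩
      q ℕ.* (M ℕ.+ 130)                     ∎) ⟩
  I ℕ.* (M ℕ.* n) ℕ.+ q ℕ.* (M ℕ.+ 130)                     ≡⟨ cong (I ℕ.* (M ℕ.* n) ℕ.+_) 2Y≡ ⟨
  I ℕ.* (M ℕ.* n) ℕ.+ 2 ℕ.* (q ℕ.* (J ℕ.+ 39))              ∎
  where
  open ℕ.≤-Reasoning
  open +-*-Solver
  2Y≡ : 2 ℕ.* (q ℕ.* (J ℕ.+ 39)) ≡ q ℕ.* (M ℕ.+ 130)
  2Y≡ = trans (solve 2 (λ q J → con 2 :* (q :* (J :+ con 39)) := q :* (con 2 :* J :+ con 78)) refl q J)
    (cong (q ℕ.*_) (trans (cong (ℕ._+ 78) (sym e)) (ℕ.+-assoc M 52 78)))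

-- The parameter A of Stepanov's bound is taken as P - J or 2P - J and grows with q. The number b
-- bounds both from below, so the inequalities on the size of the linear systems involve constants
-- only.
family-from-constants : ∀ {q} → Prime q → ∀ R → q ≡ suc (4 ℕ.* (4 ℕ.* R)) → ∀ J M b c L →
  2 ℕ.* M ℕ.+ 104 ≡ 4 ℕ.* J → M ℕ.+ 52 ≡ 2 ℕ.* J → 0 < b → b ℕ.+ J ≤ 4 ℕ.* R →
  (2 ℕ.* M) ℕ.* (J ℕ.+ (2 ℕ.* M) ℕ.* 13) < 104 ℕ.* b → M ℕ.* (J ℕ.+ M ℕ.* 13) < 52 ℕ.* b →
  2 ℕ.* M ≤ q → L ℕ.* 130 ℕ.+ c ≤ M → 13 ℕ.* L ℕ.* M < c ℕ.* q → L ≡ 2097152 →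
  ∃ λ F → IsRelDF 17 q 17 1 F
family-from-constants {q} pr R q≡ J M b c L e₄ e₂ 0<b b+J≤P u₄ u₂ 2M≤q small₁ small₂ refl =
  family-from-bounds K P R refl q≡ M Y 13 count-odd count-even ℕ.≤-refl (main-term-dominates q J M c L e₂ small₁ small₂)
  where
  K = primeField pr
  P = 4 ℕ.* R
  b≤A₄ : b ≤ P ∸ J
  b≤A₄ = subst (_≤ P ∸ J) (ℕ.m+n∸n≡m b J) (ℕ.∸-monoˡ-≤ J b+J≤P)
  b≤A₂ : b ≤ 2 ℕ.* P ∸ J
  b≤A₂ = ℕ.≤-trans b≤A₄ (ℕ.∸-monoˡ-≤ J (ℕ.m≤m+n P _))
  J≤P : J ≤ P
  J≤P = ℕ.≤-trans (ℕ.m≤n+m J b) b+J≤P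
  open QuarticCharacter.Counting K P q≡ J M 13 (P ∸ J) (2 ℕ.* P ∸ J)
    (ℕ.>-nonZero (ℕ.<-≤-trans 0<b b≤A₄)) (ℕ.>-nonZero (ℕ.<-≤-trans 0<b b≤A₂))
    (ℕ.>-nonZero (ℕ.<-≤-trans 0<b (ℕ.≤-trans (ℕ.m≤m+n b J) b+J≤P)))
    (ℕ.≤-reflexive (ℕ.m∸n+n≡m J≤P)) (ℕ.≤-reflexive (ℕ.m∸n+n≡m (ℕ.≤-trans J≤P (ℕ.m≤m+n P _))))
    (unknowns-suffice (2 ℕ.* M) J (P ∸ J) 104 4 13 e₄ (ℕ.<-≤-trans u₄ (ℕ.*-monoʳ-≤ 104 b≤A₄)))
    (unknowns-suffice M J (2 ℕ.* P ∸ J) 52 2 13 e₂ (ℕ.<-≤-trans u₂ (ℕ.*-monoʳ-≤ 52 b≤A₂)))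
    2M≤q

-- 2M falls short of 4J just enough for the linear system to be underdetermined, while 2Y - M q stays below M q / 2^21.
large-prime : ∀ {q} → Prime q → ∀ R → q ≡ suc (4 ℕ.* (4 ℕ.* R)) → GtQ 4 13 q → ∃ λ F → IsRelDF 17 q 17 1 F
large-prime {q} pr R q≡ (c<q , gt) = family-from-constants pr R q≡
  -- These are J, M = 2J - 52, b, c, L. The error terms force J above about 130 · 2^20, or 1.37 ·
  -- 10^8; the linear system of order 4 forces it below about 0.35 times the square root of q, or
  -- 2.05 · 10^8 at the threshold. b is (U² - 1) / 4 - J, and c is part of what M leaves above 130 ·
  -- 2^21.
  200000000 399999948 86201711711239680 100000000 2097152
  refl refl (≤-by-computation tt) b+J≤P (≤-by-computation tt) (≤-by-computation tt)
  (ℕ.≤-trans (≤-by-computation {799999896} {344806847644958721} tt) (ℕ.<⇒≤ U²<q)) (≤-by-computation tt)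
  (ℕ.<-≤-trans (≤-by-computation {suc (13 ℕ.* 2097152 ℕ.* 399999948)} {100000000 ℕ.* 344806847644958721} tt) (ℕ.*-monoʳ-≤ 100000000 (ℕ.<⇒≤ U²<q))) refl
  where
  ≤-by-computation : ∀ {m n} → Bool.T (m ℕ.≤ᵇ n) → m ≤ n
  ≤-by-computation {m} {n} = ℕ.≤ᵇ⇒≤ m n
  d = 4 ℕ.^ 12 ℕ.* 13
  -- 344806847644958721 is the square of U 4 13 = 587202561.
  U²<q : 344806847644958721 < q
  U²<q = ℕ.*-cancelʳ-< q 344806847644958721 q (ℕ.<-≤-trans gt (ℕ.*-mono-≤ (ℕ.m∸n≤m q d) (ℕ.m∸n≤m q d)))
  b+J≤P : 86201711711239680 ℕ.+ 200000000 ≤ 4 ℕ.* R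
  b+J≤P = ℕ.*-cancelˡ-≤ 4 (ℕ.≤-pred (subst (_ ≤_) q≡ (ℕ.<⇒≤ U²<q)))

-- Small primes

-- Square-and-multiply with a bound f on the number of binary digits of the exponent.
powMod : (q : ℕ) .{{_ : NonZero q}} → ℕ → ℕ → ℕ → ℕ
powMod q zero    x n = 1
powMod q (suc f) x n = (if does (n % 2 ℕ.≟ 0) then 1 else x) ℕ.* powMod q f (x ℕ.* x % q) (n / 2) % q

module _ {p : ℕ} (K : PrimeField p) where
  open FieldFacts K

  embed : ℕ → F
  embed n = n · 1#

  embed-% : ∀ n → embed (n % p) ≡ embed n
  embed-% n = Fin.toℕ-injective (trans (toℕ-·1 (n % p)) (trans (m%n%n≡m%n n p) (sym (toℕ-·1 n))))

  embed-* : ∀ m n → embed (m ℕ.* n) ≡ embed m * embed n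
  embed-* = ·1-homo-*

  embed-+ : ∀ m n → embed (m ℕ.+ n) ≡ embed m + embed n
  embed-+ = ·-homo-+ 1#

  embed-^ : ∀ m n → embed (m ℕ.^ n) ≡ embed m ^ n
  embed-^ m zero    = +-identityʳ 1#
  embed-^ m (suc n) = trans (embed-* m (m ℕ.^ n)) (cong (embed m *_) (embed-^ m n))

  embed-powMod : ∀ f x n → n < 2 ℕ.^ f → embed (powMod p f x n) ≡ embed x ^ n
  embed-powMod zero    x zero _ = +-identityʳ 1#
  embed-powMod zero    x (suc n) (s≤s ())
  embed-powMod (suc f) x n n< = begin
    embed (c ℕ.* powMod p f (x ℕ.* x % p) (n / 2) % p)        ≡⟨ trans (embed-% _) (embed-* c _) ⟩
    embed c * embed (powMod p f (x ℕ.* x % p) (n / 2))        ≡⟨ cong₂ _*_ c≡ (embed-powMod f (x ℕ.* x % p) (n / 2) (m<n*o⇒m/o<n {n} {2 ℕ.^ f} {2} (subst (n <_) (ℕ.*-comm 2 (2 ℕ.^ f)) n<))) ⟩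
    embed x ^ (n % 2) * embed (x ℕ.* x % p) ^ (n / 2)         ≡⟨ cong (λ y → embed x ^ (n % 2) * y ^ (n / 2)) (trans (embed-% _) (trans (embed-* x x) (cong (embed x *_) (sym (*-identityʳ _))))) ⟩
    embed x ^ (n % 2) * (embed x ^ 2) ^ (n / 2)               ≡⟨ cong (embed x ^ (n % 2) *_) (^-assocʳ (embed x) 2 (n / 2)) ⟩
    embed x ^ (n % 2) * embed x ^ (2 ℕ.* (n / 2))             ≡⟨ ^-homo-* (embed x) (n % 2) _ ⟨
    embed x ^ (n % 2 ℕ.+ 2 ℕ.* (n / 2))                       ≡⟨ cong (λ k → embed x ^ (n % 2 ℕ.+ k)) (ℕ.*-comm 2 (n / 2)) ⟩
    embed x ^ (n % 2 ℕ.+ n / 2 ℕ.* 2)                         ≡⟨ cong (embed x ^_) (m≡m%n+[m/n]*n n 2) ⟨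
    embed x ^ n                                               ∎
    where
    open ≡-Reasoning
    c = if does (n % 2 ℕ.≟ 0) then 1 else x
    c≡ : embed c ≡ embed x ^ (n % 2)
    c≡ = go (n % 2) (m%n<n n 2)
      where
      go : ∀ r → r < 2 → embed (if does (r ℕ.≟ 0) then 1 else x) ≡ embed x ^ r
      go 0 _ = +-identityʳ 1#
      go 1 _ = sym (*-identityʳ (embed x))
      go (suc (suc r)) (s≤s (s≤s ()))

formValue : ℕ → Vec ℕ 4 → Form → ℕ
formValue i b (s , nothing)      = lookup b s
formValue i b (s , just (t , c)) = lookup b s ℕ.+ i ℕ.^ toℕ c ℕ.* lookup b t

-- The exponent is P = 4R; twelve binary digits suffice since q stays below 10^4.
quarticResidue : (q R : ℕ) .{{_ : NonZero q}} → ℕ → ℕ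
quarticResidue q R x = powMod q 12 (x % q) (4 ℕ.* R)

Certificate : (q R : ℕ) .{{_ : NonZero q}} → ℕ → Vec ℕ 4 → Set
Certificate q R i b = suc (i ℕ.* i) % q ≡ 0 × 4 ℕ.* R < 2 ℕ.^ 12 ×
  ∀ h r → ρ h r ≢ 0 × ∀ r′ → ρ h r ≡ ρ h r′ → r ≡ r′
  where
  ρ : Fin 9 → Fin 4 → ℕ
  ρ h r = quarticResidue q R (formValue i b (form h r)) % q

certificate? : ∀ q R .{{_ : NonZero q}} i b → Dec (Certificate q R i b)
certificate? q R i b = suc (i ℕ.* i) % q ℕ.≟ 0 ×-dec 4 ℕ.* R ℕ.<? 2 ℕ.^ 12 ×-dec
  Fin.all? λ h → Fin.all? λ r → ¬? (_ ℕ.≟ 0) ×-dec Fin.all? λ r′ → _ ℕ.≟ _ →-dec r Fin.≟ r′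

certified-prime : ∀ {q} (pr : Prime q) R .{{_ : NonZero q}} → q ≡ suc (4 ℕ.* (4 ℕ.* R)) → ∀ i b → Certificate q R i b →
  ∃ λ F → IsRelDF 17 q 17 1 F
certified-prime {q} pr R {{q≢0}} q≡ i b (i² , R< , distinct) = family , isRelDF form≢0 rainbow
  where
  K = primeField pr
  open FieldFacts K hiding (p≢0)
  e : ℕ → F
  e = embed K
  ι² : e i * e i ≡ - 1#
  ι² = trans (sym (embed-* K i i)) (+-inverse-unique (trans (cong (e (i ℕ.* i) +_) (-‿involutive 1#)) (trans (+-comm _ 1#)
    (toℕ≡0 (trans (toℕ-·1 (suc (i ℕ.* i))) i²)))))
  open QuarticCharacter K (4 ℕ.* R) q≡ using (χ)
  open DifferenceFamily K (4 ℕ.* R) R refl q≡ (e i) ι² (e ∘ lookup b)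
  value≡ : ∀ f → ⟦ f ⟧ ≡ e (formValue i b f)
  value≡ (s , nothing)      = refl
  value≡ (s , just (t , c)) = sym (trans (embed-+ K (lookup b s) _) (cong (e (lookup b s) +_)
    (trans (embed-* K (i ℕ.^ toℕ c) (lookup b t)) (cong (_* e (lookup b t)) (embed-^ K i (toℕ c))))))
  residue≡ : ∀ f → toℕ (χ ⟦ f ⟧) ≡ quarticResidue q R {{q≢0}} (formValue i b f) % q
  residue≡ f = trans (cong toℕ (begin
    χ ⟦ f ⟧                                              ≡⟨ cong χ (trans (value≡ f) (sym (embed-% K (formValue i b f)))) ⟩
    e (formValue i b f % q) ^ (4 ℕ.* R)                  ≡⟨ embed-powMod K 12 (formValue i b f % q) (4 ℕ.* R) R< ⟨
    e (quarticResidue q R {{q≢0}} (formValue i b f))             ∎)) (toℕ-·1 (quarticResidue q R {{q≢0}} (formValue i b f)))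
    where open ≡-Reasoning
  form≢0 : ∀ h r → ⟦ form h r ⟧ ≢ 0#
  form≢0 h r z = proj₁ (distinct h r) (trans (sym (residue≡ (form h r))) (trans (cong (toℕ ∘ χ) z) (trans (cong toℕ χ0) toℕ-0#)))
    where
    positive : ∀ n → q ≡ suc (4 ℕ.* n) → 0# ^ n ≡ 0#
    positive zero    e = ⊥-elim (ℕ.<-irrefl (sym e) 1<p)
    positive (suc n) _ = zeroˡ _
    χ0 : χ 0# ≡ 0#
    χ0 = positive (4 ℕ.* R) q≡
  rainbow : ∀ h {r r′} → χ ⟦ form h r ⟧ ≡ χ ⟦ form h r′ ⟧ → r ≡ r′
  rainbow h {r} {r′} z = proj₂ (distinct h r) r′ (trans (sym (residue≡ (form h r))) (trans (cong toℕ z) (residue≡ (form h r′))))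

-- Entries (q , i , x , y , z) with i² ≡ -1 modulo q, found by computer search; the block has
-- b₁ , b₂ , b₄ , b₈ = 1 , x , y , z.
Entry : Set
Entry = ℕ × ℕ × ℕ × ℕ × ℕ

table : List Entry
table =
  (881 , 387 , 222 , 219 , 163) ∷ (1297 , 1261 , 258 , 622 , 164) ∷ (1601 , 1561 , 71 , 194 , 431) ∷
  (1873 , 737 , 159 , 813 , 80) ∷ (2017 , 229 , 181 , 530 , 329) ∷ (2129 , 372 , 77 , 267 , 785) ∷
  (2657 , 2494 , 147 , 590 , 888) ∷ (2753 , 1959 , 525 , 344 , 490) ∷ (2801 , 1258 , 538 , 851 , 877) ∷
  (2897 , 1777 , 369 , 1443 , 448) ∷ (3089 , 2696 , 288 , 1443 , 923) ∷ (3121 , 79 , 209 , 874 , 101) ∷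
  (3217 , 1781 , 606 , 365 , 467) ∷ (3313 , 2906 , 248 , 1069 , 1046) ∷ (3361 , 900 , 262 , 523 , 351) ∷
  (3617 , 1234 , 66 , 1047 , 48) ∷ (3697 , 1131 , 879 , 1105 , 85) ∷ (3761 , 604 , 73 , 621 , 1639) ∷
  (3793 , 803 , 269 , 294 , 567) ∷ (3889 , 454 , 274 , 1028 , 198) ∷ (4001 , 3102 , 146 , 1776 , 1122) ∷
  (4049 , 884 , 68 , 1367 , 1513) ∷ (4129 , 3234 , 638 , 120 , 1941) ∷ (4241 , 1044 , 434 , 189 , 417) ∷
  (4273 , 1200 , 226 , 1157 , 593) ∷ (4289 , 3761 , 11 , 1825 , 2099) ∷ (4481 , 276 , 30 , 425 , 1464) ∷
  (4561 , 2356 , 773 , 1986 , 358) ∷ (4657 , 1912 , 553 , 104 , 2261) ∷ (4721 , 1697 , 369 , 1186 , 1317) ∷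
  (4801 , 3398 , 184 , 1131 , 2392) ∷ (4817 , 1291 , 34 , 1298 , 2241) ∷ (4993 , 158 , 12 , 284 , 172) ∷
  (5009 , 4470 , 411 , 1034 , 1791) ∷ (5233 , 2253 , 76 , 1547 , 1466) ∷ (5281 , 1673 , 231 , 387 , 1576) ∷
  (5297 , 2313 , 24 , 2310 , 1615) ∷ (5393 , 665 , 233 , 560 , 190) ∷ (5441 , 2452 , 59 , 1677 , 2076) ∷
  (5521 , 4756 , 123 , 1147 , 1428) ∷ (5569 , 973 , 74 , 147 , 2017) ∷ (5857 , 4547 , 838 , 2581 , 1668) ∷
  (5953 , 3550 , 275 , 8 , 2412) ∷ (6113 , 5024 , 124 , 1654 , 1805) ∷ (6257 , 1584 , 946 , 3034 , 1728) ∷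
  (6337 , 178 , 39 , 1400 , 1118) ∷ (6449 , 1854 , 76 , 2724 , 410) ∷ (6529 , 4218 , 91 , 2933 , 2796) ∷
  (6673 , 4236 , 292 , 700 , 559) ∷ (6689 , 3930 , 46 , 2082 , 2431) ∷ (6737 , 4344 , 183 , 2479 , 1308) ∷
  (6833 , 1307 , 70 , 2512 , 2720) ∷ (6961 , 344 , 453 , 644 , 1497) ∷ (6977 , 2063 , 57 , 1070 , 2512) ∷
  (7057 , 6973 , 86 , 339 , 2992) ∷ (7121 , 6343 , 475 , 3283 , 2700) ∷ (7297 , 3553 , 461 , 3577 , 1109) ∷
  (7393 , 2361 , 260 , 3276 , 3348) ∷ (7457 , 1275 , 330 , 3048 , 178) ∷ (7489 , 5898 , 56 , 3196 , 3094) ∷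
  (7537 , 6488 , 57 , 1709 , 2876) ∷ (7649 , 5286 , 376 , 2176 , 280) ∷ (7681 , 3383 , 535 , 798 , 1420) ∷
  (7793 , 2214 , 20 , 3798 , 349) ∷ (7841 , 198 , 23 , 3361 , 2981) ∷ (7873 , 3590 , 504 , 1588 , 3162) ∷
  (7937 , 1962 , 276 , 3325 , 3694) ∷ (8017 , 6204 , 114 , 510 , 2634) ∷ (8081 , 3940 , 228 , 693 , 2240) ∷
  (8161 , 7959 , 95 , 1081 , 2262) ∷ (8209 , 6270 , 45 , 129 , 4075) ∷ (8273 , 2162 , 14 , 72 , 1481) ∷
  (8353 , 2688 , 604 , 508 , 321) ∷ (8369 , 666 , 55 , 2702 , 1591) ∷ (8513 , 7310 , 44 , 1093 , 1474) ∷
  (8609 , 1830 , 36 , 439 , 92) ∷ (8641 , 7058 , 555 , 3427 , 287) ∷ (8689 , 4628 , 334 , 1933 , 3002) ∷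
  (8737 , 4473 , 254 , 596 , 4239) ∷ (8753 , 2569 , 177 , 4276 , 385) ∷ (8849 , 2994 , 93 , 4021 , 3489) ∷
  (8929 , 3424 , 276 , 424 , 3300) ∷ (9041 , 6757 , 418 , 3066 , 2234) ∷ (9137 , 7851 , 10 , 25 , 1519) ∷
  (9281 , 8695 , 68 , 4034 , 2811) ∷ (9377 , 6529 , 233 , 1884 , 850) ∷ (9473 , 1172 , 24 , 177 , 3521) ∷
  (9521 , 2140 , 42 , 529 , 73) ∷ (9601 , 9197 , 155 , 254 , 2108) ∷ (9649 , 845 , 28 , 2719 , 1423) ∷
  (9697 , 1557 , 47 , 2263 , 3602) ∷ (9857 , 222 , 218 , 4803 , 4412) ∷
  []

ValidEntry : Entry → Set
ValidEntry (zero , _)                    = ⊥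
ValidEntry (q@(suc _) , i , x , y , z) = Certificate q (q / 16) i (1 ∷ x ∷ y ∷ z ∷ [])

validEntry? : ∀ t → Dec (ValidEntry t)
validEntry? (zero , _)                  = no λ ()
validEntry? (q@(suc _) , i , x , y , z) = certificate? q (q / 16) i (1 ∷ x ∷ y ∷ z ∷ [])

abstract
  table-valid : All ValidEntry table
  table-valid = from-yes (all? validEntry? table)

InTable : ℕ → Set
InTable q = Any (λ t → proj₁ t ≡ q) table

inTable? : ∀ q → Dec (InTable q)
inTable? q = any? (λ t → proj₁ t ℕ.≟ q) table

divide-by-16 : ∀ {q} → q % 16 ≡ 1 → q ≡ suc (4 ℕ.* (4 ℕ.* (q / 16)))
divide-by-16 {q} e = trans (m≡m%n+[m/n]*n q 16) (cong₂ ℕ._+_ e (trans (ℕ.*-comm (q / 16) 16) (ℕ.*-assoc 4 4 (q / 16))))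

entry-prime : ∀ t → ValidEntry t → Prime (proj₁ t) → proj₁ t % 16 ≡ 1 → ∃ λ F → IsRelDF 17 (proj₁ t) 17 1 F
entry-prime (suc n , i , x , y , z) v pr q%16 = certified-prime pr (suc n / 16) (divide-by-16 {suc n} q%16) i (1 ∷ x ∷ y ∷ z ∷ []) v

table-prime : ∀ {q} → Prime q → q % 16 ≡ 1 → InTable q → ∃ λ F → IsRelDF 17 q 17 1 F
table-prime {q} pr q%16 a = let t , t∈ , e = find a in
  subst (λ q → Prime q → q % 16 ≡ 1 → ∃ λ F → IsRelDF 17 q 17 1 F) e (entry-prime t (All.lookup table-valid t∈)) pr q%16

-- The odd primes below 100: a composite odd number up to 9857 < 100² is divisible by one of them.
small-divisors : List ℕ
small-divisors = 3 ∷ 5 ∷ 7 ∷ 11 ∷ 13 ∷ 17 ∷ 19 ∷ 23 ∷ 29 ∷ 31 ∷ 37 ∷ 41 ∷ 43 ∷ 47 ∷ 53 ∷ 59 ∷ 61 ∷ 67 ∷ 71 ∷ 73 ∷ 79 ∷ 83 ∷ 89 ∷ 97 ∷ []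

Covered : ℕ → Set
Covered q = q % 16 ≢ 1 ⊎ InTable q ⊎ Any (_∣ q) small-divisors

covered? : ∀ q → Dec (Covered q)
covered? q = ¬? (q % 16 ℕ.≟ 1) ⊎-dec (inTable? q ⊎-dec any? (_∣? q) small-divisors)

abstract
  -- The range contains 9857 - 6673 + 1 = 3185 numbers.
  range-covered : ∀ {n} → n < 3185 → Covered (6673 ℕ.+ n)
  range-covered = from-yes (ℕ.allUpTo? (λ n → covered? (6673 ℕ.+ n)) 3185)

small-divisor-bounds : All (λ d → 1 < d × d < 6673) small-divisors
small-divisor-bounds = from-yes (all? (λ d → 1 ℕ.<? d ×-dec d ℕ.<? 6673) small-divisors)

range-prime : ∀ {q} → Prime q → q % 16 ≡ 1 → 6673 ≤ q → q ≤ 9857 → ∃ λ F → IsRelDF 17 q 17 1 F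
range-prime {q} pr q%16 lo hi = go (subst Covered (ℕ.m+[n∸m]≡n lo) (range-covered (s≤s (ℕ.∸-monoˡ-≤ {q} 6673 hi))))
  where
  go : Covered q → ∃ λ F → IsRelDF 17 q 17 1 F
  go (inj₁ ≢1)       = ⊥-elim (≢1 q%16)
  go (inj₂ (inj₁ t)) = table-prime pr q%16 t
  go (inj₂ (inj₂ a)) = let d , d∈ , d∣q = find a ; 1<d , d<6673 = All.lookup small-divisor-bounds d∈ in
    impossible 1<d (ℕ.<-≤-trans d<6673 lo) (prime⇒irreducible pr d∣q)
    where
    impossible : ∀ {d} {A : Set} → 1 < d → d < q → d ≡ 1 ⊎ d ≡ q → A
    impossible 1<d d<q (inj₁ d≡1) = ⊥-elim (ℕ.<-irrefl (sym d≡1) 1<d)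
    impossible 1<d d<q (inj₂ d≡q) = ⊥-elim (ℕ.<-irrefl d≡q d<q)

-- x ↦ x² is planar modulo 17, so its graph alone is a difference family.
parabola : Block 17 17 17
parabola j = (toℕ j ℕ.* toℕ j) mod 17 , j

-- The points of the parabola with difference (a , b) have sum a / b.
chord : Grp 17 17 → Fin 17 × Fin 17
chord (a , b) = i , subMod i b
  where
  -- Modulo 17 the power b^15 is the inverse of b and 9 that of 2, so i is half of b + a / b.
  i = ((toℕ b ℕ.+ toℕ a ℕ.* toℕ b ℕ.^ 15) ℕ.* 9) mod 17

parabola-family : IsRelDF 17 17 17 1 (parabola ∷ [])
parabola-family = (λ e → cong proj₂ e) ∷ [] , λ g → zeros g , ones g
  where
  open Hits {A = ⊤} (λ _ → parabola)
  hits : ∀ i j → i ≡ j ⊎ toℕ (subMod i j) ≢ 0 × chord (parabola i -G parabola j) ≡ (i , j)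
  hits = from-yes (Fin.all? {17} λ i → Fin.all? {17} λ j → i Fin.≟ j ⊎-dec
    ¬? (toℕ (subMod i j) ℕ.≟ 0) ×-dec Product.≡-dec Fin._≟_ Fin._≟_ (chord (parabola i -G parabola j)) (i , j))
  chords : ∀ a b → toℕ b ≡ 0 ⊎ Hit (a , b) tt (proj₁ (chord (a , b))) (proj₂ (chord (a , b)))
  chords = from-yes (Fin.all? {17} λ a → Fin.all? {17} λ b → toℕ b ℕ.≟ 0 ⊎-dec
    ¬? (proj₁ (chord (a , b)) Fin.≟ proj₂ (chord (a , b))) ×-dec
    (parabola (proj₁ (chord (a , b))) -G parabola (proj₂ (chord (a , b)))) ≟G (a , b))
  hit-chord : ∀ {g} i j → Hit g tt i j → toℕ (proj₂ g) ≢ 0 × chord g ≡ (i , j)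
  hit-chord i j (i≢j , e) = subst (λ g → toℕ (proj₂ g) ≢ 0 × chord g ≡ (i , j)) e ([ (λ q → ⊥-elim (i≢j q)) , id ]′ (hits i j))
  zeros : ∀ g → InN g → diffCount (parabola ∷ []) g ≡ 0
  zeros g b≡0 = no-hit (tt ∷ []) g (λ _ i j h → proj₁ (hit-chord i j h) b≡0)
  ones : ∀ g → ¬ InN g → diffCount (parabola ∷ []) g ≡ 1
  ones g b≢0 = one-hit {tt ∷ []} g ([] ∷ []) (here refl) ([ (λ q → ⊥-elim (b≢0 q)) , id ]′ (chords (proj₁ g) (proj₂ g)))
    (λ _ i j h → let e = proj₂ (hit-chord i j h) in refl , cong proj₁ (sym e) , cong proj₂ (sym e))

listed : List ℕ
listed = 17 ∷ 881 ∷ 1297 ∷ 1601 ∷ 1873 ∷ 2017 ∷ 2129 ∷ 2657 ∷ 2753 ∷ 2801 ∷ 2897 ∷ 3089 ∷ 3121 ∷ 3217 ∷ 3313 ∷ 3361 ∷ 3617 ∷ 3697 ∷ 3761 ∷ 3793 ∷ 3889 ∷ 4001 ∷ 4049 ∷ 4129 ∷ 4241 ∷ 4273 ∷ 4289 ∷ 4481 ∷ 4561 ∷ 4657 ∷ 4721 ∷ 4801 ∷ 4817 ∷ 4993 ∷ 5009 ∷ 5233 ∷ 5281 ∷ 5297 ∷ 5393 ∷ 5441 ∷ 5521 ∷ 5569 ∷ 5857 ∷ 5953 ∷ 6113 ∷ 6257 ∷ 6337 ∷ 6449 ∷ 6529 ∷ []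

abstract
  listed-covered : All (λ q → q ≡ 17 ⊎ InTable q) listed
  listed-covered = from-yes (all? (λ q → q ℕ.≟ 17 ⊎-dec inTable? q) listed)

listed-prime : ∀ {q} → Prime q → q % 16 ≡ 1 → q ∈ listed → ∃ λ F → IsRelDF 17 q 17 1 F
listed-prime pr q%16 q∈ =
  [ (λ e → subst (λ q → ∃ λ F → IsRelDF 17 q 17 1 F) (sym e) (parabola ∷ [] , parabola-family)) , table-prime pr q%16 ]′
  (All.lookup listed-covered q∈)

theorem3p7 : (q : ℕ) → Prime q → q % 16 ≡ 1 →
    (GtQ 4 13 q
    ⊎ q ∈ (17 ∷ 881 ∷ 1297 ∷ 1601 ∷ 1873 ∷ 2017 ∷ 2129 ∷ 2657 ∷ 2753 ∷ 2801 ∷ 2897 ∷ 3089 ∷ 3121 ∷ 3217 ∷ 3313 ∷ 3361 ∷ 3617 ∷ 3697 ∷ 3761 ∷ 3793 ∷ 3889 ∷ 4001 ∷ 4049 ∷ 4129 ∷ 4241 ∷ 4273 ∷ 4289 ∷ 4481 ∷ 4561 ∷ 4657 ∷ 4721 ∷ 4801 ∷ 4817 ∷ 4993 ∷ 5009 ∷ 5233 ∷ 5281 ∷ 5297 ∷ 5393 ∷ 5441 ∷ 5521 ∷ 5569 ∷ 5857 ∷ 5953 ∷ 6113 ∷ 6257 ∷ 6337 ∷ 6449 ∷ 6529 ∷ [])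
    ⊎ (6673 ≤ q × q ≤ 9857)) →
    ∃ λ (F : List (Block 17 q 17)) → IsRelDF 17 q 17 1 F
theorem3p7 q pr q%16 (inj₁ large)            = large-prime pr (q / 16) (divide-by-16 q%16) large
theorem3p7 q pr q%16 (inj₂ (inj₁ q∈))        = listed-prime pr q%16 q∈
theorem3p7 q pr q%16 (inj₂ (inj₂ (lo , hi))) = range-prime pr q%16 lo hi
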